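{- Let $m\ge1$ and $P\ge3$ be two fixed integers. Let $s\in\mathcal{PS}=\mathcal{PS}(P)$ be a uniformly random $P$-angulated surface, of size $n$ if $P$ is even and of size $2n$ if $P$ is odd. Then, as $n\to\infty$, $\mathbb P(s\text{ has }m\text{ connected components})$ satisfies $$\mathbb P(s\text{ has }m\text{ connected components})\approx\begin{cases}\displaystyle\sum_{k\ge0}\mathfrak d_{k,m}(\mathcal{PS})\cdot\binom nk\cdot\frac{(P(n-k)-1)!!}{(Pn-1)!!}&\text{if }P\text{ is even},\\[2ex]\displaystyle\sum_{k\ge0}\mathfrak d_{2k,m}(\mathcal{PS})\cdot\binom{2n}{2k}\cdot\frac{(2P(n-k)-1)!!}{(2Pn-1)!!}&\text{if }P\text{ is odd},\end{cases}$$ where $$\begin{aligned}\mathfrak d_{k,m}(\mathcal{PS})&=\#\{(s',s'')\in\mathcal{PS}_i\cdot\mathcal{PS}_{k-i}\mid0\le i\le k,\ \pi_0(s')=m-1,\ \pi_0(s'')\text{ is even}\}\\&\quad-\#\{(s',s'')\in\mathcal{PS}_i\cdot\mathcal{PS}_{k-i}\mid0\le i\le k,\ \pi_0(s')=m-1,\ \pi_0(s'')\text{ is odd}\}\end{aligned}$$ and $\pi_0(s)$ is the number of connected components of the surface $s$.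
   Context: A $P$-angulated surface ($P$-angulation) of size $N$ is an oriented surface obtained by gluing $N$ unit $P$-gons along their sides; the $P$-gons are labeled by $[N]=\{1,\dots,N\}$ (or any set of size $N$), their sides are distinguishable, and any side may be glued to any other side. Combinatorially it is a perfect matching of the set of $PN$ polygon sides; so there are $(PN-1)!!$ of them if $PN$ is even and none if $PN$ is odd (with $(-1)!!=1$; for $N=0$ there is one, the empty surface, with $0$ components). Two polygons are in the same connected component if they are linked by a chain of polygons successively glued along sides. $\mathcal{PS}_i$ denotes $P$-angulated surfaces of size $i$; $(s',s'')\in\mathcal{PS}_i\cdot\mathcal{PS}_{k-i}$ means an ordered pair such that, for some decomposition $[k]=U'\sqcup U''$ with $|U'|=i$, $|U''|=k-i$, $s'$ is a $P$-angulated surface with polygons labeled by $U'$ and $s''$ one with polygons labeled by $U''$ (all decompositions are counted). Notation $\approx$: $p_n\approx\sum_{k\ge0}c_kg_k(n)$ (here $g_k(n)$ is the factor multiplying the coefficient $\mathfrak d_{k,m}$, resp. $\mathfrak d_{2k,m}$) means that $g_{k+1}(n)=o(g_k(n))$ for every $k$ and, for every integer $r\ge0$, $p_n=\sum_{k=0}^rc_kg_k(n)+O(g_{r+1}(n))$ as $n\to\infty$. -}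

module Defs where

open import Data.Fin using (Fin; toℕ; finToFun; quotient)
open import Data.Fin.Properties
  using (all?; any?; toℕ<n; toℕ-injective) renaming (_≟_ to _≟ᶠ_)
open import Data.Fin.Subset using (Subset; inside; outside; ⊤; ∁; ∣_∣; _∈_; _∉_)
open import Data.Fin.Subset.Properties using (_∈?_)
open import Data.Integer as ℤ using (ℤ)
open import Data.List
  using (List; []; _∷_; [_]; _++_; map; filter; length; foldr; concatMap;
         cartesianProduct; deduplicate; allFin; upTo)
open import Data.Nat using (ℕ; zero; suc; _+_; _*_; _∸_; _^_; _≤_; _<_; _≟_; s≤s⁻¹)
open import Data.Nat.Divisibility using (_∣_; _∣?_)
open import Data.Nat.Properties using (m≤n⇒m<n∨m≡n)
open import Data.Product using (∃-syntax; _×_; _,_)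
open import Data.Rational as ℚ using (ℚ; 0ℚ)
open import Data.Sum using (_⊎_; inj₁; inj₂)
import Data.Vec as Vec
open import Level using (0ℓ)
open import Relation.Binary using (Rel; Decidable)
open import Relation.Binary.Construct.Closure.ReflexiveTransitive using (Star; ε; _◅_; _◅◅_)
open import Relation.Binary.PropositionalEquality using (_≡_; _≢_; refl; sym; trans)
open import Relation.Nullary using (Dec; ¬_; ¬?)
open import Relation.Nullary.Decidable using (map′; _×-dec_; _⊎-dec_; _→-dec_)

module Reachability {n : ℕ} {R : Rel (Fin n) 0ℓ} (R? : Decidable R) where

  -- Via t u v: v is reachable from u through intermediate points < t.
  Via : ℕ → Rel (Fin n) 0ℓ
  Via zero    u v = u ≡ v ⊎ R u v
  Via (suc t) u v = Via t u v ⊎ (∃[ w ] toℕ w ≡ t × Via t u w × Via t w v)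

  via? : ∀ t → Decidable (Via t)
  via? zero    u v = (u ≟ᶠ v) ⊎-dec R? u v
  via? (suc t) u v =
    via? t u v ⊎-dec any? (λ w → (toℕ w ≟ t) ×-dec (via? t u w ×-dec via? t w v))

  via⇒star : ∀ t {u v} → Via t u v → Star R u v
  via⇒star zero    (inj₁ refl) = ε
  via⇒star zero    (inj₂ r)    = r ◅ ε
  via⇒star (suc t) (inj₁ p)    = via⇒star t p
  via⇒star (suc t) (inj₂ (w , _ , p , q)) = via⇒star t p ◅◅ via⇒star t q

  weaken : ∀ t {u v} → Via zero u v → Via t u v
  weaken zero    p = p
  weaken (suc t) p = inj₁ (weaken t p)

  same : ∀ {t} {p q : Fin n} → toℕ p ≡ t → toℕ q ≡ t → p ≡ q
  same e f = toℕ-injective (trans e (sym f))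

  via-trans : ∀ t {u w v} → toℕ w < t → Via t u w → Via t w v → Via t u v
  via-trans (suc t) w<1+t a b with m≤n⇒m<n∨m≡n (s≤s⁻¹ w<1+t)
  via-trans (suc t) _ (inj₁ a) (inj₁ b) | inj₁ w<t = inj₁ (via-trans t w<t a b)
  via-trans (suc t) _ (inj₁ a) (inj₂ (p , e , b , c)) | inj₁ w<t =
    inj₂ (p , e , via-trans t w<t a b , c)
  via-trans (suc t) _ (inj₂ (p , e , a , b)) (inj₁ c) | inj₁ w<t =
    inj₂ (p , e , a , via-trans t w<t b c)
  via-trans (suc t) _ (inj₂ (p , e , a , _)) (inj₂ (q , f , _ , d)) | inj₁ _
    with refl ← same e f = inj₂ (p , e , a , d)
  via-trans (suc t) {w = w} _ (inj₁ a) (inj₁ b) | inj₂ w≡t = inj₂ (w , w≡t , a , b)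
  via-trans (suc t) {w = w} _ (inj₁ a) (inj₂ (q , f , _ , d)) | inj₂ w≡t
    with refl ← same w≡t f = inj₂ (w , w≡t , a , d)
  via-trans (suc t) {w = w} _ (inj₂ (p , e , a , _)) (inj₁ c) | inj₂ w≡t
    with refl ← same w≡t e = inj₂ (p , e , a , c)
  via-trans (suc t) _ (inj₂ (p , e , a , _)) (inj₂ (q , f , _ , d)) | inj₂ _
    with refl ← same e f = inj₂ (p , e , a , d)

  star⇒via : ∀ {u v} → Star R u v → Via n u v
  star⇒via ε = weaken n (inj₁ refl)
  star⇒via (_◅_ {j = w} r rs) = via-trans n (toℕ<n w) (weaken n (inj₂ r)) (star⇒via rs)

  star? : Decidable (Star R)
  star? u v = map′ (via⇒star n) star⇒via (via? n u v)

Side : ℕ → ℕ → Set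
Side k P = Fin (k * P)

polygon : ∀ {k} P → Side k P → Fin k
polygon {k} P = quotient {k} P

-- A perfect matching of the sides of the polygons in U is encoded as an
-- involution of the sides of all k polygons whose fixed points are exactly
-- the sides of the polygons outside U.  (Such an involution automatically
-- maps the sides of the polygons in U to themselves.)
record IsSurface {k : ℕ} (P : ℕ) (U : Subset k) (s : Side k P → Side k P) : Set where
  constructor isSurface
  field
    involutive : ∀ x → s (s x) ≡ x
    glued      : ∀ x → polygon {k} P x ∈ U → s x ≢ x
    unused     : ∀ x → polygon {k} P x ∉ U → s x ≡ x

isSurface? : ∀ {k} P (U : Subset k) s → Dec (IsSurface P U s)
isSurface? {k} P U s = map′
  (λ (i , g , u) → isSurface i g u)
  (λ (isSurface i g u) → i , g , u)
  (all? (λ x → s (s x) ≟ᶠ x)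
   ×-dec all? (λ x → (polygon {k} P x ∈? U) →-dec ¬? (s x ≟ᶠ x))
   ×-dec all? (λ x → ¬? (polygon {k} P x ∈? U) →-dec (s x ≟ᶠ x)))

-- All surfaces with label set U, each listed once: finToFun is a bijection
-- onto the functions Side k P → Side k P up to pointwise equality.
surfaces : ∀ {k} P → Subset k → List (Side k P → Side k P)
surfaces {k} P U =
  filter (isSurface? P U) (map finToFun (allFin ((k * P) ^ (k * P))))

GluedTo : ∀ {k} P → (Side k P → Side k P) → Rel (Fin k) 0ℓ
GluedTo {k} P s u v = ∃[ x ] polygon {k} P x ≡ u × polygon {k} P (s x) ≡ v

gluedTo? : ∀ {k} P s → Decidable (GluedTo {k} P s)
gluedTo? {k} P s u v =
  any? (λ x → (polygon {k} P x ≟ᶠ u) ×-dec (polygon {k} P (s x) ≟ᶠ v))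

Connected : ∀ {k} P → (Side k P → Side k P) → Rel (Fin k) 0ℓ
Connected P s = Star (GluedTo P s)

connected? : ∀ {k} P s → Decidable (Connected {k} P s)
connected? P s = Reachability.star? (gluedTo? P s)

-- The number of classes of the relation Connected among the polygons in U:
-- deduplicate keeps one representative of each class.
π₀ : ∀ {k} P → Subset k → (Side k P → Side k P) → ℕ
π₀ {k} P U s = length (deduplicate (connected? P s) (filter (_∈? U) (allFin k)))

subsets : ∀ k → List (Subset k)
subsets zero    = [ Vec.[] ]
subsets (suc k) = map (outside Vec.∷_) (subsets k) ++ map (inside Vec.∷_) (subsets k)

-- A decomposition of the label set into U and ∁ U, with a surface on each part.
SurfacePair : ℕ → ℕ → Set
SurfacePair P k = Subset k × (Side k P → Side k P) × (Side k P → Side k P)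

surfacePairs : ∀ P k (i : ℕ) → List (SurfacePair P k)
surfacePairs P k i =
  concatMap (λ U → map (U ,_) (cartesianProduct (surfaces P U) (surfaces P (∁ U))))
            (filter (λ U → ∣ U ∣ ≟ i) (subsets k))

allSurfacePairs : ∀ P k → List (SurfacePair P k)
allSurfacePairs P k = concatMap (surfacePairs P k) (upTo (suc k))

EvenPair OddPair : ∀ {P k} (m : ℕ) → SurfacePair P k → Set
EvenPair {P} m (U , s′ , s″) = π₀ P U s′ ≡ m ∸ 1 × 2 ∣ π₀ P (∁ U) s″
OddPair  {P} m (U , s′ , s″) = π₀ P U s′ ≡ m ∸ 1 × ¬ 2 ∣ π₀ P (∁ U) s″

even? : ∀ {P k} m (t : SurfacePair P k) → Dec (EvenPair {P} m t)
even? {P} m (U , s′ , s″) = (π₀ P U s′ ≟ m ∸ 1) ×-dec (2 ∣? π₀ P (∁ U) s″)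

odd? : ∀ {P k} m (t : SurfacePair P k) → Dec (OddPair {P} m t)
odd? {P} m (U , s′ , s″) = (π₀ P U s′ ≟ m ∸ 1) ×-dec ¬? (2 ∣? π₀ P (∁ U) s″)

𝔡 : (P k m : ℕ) → ℤ
𝔡 P k m = ℤ.+ length (filter (even? {P} {k} m) (allSurfacePairs P k))
      ℤ.- ℤ.+ length (filter (odd?  {P} {k} m) (allSurfacePairs P k))

infixl 7 _//_

-- The quotient of two naturals, with the convention a // 0 = 0.
_//_ : ℕ → ℕ → ℚ
a // zero  = 0ℚ
a // suc b = ℤ.+ a ℚ./ suc b

-- The probability that a uniformly random surface of size N has m components.
-- (When P * N is odd there is no surface and the value is 0.)
ℙ[π₀≡_] : (m P N : ℕ) → ℚ
ℙ[π₀≡ m ] P N =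
  length (filter (λ s → π₀ P (⊤ {N}) s ≟ m) (surfaces P (⊤ {N}))) // length (surfaces P (⊤ {N}))

-- [ q -1]!! is (q - 1)!!, where (-1)!! = 0!! = 1.
[_-1]!! : ℕ → ℕ
[ zero        -1]!! = 1
[ suc zero    -1]!! = 1
[ suc (suc q) -1]!! = suc q * [ q -1]!!

Seq : Set
Seq = ℕ → ℚ

_=O_ : Rel Seq 0ℓ
f =O g = ∃[ C ] ∃[ n₀ ] ∀ n → n₀ ≤ n → ℚ.∣ f n ∣ ℚ.≤ C ℚ.* ℚ.∣ g n ∣

_=o_ : Rel Seq 0ℓ
f =o g = ∀ ε → 0ℚ ℚ.< ε → ∃[ n₀ ] ∀ n → n₀ ≤ n → ℚ.∣ f n ∣ ℚ.≤ ε ℚ.* ℚ.∣ g n ∣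

∑[k≤_] : ℕ → Seq → ℚ
∑[k≤ r ] a = foldr ℚ._+_ 0ℚ (map a (upTo (suc r)))

record AsymptoticExpansion (p : Seq) (c : ℕ → ℤ) (g : ℕ → Seq) : Set where
  field
    scale     : ∀ k → g (suc k) =o g k
    remainder : ∀ r → (λ n → p n ℚ.- ∑[k≤ r ] (λ k → (c k ℚ./ 1) ℚ.* g k n)) =O g (suc r)

{-# OPTIONS --safe #-}

-- Let w(n), α(m, n) and u(n) be the numbers of surfaces of size n, of those
-- with m components, and the signed number Σ (-1)^π₀.  Splitting off the
-- component of a given polygon gives, for exponential generating functions,
-- w′ = c′ w, α′ₘ₊₁ = c′ αₘ and u′ = - c′ u, with c counting connected surfaces.
-- Hence u w = 1 and, for D = z d/dz and d = αₘ u, D αₘ₊₁ = D w · d, where d has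
-- coefficients 𝔡.  Write f ∼ F when f(n) is expanded as Σ F(k) (n C k) w(n - k).
-- Since w grows superexponentially, in a product only the terms with one small
-- index matter, so F behaves as a derivation: f g ∼ f G + g F.  This gives
-- u ∼ - u², then an expansion of d from one of αₘ, and, with D αₘ₊₁ = D w · d,
-- finally αₘ₊₁ ∼ d, by induction on m.

module Submission where

open import Defs
open import Data.Bool as Bool using (Bool; true; false; if_then_else_)
open import Data.Empty using (⊥-elim)
open import Data.Fin using (Fin; zero; suc; finToFun; funToFin; combine; quotient; remQuot)
import Data.Fin.Properties as Fin
open import Data.Fin.Subset using (Subset; inside; outside; ∁; _∈_; _∉_; _⊆_; _─_; _-_; ∣_∣; ⊤)
import Data.Fin.Subset.Properties as Subset
open import Data.Integer as ℤ using (ℤ; +_; 0ℤ; 1ℤ; -1ℤ)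
  renaming (_+_ to _+ᶻ_; _*_ to _*ᶻ_; -_ to -ᶻ_; _-_ to _-ᶻ_)
import Data.Integer.Properties as ℤ
open import Data.Integer.Tactic.RingSolver using (solve-∀)
open import Data.List
  using (List; []; _∷_; _++_; map; filter; length; foldr; concatMap; cartesianProduct;
         deduplicate; allFin; tabulate; upTo; applyUpTo)
import Data.List.Membership.Propositional as List
import Data.List.Membership.Propositional.Properties as List
import Data.List.Properties as List
open import Data.List.Relation.Unary.All as All using (All; []; _∷_)
import Data.List.Relation.Unary.All.Properties as All
open import Data.Nat
  using (ℕ; zero; suc; _+_; _*_; _∸_; _^_; _≤_; _<_; _≟_; _!; _/_; NonZero;
         >-nonZero; ≢-nonZero⁻¹; z≤n; s≤s; s≤s⁻¹)
import Data.Nat.Properties as ℕ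
import Data.Nat.Tactic.RingSolver as ℕ-Solver
open import Data.Nat.Combinatorics
  using (_C_; nCk≡n!/k![n-k]!; k![n∸k]!∣n!; k>n⇒nCk≡0; nCk+nC[k+1]≡[n+1]C[k+1])
open import Data.Nat.DivMod using (m/n*n≡m)
open import Data.Nat.Divisibility
  using (_∣_; _∣?_; divides-refl; ∣⇒≤; ∣m+n∣m⇒∣n; ∣m∣n⇒∣m+n; m∣m*n; ∣-refl; _∣0; 1∣_)
open import Data.Nat.Primality using (euclidsLemma; prime[2])
open import Data.Product using (∃-syntax; _×_; _,_; proj₁; proj₂)
open import Data.Rational as ℚ using (ℚ; 0ℚ) renaming (_*_ to _*ℚ_)
import Data.Rational.Properties as ℚ
open import Data.Rational.Unnormalised as ℚᵘ using (mkℚᵘ; *≡*; *≤*)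
import Data.Rational.Unnormalised.Properties as ℚᵘ
open import Data.Sum using (inj₁; inj₂)
import Data.Vec as Vec
import Data.Vec.Properties as Vec
open import Function using (_∘_; id)
open import Relation.Binary.PropositionalEquality
open import Relation.Nullary using (Dec; yes; no; does; ¬_; ¬?)
open import Relation.Nullary.Decidable using (_×-dec_; _→-dec_; dec-true; dec-false)
open import Relation.Binary.Construct.Closure.ReflexiveTransitive as Star using (Star; ε; _◅_; _◅◅_)

-- Formally `w` = exp(`c`), and the series counting surfaces with m components is (log `w`)^m / m!.
-- The relation `f ∼ F` says that F is the derivative of f with respect to `w`: this explains -u²
-- for u = 1/w, and `α m ⋆ u` for `α (suc m)`. The derivation rule reaches products and the inverse,
-- but not a logarithm; so the expansion is integrated instead, and the factor n that `D` puts
-- before f pays for `D w` being n times as large as `W`. Counts are shown to depend on the number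
-- of labels alone without transporting surfaces along bijections: the recursion determines the
-- connected surfaces on a label set from smaller sets and from the number of all surfaces, which is
-- explicit, so an induction compares any two sets of equal size. The two parities of P are one
-- case. If sizes go up in steps of `e` and e P = 2 q, then P ≥ 3 becomes `e < q`; this makes `W`
-- outgrow (e n)! by a factor of at least n at the n-th step, and for this reason the middle terms
-- of a product are negligible.

interchange : ∀ a b c d → (a +ᶻ b) +ᶻ (c +ᶻ d) ≡ (a +ᶻ c) +ᶻ (b +ᶻ d)
interchange = solve-∀

-- Finite sums of integers

∑< : ℕ → (ℕ → ℤ) → ℤ
∑< zero    f = 0ℤ
∑< (suc n) f = f 0 +ᶻ ∑< n (f ∘ suc)

∑<-cong : ∀ n {f g} → (∀ i → i < n → f i ≡ g i) → ∑< n f ≡ ∑< n g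
∑<-cong zero    eq = refl
∑<-cong (suc n) eq = cong₂ _+ᶻ_ (eq 0 (s≤s z≤n)) (∑<-cong n (λ i i<n → eq (suc i) (s≤s i<n)))

∑<-+ : ∀ n f g → ∑< n (λ i → f i +ᶻ g i) ≡ ∑< n f +ᶻ ∑< n g
∑<-+ zero    f g = refl
∑<-+ (suc n) f g = trans (cong (f 0 +ᶻ g 0 +ᶻ_) (∑<-+ n (f ∘ suc) (g ∘ suc))) (interchange (f 0) (g 0) _ _)

∑<-last : ∀ n f → ∑< (suc n) f ≡ ∑< n f +ᶻ f n
∑<-last zero    f = ℤ.+-comm (f 0) 0ℤ
∑<-last (suc n) f = trans (cong (f 0 +ᶻ_) (∑<-last n (f ∘ suc))) (sym (ℤ.+-assoc (f 0) _ _))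

∑<-zero : ∀ n {f} → (∀ i → i < n → f i ≡ 0ℤ) → ∑< n f ≡ 0ℤ
∑<-zero zero    eq = refl
∑<-zero (suc n) eq = cong₂ _+ᶻ_ (eq 0 (s≤s z≤n)) (∑<-zero n (λ i i<n → eq (suc i) (s≤s i<n)))

-- The number of perfect matchings of n points. It is 0 at odd n, where `[_-1]!!` goes on with a
-- product; at even n the two agree.
matchings : ℕ → ℕ
matchings zero          = 1
matchings (suc zero)    = 0
matchings (suc (suc n)) = suc n * matchings n

choose-! : ∀ i j → ((i + j) C i) * (i ! * j !) ≡ (i + j) !
choose-! i j = begin-equality
  ((i + j) C i) * (i ! * j !)
    ≡⟨ cong (λ m → ((i + j) C i) * (i ! * m !)) (sym (ℕ.m+n∸m≡n i j)) ⟩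
  ((i + j) C i) * (i ! * (i + j ∸ i) !)
    ≡⟨ cong (_* (i ! * (i + j ∸ i) !)) (nCk≡n!/k![n-k]! (ℕ.m≤m+n i j)) ⟩
  (((i + j) !) / (i ! * (i + j ∸ i) !)) * (i ! * (i + j ∸ i) !)
    ≡⟨ m/n*n≡m (k![n∸k]!∣n! (ℕ.m≤m+n i j)) ⟩
  (i + j) ! ∎
  where
  open ℕ.≤-Reasoning
  instance _ = i ℕ.!* (i + j ∸ i) !≢0

-- The products (x+1)(x+2)...(x+l) and (x+1)(x+3)...(x+2l-1): the factors gained by x! and by
-- `matchings x` when the argument grows by l and by 2l.
rising oddRising : ℕ → ℕ → ℕ
rising x zero    = 1
rising x (suc l) = (x + l + 1) * rising x l
oddRising x zero    = 1
oddRising x (suc l) = (x + 2 * l + 1) * oddRising x l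

rising-! : ∀ x l → (l + x) ! ≡ rising x l * x !
rising-! x zero    = sym (ℕ.*-identityˡ (x !))
rising-! x (suc l) = trans (cong₂ _*_ (order x l) (rising-! x l)) (sym (ℕ.*-assoc (x + l + 1) (rising x l) (x !)))
  where
  order : ∀ x l → suc (l + x) ≡ x + l + 1
  order = ℕ-Solver.solve-∀

oddRising-matchings : ∀ x l → matchings (2 * l + x) ≡ oddRising x l * matchings x
oddRising-matchings x zero    = sym (ℕ.*-identityˡ (matchings x))
oddRising-matchings x (suc l) = begin-equality
  matchings (2 * suc l + x)                   ≡⟨ cong matchings (two x l) ⟩
  suc (2 * l + x) * matchings (2 * l + x)     ≡⟨ cong₂ _*_ (order x l) (oddRising-matchings x l) ⟩
  (x + 2 * l + 1) * (oddRising x l * matchings x) ≡⟨ sym (ℕ.*-assoc (x + 2 * l + 1) (oddRising x l) (matchings x)) ⟩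
  oddRising x (suc l) * matchings x           ∎
  where
  open ℕ.≤-Reasoning
  two : ∀ x l → 2 * suc l + x ≡ suc (suc (2 * l + x))
  two = ℕ-Solver.solve-∀
  order : ∀ x l → suc (2 * l + x) ≡ x + 2 * l + 1
  order = ℕ-Solver.solve-∀

rising-nonZero : ∀ x l → NonZero (rising x l)
rising-nonZero x zero    = _
rising-nonZero x (suc l) = ℕ.m*n≢0 (x + l + 1) (rising x l) {{>-nonZero (ℕ.m≤n+m 1 (x + l))}} {{rising-nonZero x l}}
oddRising-nonZero : ∀ x l → NonZero (oddRising x l)
oddRising-nonZero x zero    = _
oddRising-nonZero x (suc l) = ℕ.m*n≢0 (x + 2 * l + 1) (oddRising x l) {{>-nonZero (ℕ.m≤n+m 1 (x + 2 * l))}} {{oddRising-nonZero x l}}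

-- Growth of the number of surfaces

module Growth (e q : ℕ) (e<q : e < q) where

  e≤q : e ≤ q
  e≤q = ℕ.<⇒≤ e<q

  -- When e P = 2 q there are W i surfaces of size e i; τ and ρ are the ratios
  -- of successive values of (e i)! and W i.
  τ ρ W : ℕ → ℕ
  τ i = rising (e * i) e
  ρ i = oddRising (2 * (q * i)) q
  W i = matchings (2 * (q * i))

  W-suc : ∀ i → W (suc i) ≡ ρ i * W i
  W-suc i = trans (cong matchings (order q i)) (oddRising-matchings (2 * (q * i)) q)
    where
    order : ∀ q i → 2 * (q * suc i) ≡ 2 * q + 2 * (q * i)
    order = ℕ-Solver.solve-∀

  -- The ratio of the two products increases with its first argument: each
  -- factor of rising is matched with one of oddRising, the other k only grow.
  oddRising-rising : ∀ i j l k → i ≤ j →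
    oddRising (2 * (q * i)) (k + l) * rising (e * j) l ≤ oddRising (2 * (q * j)) (k + l) * rising (e * i) l
  oddRising-rising i j l (suc k) i≤j = begin
    (2 * (q * i) + 2 * (k + l) + 1) * oddRising (2 * (q * i)) (k + l) * rising (e * j) l
      ≡⟨ ℕ.*-assoc (2 * (q * i) + 2 * (k + l) + 1) _ _ ⟩
    (2 * (q * i) + 2 * (k + l) + 1) * (oddRising (2 * (q * i)) (k + l) * rising (e * j) l)
      ≤⟨ ℕ.*-mono-≤ (ℕ.+-monoˡ-≤ 1 (ℕ.+-monoˡ-≤ (2 * (k + l)) (ℕ.*-monoʳ-≤ 2 (ℕ.*-monoʳ-≤ q i≤j))))
                    (oddRising-rising i j l k i≤j) ⟩
    (2 * (q * j) + 2 * (k + l) + 1) * (oddRising (2 * (q * j)) (k + l) * rising (e * i) l)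
      ≡⟨ ℕ.*-assoc (2 * (q * j) + 2 * (k + l) + 1) _ _ ⟨
    (2 * (q * j) + 2 * (k + l) + 1) * oddRising (2 * (q * j)) (k + l) * rising (e * i) l ∎
    where open ℕ.≤-Reasoning 
  oddRising-rising i j zero    zero i≤j = ℕ.≤-refl
  oddRising-rising i j (suc l) zero i≤j = begin
    (2 * (q * i) + 2 * l + 1) * oddRising (2 * (q * i)) l * ((e * j + l + 1) * rising (e * j) l)
      ≡⟨ mid (2 * (q * i) + 2 * l + 1) (oddRising (2 * (q * i)) l) (e * j + l + 1) (rising (e * j) l) ⟩
    (2 * (q * i) + 2 * l + 1) * (e * j + l + 1) * (oddRising (2 * (q * i)) l * rising (e * j) l)
      ≤⟨ ℕ.*-mono-≤ factor (oddRising-rising i j l zero i≤j) ⟩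
    (2 * (q * j) + 2 * l + 1) * (e * i + l + 1) * (oddRising (2 * (q * j)) l * rising (e * i) l)
      ≡⟨ mid (2 * (q * j) + 2 * l + 1) (oddRising (2 * (q * j)) l) (e * i + l + 1) (rising (e * i) l) ⟨
    (2 * (q * j) + 2 * l + 1) * oddRising (2 * (q * j)) l * ((e * i + l + 1) * rising (e * i) l) ∎
    where
    open ℕ.≤-Reasoning 
    mid : ∀ a b c d → (a * b) * (c * d) ≡ (a * c) * (b * d)
    mid = ℕ-Solver.solve-∀
    split : ∀ x δ q e l → (2 * (q * x) + 2 * l + 1) * (e * (x + δ) + l + 1) ≡
      (2 * (q * x) + 2 * l + 1) * (e * x + l + 1) + (2 * (q * x * (e * δ)) + e * (2 * l + 1) * δ)
    split = ℕ-Solver.solve-∀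
    split′ : ∀ x δ q e l → (2 * (q * (x + δ)) + 2 * l + 1) * (e * x + l + 1) ≡
      (2 * (q * x) + 2 * l + 1) * (e * x + l + 1) + (2 * (q * x * (e * δ)) + q * (2 * l + 2) * δ)
    split′ = ℕ-Solver.solve-∀
    -- Writing j = i + δ, the two products expand to a common part plus e (2l+1) δ on the left and q
    -- (2l+2) δ on the right.
    factor : (2 * (q * i) + 2 * l + 1) * (e * j + l + 1) ≤ (2 * (q * j) + 2 * l + 1) * (e * i + l + 1)
    factor = subst (λ j → (2 * (q * i) + 2 * l + 1) * (e * j + l + 1) ≤ (2 * (q * j) + 2 * l + 1) * (e * i + l + 1))
      (ℕ.m+[n∸m]≡n i≤j) (begin
        (2 * (q * i) + 2 * l + 1) * (e * (i + (j ∸ i)) + l + 1)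
          ≡⟨ split i (j ∸ i) q e l ⟩
        (2 * (q * i) + 2 * l + 1) * (e * i + l + 1) + (2 * (q * i * (e * (j ∸ i))) + e * (2 * l + 1) * (j ∸ i))
          ≤⟨ ℕ.+-monoʳ-≤ ((2 * (q * i) + 2 * l + 1) * (e * i + l + 1)) (ℕ.+-monoʳ-≤ (2 * (q * i * (e * (j ∸ i))))
               (ℕ.*-monoˡ-≤ (j ∸ i) (ℕ.*-mono-≤ e≤q (ℕ.+-monoʳ-≤ (2 * l) (s≤s (z≤n {1})))))) ⟩
        (2 * (q * i) + 2 * l + 1) * (e * i + l + 1) + (2 * (q * i * (e * (j ∸ i))) + q * (2 * l + 2) * (j ∸ i))
          ≡⟨ split′ i (j ∸ i) q e l ⟨
        (2 * (q * (i + (j ∸ i))) + 2 * l + 1) * (e * i + l + 1) ∎)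

  -- The case of e matched factors and q - e surplus ones: the sequence W i / (e i)! is log-convex.
  ρτ-mono : ∀ {i j} → i ≤ j → ρ i * τ j ≤ ρ j * τ i
  ρτ-mono {i} {j} i≤j =
    subst (λ m → oddRising (2 * (q * i)) m * τ j ≤ oddRising (2 * (q * j)) m * τ i)
          (ℕ.m∸n+n≡m e≤q) (oddRising-rising i j e (q ∸ e) i≤j)

  rising≤oddRising : ∀ j l → rising (e * j) l ≤ oddRising (2 * (q * j)) l
  rising≤oddRising j zero    = ℕ.≤-refl
  rising≤oddRising j (suc l) = ℕ.*-mono-≤
    (ℕ.+-monoˡ-≤ 1 (ℕ.+-mono-≤ (ℕ.≤-trans (ℕ.*-monoˡ-≤ j e≤q) (ℕ.m≤m+n (q * j) _)) (ℕ.m≤m+n l _)))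
    (rising≤oddRising j l)

  -- This is where q > e is needed.
  iτ≤ρ : ∀ i → i * τ i ≤ ρ i
  iτ≤ρ i = subst (λ m → i * τ i ≤ oddRising (2 * (q * i)) m) (ℕ.m∸n+n≡m e<q) (extend (q ∸ suc e))
    where
    open ℕ.≤-Reasoning 
    extend : ∀ k → i * τ i ≤ oddRising (2 * (q * i)) (k + suc e)
    -- As e < q, `ρ i` has at least e + 1 factors: the first e dominate `τ i`, and the next one, 2 q
    -- i + 2 e + 1, is at least i.
    extend zero = ℕ.*-mono-≤ (begin
      i                          ≡⟨ ℕ.*-identityˡ i ⟨
      1 * i                      ≤⟨ ℕ.*-monoˡ-≤ i (ℕ.≤-trans (s≤s z≤n) e<q) ⟩
      q * i                      ≤⟨ ℕ.m≤m+n (q * i) _ ⟩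
      2 * (q * i)                ≤⟨ ℕ.m≤m+n _ (2 * e) ⟩
      2 * (q * i) + 2 * e        ≤⟨ ℕ.m≤m+n _ 1 ⟩
      2 * (q * i) + 2 * e + 1    ∎) (rising≤oddRising i e)
    extend (suc k) = begin
      i * τ i                                             ≤⟨ extend k ⟩
      oddRising (2 * (q * i)) (k + suc e)                 ≡⟨ ℕ.*-identityˡ _ ⟨
      1 * oddRising (2 * (q * i)) (k + suc e)             ≤⟨ ℕ.*-monoˡ-≤ (oddRising (2 * (q * i)) (k + suc e)) (ℕ.m≤n+m 1 (2 * (q * i) + 2 * (k + suc e))) ⟩
      oddRising (2 * (q * i)) (suc k + suc e)             ∎

  B : ℕ → ℕ → ℕ
  B n i = (e * n) C (e * i)

  B-! : ∀ i j → B (i + j) i * ((e * i) ! * (e * j) !) ≡ (e * (i + j)) !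
  B-! i j = subst (λ m → (m C (e * i)) * ((e * i) ! * (e * j) !) ≡ m !) (sym (ℕ.*-distribˡ-+ e i j)) (choose-! (e * i) (e * j))

  cancel-!! : ∀ {x y} i j → x * (i ! * j !) ≡ y * (i ! * j !) → x ≡ y
  cancel-!! {x} {y} i j = ℕ.*-cancelʳ-≡ x y (i ! * j !) {{i ℕ.!* j !≢0}}

  B-zero : ∀ n → B n 0 ≡ 1
  B-zero n = cong ((e * n) C_) (ℕ.*-zeroʳ e)

  B-sym : ∀ i j → B (i + j) i ≡ B (i + j) j
  B-sym i j = cancel-!! (e * i) (e * j) (begin-equality
    B (i + j) i * ((e * i) ! * (e * j) !)  ≡⟨ B-! i j ⟩
    (e * (i + j)) !                        ≡⟨ cong (λ n → (e * n) !) (ℕ.+-comm i j) ⟩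
    (e * (j + i)) !                        ≡⟨ B-! j i ⟨
    B (j + i) j * ((e * j) ! * (e * i) !)  ≡⟨ cong₂ (λ n x → B n j * x) (ℕ.+-comm j i) (ℕ.*-comm ((e * j) !) ((e * i) !)) ⟩
    B (i + j) j * ((e * i) ! * (e * j) !)  ∎)
    where open ℕ.≤-Reasoning

  -- Both sides are the multinomial coefficient of (e i, e j, e l): multiplied by the three
  -- factorials, each gives (e n)!.
  B-trinomial : ∀ i j l → B (i + (j + l)) i * B (j + l) j ≡ B (i + (j + l)) (i + j) * B (i + j) i
  B-trinomial i j l = ℕ.*-cancelʳ-≡ _ _ (a * b * c)
    {{ℕ.m*n≢0 (a * b) c {{(e * i) ℕ.!* (e * j) !≢0}} {{(e * l) ℕ.!≢0}}}} (begin-equality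
    B n i * B (j + l) j * (a * b * c)       ≡⟨ shuffle₁ (B n i) (B (j + l) j) a b c ⟩
    B n i * (a * (B (j + l) j * (b * c)))   ≡⟨ cong (λ x → B n i * (a * x)) (B-! j l) ⟩
    B n i * (a * (e * (j + l)) !)           ≡⟨ B-! i (j + l) ⟩
    (e * n) !                               ≡⟨ cong (λ m → (e * m) !) (ℕ.+-assoc i j l) ⟨
    (e * (i + j + l)) !                     ≡⟨ B-! (i + j) l ⟨
    B (i + j + l) (i + j) * ((e * (i + j)) ! * c)
      ≡⟨ cong₂ (λ m x → B m (i + j) * (x * c)) (ℕ.+-assoc i j l) (sym (B-! i j)) ⟩
    B n (i + j) * (B (i + j) i * (a * b) * c)
      ≡⟨ shuffle₂ (B n (i + j)) (B (i + j) i) a b c ⟩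
    B n (i + j) * B (i + j) i * (a * b * c) ∎)
    where
    open ℕ.≤-Reasoning
    n = i + (j + l)
    a = (e * i) !
    b = (e * j) !
    c = (e * l) !
    shuffle₁ : ∀ x y a b c → x * y * (a * b * c) ≡ x * (a * (y * (b * c)))
    shuffle₁ = ℕ-Solver.solve-∀
    shuffle₂ : ∀ x y a b c → x * (y * (a * b) * c) ≡ x * y * (a * b * c)
    shuffle₂ = ℕ-Solver.solve-∀

  [e*suc]! : ∀ i → (e * suc i) ! ≡ τ i * (e * i) !
  [e*suc]! i = trans (cong _! (ℕ.*-suc e i)) (rising-! (e * i) e)

  B-step : ∀ i j → B (i + suc j) (suc i) * τ i ≡ B (i + suc j) i * τ j
  B-step i j = cancel-!! (e * i) (e * j) (begin-equality
    B n (suc i) * τ i * (a * b)                ≡⟨ shuffle₁ (B n (suc i)) (τ i) a b ⟩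
    B n (suc i) * (τ i * a * b)                ≡⟨ cong₂ (λ m x → B m (suc i) * (x * b)) (ℕ.+-suc i j) (sym ([e*suc]! i)) ⟩
    B (suc i + j) (suc i) * ((e * suc i) ! * b) ≡⟨ B-! (suc i) j ⟩
    (e * (suc i + j)) !                        ≡⟨ cong (λ m → (e * m) !) (ℕ.+-suc i j) ⟨
    (e * n) !                                  ≡⟨ B-! i (suc j) ⟨
    B n i * (a * (e * suc j) !)                ≡⟨ cong (λ x → B n i * (a * x)) ([e*suc]! j) ⟩
    B n i * (a * (τ j * b))                    ≡⟨ shuffle₂ (B n i) (τ j) a b ⟩
    B n i * τ j * (a * b)                      ∎)
    where
    open ℕ.≤-Reasoning
    n = i + suc j
    a = (e * i) !
    b = (e * j) !
    shuffle₁ : ∀ x y a b → x * y * (a * b) ≡ x * (y * a * b)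
    shuffle₁ = ℕ-Solver.solve-∀
    shuffle₂ : ∀ x y a b → x * (a * (y * b)) ≡ x * y * (a * b)
    shuffle₂ = ℕ-Solver.solve-∀

  instance
    τ-nonZero : ∀ {i} → NonZero (τ i)
    τ-nonZero {i} = rising-nonZero (e * i) e
    ρ-nonZero : ∀ {i} → NonZero (ρ i)
    ρ-nonZero {i} = oddRising-nonZero (2 * (q * i)) q

  -- The number of ordered pairs of surfaces of sizes e i and e j whose label sets partition e (i +
  -- j) labels. Up to a constant it bounds the terms of any product of two sequences of order `W`.
  g : ℕ → ℕ → ℕ
  g i j = B (i + j) i * (W i * W j)

  g-sym : ∀ i j → g i j ≡ g j i
  g-sym i j = cong₂ _*_ (trans (B-sym i j) (cong (λ n → B n j) (ℕ.+-comm i j))) (ℕ.*-comm (W i) (W j))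

  -- The ratio of neighbouring values is (ρ i / τ i) / (ρ j / τ j), in cross-multiplied form to stay
  -- within ℕ.
  g-step : ∀ i j → g (suc i) j * (τ i * ρ j) ≡ g i (suc j) * (τ j * ρ i)
  g-step i j = begin-equality
    B (suc i + j) (suc i) * (W (suc i) * W j) * (τ i * ρ j)
      ≡⟨ cong₂ (λ n x → B n (suc i) * (x * W j) * (τ i * ρ j)) (sym (ℕ.+-suc i j)) (W-suc i) ⟩
    B (i + suc j) (suc i) * (ρ i * W i * W j) * (τ i * ρ j)
      ≡⟨ shuffle₁ (B (i + suc j) (suc i)) (ρ i) (W i) (W j) (τ i) (ρ j) ⟩
    B (i + suc j) (suc i) * τ i * (ρ i * (W i * (ρ j * W j)))
      ≡⟨ cong₂ (λ x y → x * (ρ i * (W i * y))) (B-step i j) (sym (W-suc j)) ⟩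
    B (i + suc j) i * τ j * (ρ i * (W i * W (suc j)))
      ≡⟨ shuffle₂ (B (i + suc j) i) (τ j) (ρ i) (W i) (W (suc j)) ⟩
    B (i + suc j) i * (W i * W (suc j)) * (τ j * ρ i) ∎
    where
    open ℕ.≤-Reasoning
    shuffle₁ : ∀ a b c d t r → a * (b * c * d) * (t * r) ≡ a * t * (b * (c * (r * d)))
    shuffle₁ = ℕ-Solver.solve-∀
    shuffle₂ : ∀ a t b c d → a * t * (b * (c * d)) ≡ a * (c * d) * (t * b)
    shuffle₂ = ℕ-Solver.solve-∀

  g-antitone : ∀ {i j} → i ≤ j → g (suc i) j ≤ g i (suc j)
  g-antitone {i} {j} i≤j = ℕ.*-cancelʳ-≤ _ _ (τ i * ρ j) {{ℕ.m*n≢0 (τ i) (ρ j)}} (begin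
    g (suc i) j * (τ i * ρ j)  ≡⟨ g-step i j ⟩
    g i (suc j) * (τ j * ρ i)  ≡⟨ cong (g i (suc j) *_) (ℕ.*-comm (τ j) (ρ i)) ⟩
    g i (suc j) * (ρ i * τ j)  ≤⟨ ℕ.*-monoʳ-≤ (g i (suc j)) (ρτ-mono i≤j) ⟩
    g i (suc j) * (ρ j * τ i)  ≡⟨ cong (g i (suc j) *_) (ℕ.*-comm (ρ j) (τ i)) ⟩
    g i (suc j) * (τ i * ρ j)  ∎)
    where open ℕ.≤-Reasoning

  -- Iterates `g-antitone`: for a fixed sum of indices, raising the smaller one towards the middle
  -- only decreases `g`.
  g-unimodal : ∀ d a j → a + d ≤ j → g (a + d) j ≤ g a (d + j)
  g-unimodal zero    a j _  = ℕ.≤-reflexive (cong (λ i → g i j) (ℕ.+-identityʳ a))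
  g-unimodal (suc d) a j le = begin
    g (a + suc d) j      ≡⟨ cong (λ i → g i j) (ℕ.+-suc a d) ⟩
    g (suc (a + d)) j    ≤⟨ g-antitone (ℕ.≤-trans (ℕ.+-monoʳ-≤ a (ℕ.n≤1+n d)) le) ⟩
    g (a + d) (suc j)    ≤⟨ g-unimodal d a (suc j) (ℕ.≤-trans (ℕ.≤-trans (ℕ.+-monoʳ-≤ a (ℕ.n≤1+n d)) le) (ℕ.n≤1+n j)) ⟩
    g a (d + suc j)      ≡⟨ cong (g a) (ℕ.+-suc d j) ⟩
    g a (suc d + j)      ∎
    where open ℕ.≤-Reasoning

  decay : ℕ → ℕ
  decay a = (a + 2) * ρ a

  -- One step inwards from the edge gains a full factor n = a + 1 + j. The ratio is at most ρ a / j
  -- because j τ j ≤ ρ j and τ a ≥ 1, and n ≤ (a + 2) j turns 1 / j into (a + 2) / n; hence the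
  -- constant `decay a`.
  g-decay : ∀ a j → 1 ≤ j → (suc a + j) * g (suc a) j ≤ decay a * g a (suc j)
  g-decay a j 1≤j = ℕ.*-cancelʳ-≤ _ _ (τ a * ρ j) {{ℕ.m*n≢0 (τ a) (ρ j)}} (begin
    (suc a + j) * g (suc a) j * (τ a * ρ j)       ≡⟨ ℕ.*-assoc (suc a + j) (g (suc a) j) (τ a * ρ j) ⟩
    (suc a + j) * (g (suc a) j * (τ a * ρ j))     ≡⟨ cong ((suc a + j) *_) (g-step a j) ⟩
    (suc a + j) * (g a (suc j) * (τ j * ρ a))     ≤⟨ ℕ.*-monoˡ-≤ (g a (suc j) * (τ j * ρ a)) bound ⟩
    (a + 2) * j * (g a (suc j) * (τ j * ρ a))     ≡⟨ shuffle₁ (a + 2) j (g a (suc j)) (τ j) (ρ a) ⟩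
    (a + 2) * ρ a * g a (suc j) * (1 * (j * τ j)) ≤⟨ ℕ.*-monoʳ-≤ ((a + 2) * ρ a * g a (suc j))
                                                      (ℕ.*-mono-≤ (ℕ.n≢0⇒n>0 (≢-nonZero⁻¹ (τ a))) (iτ≤ρ j)) ⟩
    (a + 2) * ρ a * g a (suc j) * (τ a * ρ j)     ∎)
    where
    open ℕ.≤-Reasoning
    shuffle₁ : ∀ x j y t r → x * j * (y * (t * r)) ≡ x * r * y * (1 * (j * t))
    shuffle₁ = ℕ-Solver.solve-∀
    bound : suc a + j ≤ (a + 2) * j
    bound = begin
      suc a + j             ≡⟨ cong (_+ j) (ℕ.*-identityʳ (suc a)) ⟨
      suc a * 1 + j         ≤⟨ ℕ.+-monoˡ-≤ j (ℕ.*-monoʳ-≤ (suc a) 1≤j) ⟩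
      suc a * j + j         ≡⟨ shuffle₂ a j ⟩
      (a + 2) * j           ∎
      where
      shuffle₂ : ∀ a j → suc a * j + j ≡ (a + 2) * j
      shuffle₂ = ℕ-Solver.solve-∀

  -- Unimodality moves the smaller of the two indices down to a + 1, and `g-decay` makes the last
  -- step to a. Since fewer than n such pairs have sum n, all of them together weigh at most a
  -- constant times the edge term.
  g-interior : ∀ a d d′ → (suc a + d + (suc a + d′)) * g (suc a + d) (suc a + d′) ≤ decay a * g a (suc (d + (suc a + d′)))
  g-interior a d d′ with ℕ.≤-total (suc a + d) (suc a + d′)
  ... | inj₁ i≤j = half d (suc a + d′) i≤j (s≤s z≤n)
    where
    open ℕ.≤-Reasoning
    half : ∀ d j → suc a + d ≤ j → 1 ≤ j → (suc a + d + j) * g (suc a + d) j ≤ decay a * g a (suc (d + j))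
    half d j i≤j 1≤j = begin
      (suc a + d + j) * g (suc a + d) j    ≤⟨ ℕ.*-monoʳ-≤ (suc a + d + j) (g-unimodal d (suc a) j i≤j) ⟩
      (suc a + d + j) * g (suc a) (d + j)  ≡⟨ cong (_* g (suc a) (d + j)) (ℕ.+-assoc (suc a) d j) ⟩
      (suc a + (d + j)) * g (suc a) (d + j) ≤⟨ g-decay a (d + j) (ℕ.≤-trans 1≤j (ℕ.m≤n+m j d)) ⟩
      decay a * g a (suc (d + j))          ∎
  ... | inj₂ j≤i = begin
      (suc a + d + (suc a + d′)) * g (suc a + d) (suc a + d′)
        ≡⟨ cong₂ _*_ (ℕ.+-comm (suc a + d) (suc a + d′)) (g-sym (suc a + d) (suc a + d′)) ⟩
      (suc a + d′ + (suc a + d)) * g (suc a + d′) (suc a + d)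
        ≤⟨ ℕ.*-monoʳ-≤ (suc a + d′ + (suc a + d)) (g-unimodal d′ (suc a) (suc a + d) j≤i) ⟩
      (suc a + d′ + (suc a + d)) * g (suc a) (d′ + (suc a + d))
        ≡⟨ cong (_* g (suc a) (d′ + (suc a + d))) (ℕ.+-assoc (suc a) d′ (suc a + d)) ⟩
      (suc a + (d′ + (suc a + d))) * g (suc a) (d′ + (suc a + d))
        ≤⟨ g-decay a (d′ + (suc a + d)) (ℕ.≤-trans (s≤s z≤n) (ℕ.m≤n+m (suc a + d) d′)) ⟩
      decay a * g a (suc (d′ + (suc a + d)))
        ≡⟨ cong (λ m → decay a * g a (suc m)) (swap d′ a d) ⟩
      decay a * g a (suc (d + (suc a + d′))) ∎
    where
    open ℕ.≤-Reasoning
    swap : ∀ x a y → x + (suc a + y) ≡ y + (suc a + x)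
    swap = ℕ-Solver.solve-∀

  -- Successive scales of the expansion have a ratio of at most 1 / j, again by j τ j ≤ ρ j.
  BW-step : ∀ k j → j * (B (k + suc j) (suc k) * W j) ≤ B (k + suc j) k * W (suc j)
  BW-step k j = ℕ.*-cancelʳ-≤ _ _ (τ k) (begin
    j * (B n (suc k) * W j) * τ k    ≡⟨ shuffle₁ j (B n (suc k)) (W j) (τ k) ⟩
    j * (B n (suc k) * τ k) * W j    ≡⟨ cong (λ x → j * x * W j) (B-step k j) ⟩
    j * (B n k * τ j) * W j          ≡⟨ shuffle₂ j (B n k) (τ j) (W j) ⟩
    B n k * W j * (j * τ j)          ≤⟨ ℕ.*-monoʳ-≤ (B n k * W j) (iτ≤ρ j) ⟩
    B n k * W j * ρ j                ≡⟨ shuffle₃ (B n k) (W j) (ρ j) ⟩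
    B n k * (ρ j * W j) * 1          ≤⟨ ℕ.*-mono-≤ (ℕ.≤-reflexive (cong (B n k *_) (sym (W-suc j)))) (ℕ.n≢0⇒n>0 (≢-nonZero⁻¹ (τ k))) ⟩
    B n k * W (suc j) * τ k          ∎)
    where
    open ℕ.≤-Reasoning
    n = k + suc j
    shuffle₁ : ∀ j b w t → j * (b * w) * t ≡ j * (b * t) * w
    shuffle₁ = ℕ-Solver.solve-∀
    shuffle₂ : ∀ j b t w → j * (b * t) * w ≡ b * w * (j * t)
    shuffle₂ = ℕ-Solver.solve-∀
    shuffle₃ : ∀ b w r → b * w * r ≡ b * (r * w) * 1
    shuffle₃ = ℕ-Solver.solve-∀

-- Rearrangement and estimates of finite sums

∑<-*ˡ : ∀ c n f → ∑< n (λ i → c *ᶻ f i) ≡ c *ᶻ ∑< n f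
∑<-*ˡ c zero    f = sym (ℤ.*-zeroʳ c)
∑<-*ˡ c (suc n) f = trans (cong (c *ᶻ f 0 +ᶻ_) (∑<-*ˡ c n (f ∘ suc))) (sym (ℤ.*-distribˡ-+ c (f 0) _))

∑<-split : ∀ a b f → ∑< (a + b) f ≡ ∑< a f +ᶻ ∑< b (λ i → f (a + i))
∑<-split zero    b f = sym (ℤ.+-identityˡ _)
∑<-split (suc a) b f = trans (cong (f 0 +ᶻ_) (∑<-split a b (f ∘ suc))) (sym (ℤ.+-assoc (f 0) _ _))

∑<-reverse : ∀ n f → ∑< (suc n) f ≡ ∑< (suc n) (λ i → f (n ∸ i))
∑<-reverse zero    f = refl
∑<-reverse (suc n) f = begin
  f 0 +ᶻ ∑< (suc n) (f ∘ suc)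
    ≡⟨ cong (f 0 +ᶻ_) (∑<-reverse n (f ∘ suc)) ⟩
  f 0 +ᶻ ∑< (suc n) (λ i → f (suc (n ∸ i)))
    ≡⟨ ℤ.+-comm (f 0) _ ⟩
  ∑< (suc n) (λ i → f (suc (n ∸ i))) +ᶻ f 0
    ≡⟨ cong₂ _+ᶻ_ (∑<-cong (suc n) (λ i i<n → cong f (sym (ℕ.+-∸-assoc 1 (s≤s⁻¹ i<n))))) (cong f (sym (ℕ.n∸n≡0 n))) ⟩
  ∑< (suc n) (λ i → f (suc n ∸ i)) +ᶻ f (suc n ∸ suc n)
    ≡⟨ ∑<-last (suc n) (λ i → f (suc n ∸ i)) ⟨
  ∑< (suc (suc n)) (λ i → f (suc n ∸ i)) ∎
  where open ≡-Reasoning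

-- The pairs (i, j) with i + j ≤ r, by rows on the left and by diagonals t = i + j on the right.
∑<-triangle : ∀ r (F : ℕ → ℕ → ℤ) →
  ∑< (suc r) (λ i → ∑< (suc (r ∸ i)) (F i)) ≡ ∑< (suc r) (λ t → ∑< (suc t) (λ i → F i (t ∸ i)))
∑<-triangle zero    F = refl
∑<-triangle (suc r) F = begin
  (F 0 0 +ᶻ ∑< (suc r) (F 0 ∘ suc)) +ᶻ ∑< (suc r) (λ i → ∑< (suc (r ∸ i)) (F (suc i)))
    ≡⟨ cong ((F 0 0 +ᶻ ∑< (suc r) (F 0 ∘ suc)) +ᶻ_) (∑<-triangle r (F ∘ suc)) ⟩
  (F 0 0 +ᶻ ∑< (suc r) (F 0 ∘ suc)) +ᶻ ∑< (suc r) (λ t → ∑< (suc t) (λ i → F (suc i) (t ∸ i)))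
    ≡⟨ reassoc (F 0 0) _ _ ⟩
  (F 0 0 +ᶻ 0ℤ) +ᶻ (∑< (suc r) (F 0 ∘ suc) +ᶻ ∑< (suc r) (λ t → ∑< (suc t) (λ i → F (suc i) (t ∸ i))))
    ≡⟨ cong (F 0 0 +ᶻ 0ℤ +ᶻ_) (∑<-+ (suc r) (F 0 ∘ suc) (λ t → ∑< (suc t) (λ i → F (suc i) (t ∸ i)))) ⟨
  ∑< (suc (suc r)) (λ t → ∑< (suc t) (λ i → F i (t ∸ i))) ∎
  where
  open ≡-Reasoning
  reassoc : ∀ a b c → (a +ᶻ b) +ᶻ c ≡ (a +ᶻ 0ℤ) +ᶻ (b +ᶻ c)
  reassoc = solve-∀

-- The bound X / n on a term is kept multiplied by n, which is cancelled only after the number m of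
-- terms has been compared with n.
∣∑<∣≤ : ∀ n m {X} (f : ℕ → ℤ) → (∀ i → i < m → n * ℤ.∣ f i ∣ ≤ X) → n * ℤ.∣ ∑< m f ∣ ≤ m * X
∣∑<∣≤ n zero        f le = ℕ.≤-reflexive (ℕ.*-zeroʳ n)
∣∑<∣≤ n (suc m) {X} f le = begin
  n * ℤ.∣ f 0 +ᶻ ∑< m (f ∘ suc) ∣               ≤⟨ ℕ.*-monoʳ-≤ n (ℤ.∣i+j∣≤∣i∣+∣j∣ (f 0) _) ⟩
  n * (ℤ.∣ f 0 ∣ + ℤ.∣ ∑< m (f ∘ suc) ∣)        ≡⟨ ℕ.*-distribˡ-+ n _ _ ⟩
  n * ℤ.∣ f 0 ∣ + n * ℤ.∣ ∑< m (f ∘ suc) ∣      ≤⟨ ℕ.+-mono-≤ (le 0 (s≤s z≤n)) (∣∑<∣≤ n m (f ∘ suc) (λ i i<m → le (suc i) (s≤s i<m))) ⟩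
  X + m * X                                     ∎
  where open ℕ.≤-Reasoning

infix 4 _≐_
-- Wrapped in a record so that the two sequences can be inferred from the type of a proof.
record _≐_ (x y : ℕ → ℤ) : Set where
  constructor pointwise
  field at : ∀ n → x n ≡ y n
open _≐_

infixr 5 _⟫_
_⟫_ : ∀ {x y z} → x ≐ y → y ≐ z → x ≐ z
(p ⟫ q) .at n = trans (p .at n) (q .at n)

≐-sym : ∀ {x y} → x ≐ y → y ≐ x
≐-sym p .at n = sym (p .at n)

≐-refl : ∀ {x} → x ≐ x
≐-refl .at _ = refl

-- Truncated and full binomial convolution

module Convolution (e q : ℕ) (e<q : e < q) where

  open Growth e q e<q

  -- One operation for two purposes: at r = n it is the product of exponential generating functions
  -- in powers of z^e, and for y = `w` it is the expansion of order r with coefficients x.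
  T : ℕ → (ℕ → ℤ) → (ℕ → ℤ) → ℕ → ℤ
  T r x y n = ∑< (suc r) (λ i → + B n i *ᶻ (x i *ᶻ y (n ∸ i)))

  term : (ℕ → ℤ) → (ℕ → ℤ) → ℕ → ℕ → ℤ
  term x y n i = + B n i *ᶻ (x i *ᶻ y (n ∸ i))

  infixl 7 _⋆_
  _⋆_ : (ℕ → ℤ) → (ℕ → ℤ) → ℕ → ℤ
  (x ⋆ y) n = T n x y n

  infixl 6 _⊕_
  _⊕_ : (ℕ → ℤ) → (ℕ → ℤ) → ℕ → ℤ
  (x ⊕ y) n = x n +ᶻ y n

  infix 8 ⊖_
  ⊖_ : (ℕ → ℤ) → ℕ → ℤ
  (⊖ x) n = -ᶻ x n

  δ : ℕ → ℤ
  δ zero    = 1ℤ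
  δ (suc _) = 0ℤ

  𝟎 : ℕ → ℤ
  𝟎 _ = 0ℤ

  D : (ℕ → ℤ) → ℕ → ℤ
  D x n = + n *ᶻ x n

  T-cong : ∀ r {x x′ y y′ : ℕ → ℤ} → x ≐ x′ → y ≐ y′ → T r x y ≐ T r x′ y′
  T-cong r eq eq′ .at n = ∑<-cong (suc r) (λ i _ → cong₂ (λ a b → + B n i *ᶻ (a *ᶻ b)) (eq .at i) (eq′ .at (n ∸ i)))

  ⋆-cong : ∀ {x x′ y y′ : ℕ → ℤ} → x ≐ x′ → y ≐ y′ → x ⋆ y ≐ x′ ⋆ y′
  ⋆-cong eq eq′ .at n = T-cong n eq eq′ .at n

  ⋆-congʳ : ∀ x {y y′} → y ≐ y′ → x ⋆ y ≐ x ⋆ y′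
  ⋆-congʳ x = ⋆-cong (≐-refl {x})

  ⋆-congˡ : ∀ y {x x′} → x ≐ x′ → x ⋆ y ≐ x′ ⋆ y
  ⋆-congˡ y eq = ⋆-cong eq (≐-refl {y})

  term-sym : ∀ (x y : ℕ → ℤ) {n i} → i ≤ n → term x y n (n ∸ i) ≡ term y x n i
  term-sym x y {n} {i} i≤n = cong₂ _*ᶻ_
    (cong +_ (sym (subst (λ m → B m i ≡ B m (n ∸ i)) (ℕ.m+[n∸m]≡n i≤n) (B-sym i (n ∸ i)))))
    (trans (cong (λ j → x (n ∸ i) *ᶻ y j) (ℕ.m∸[m∸n]≡n i≤n)) (ℤ.*-comm (x (n ∸ i)) (y i)))

  ⋆-comm : ∀ x y → x ⋆ y ≐ y ⋆ x
  ⋆-comm x y .at n = trans (∑<-reverse n (term x y n))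
    (∑<-cong (suc n) (λ i i<n → term-sym x y (s≤s⁻¹ i<n)))

  -- Associativity that respects truncation: the condition j ≤ r - i on a pair (i, j) concerns only
  -- i + j, so summing along diagonals gives `x ⋆ y` truncated at r.
  T-regroup : ∀ x y z r n → r ≤ n →
    ∑< (suc r) (λ i → + B n i *ᶻ (x i *ᶻ T (r ∸ i) y z (n ∸ i))) ≡ T r (x ⋆ y) z n
  T-regroup x y z r n r≤n = begin
    ∑< (suc r) (λ i → + B n i *ᶻ (x i *ᶻ T (r ∸ i) y z (n ∸ i)))
      ≡⟨ ∑<-cong (suc r) (λ i _ → trans (cong (+ B n i *ᶻ_) (sym (∑<-*ˡ (x i) (suc (r ∸ i)) (term y z (n ∸ i)))))
           (sym (∑<-*ˡ (+ B n i) (suc (r ∸ i)) (λ j → x i *ᶻ term y z (n ∸ i) j)))) ⟩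
    ∑< (suc r) (λ i → ∑< (suc (r ∸ i)) (F i))
      ≡⟨ ∑<-triangle r F ⟩
    ∑< (suc r) (λ t → ∑< (suc t) (λ i → F i (t ∸ i)))
      ≡⟨ ∑<-cong (suc r) (λ t t<r → trans (∑<-cong (suc t) (λ i i<t → entry t i (s≤s⁻¹ i<t) (ℕ.≤-trans (s≤s⁻¹ t<r) r≤n)))
           (trans (∑<-*ˡ (+ B n t) (suc t) (λ i → term x y t i *ᶻ z (n ∸ t))) (cong (+ B n t *ᶻ_)
             (trans (trans (∑<-cong (suc t) (λ i _ → ℤ.*-comm (+ B t i *ᶻ (x i *ᶻ y (t ∸ i))) (z (n ∸ t)))) (∑<-*ˡ (z (n ∸ t)) (suc t) (term x y t)))
                    (ℤ.*-comm (z (n ∸ t)) ((x ⋆ y) t)))))) ⟩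
    T r (x ⋆ y) z n ∎
    where
    open ≡-Reasoning
    F : ℕ → ℕ → ℤ
    F i j = + B n i *ᶻ (x i *ᶻ (+ B (n ∸ i) j *ᶻ (y j *ᶻ z (n ∸ i ∸ j))))
    entry : ∀ t i → i ≤ t → t ≤ n → F i (t ∸ i) ≡ + B n t *ᶻ ((+ B t i *ᶻ (x i *ᶻ y (t ∸ i))) *ᶻ z (n ∸ t))
    entry t i i≤t t≤n = begin
      + B n i *ᶻ (x i *ᶻ (+ B (n ∸ i) (t ∸ i) *ᶻ (y (t ∸ i) *ᶻ z (n ∸ i ∸ (t ∸ i)))))
        ≡⟨ shuffle₁ (+ B n i) (x i) (+ B (n ∸ i) (t ∸ i)) (y (t ∸ i)) (z (n ∸ i ∸ (t ∸ i))) ⟩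
      (+ B n i *ᶻ + B (n ∸ i) (t ∸ i)) *ᶻ ((x i *ᶻ y (t ∸ i)) *ᶻ z (n ∸ i ∸ (t ∸ i)))
        ≡⟨ cong₂ (λ a b → a *ᶻ ((x i *ᶻ y (t ∸ i)) *ᶻ z b))
             (trans (sym (ℤ.pos-* (B n i) (B (n ∸ i) (t ∸ i)))) (trans (cong +_ trinomial) (ℤ.pos-* (B n t) (B t i))))
             (trans (ℕ.∸-+-assoc n i (t ∸ i)) (cong (n ∸_) (ℕ.m+[n∸m]≡n i≤t))) ⟩
      (+ B n t *ᶻ + B t i) *ᶻ ((x i *ᶻ y (t ∸ i)) *ᶻ z (n ∸ t))
        ≡⟨ shuffle₂ (+ B n t) (+ B t i) (x i *ᶻ y (t ∸ i)) (z (n ∸ t)) ⟩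
      + B n t *ᶻ ((+ B t i *ᶻ (x i *ᶻ y (t ∸ i))) *ᶻ z (n ∸ t)) ∎
      where
      shuffle₁ : ∀ a b c d e → a *ᶻ (b *ᶻ (c *ᶻ (d *ᶻ e))) ≡ (a *ᶻ c) *ᶻ ((b *ᶻ d) *ᶻ e)
      shuffle₁ = solve-∀
      shuffle₂ : ∀ a b c d → (a *ᶻ b) *ᶻ (c *ᶻ d) ≡ a *ᶻ ((b *ᶻ c) *ᶻ d)
      shuffle₂ = solve-∀
      reindex : ∀ {j l t′ m} → i + j ≡ t′ → t′ + l ≡ m → B m i * B (m ∸ i) j ≡ B m t′ * B t′ i
      reindex {j} {l} refl refl = begin
        B (i + j + l) i * B (i + j + l ∸ i) j
          ≡⟨ cong₂ (λ m m′ → B m i * B m′ j) (ℕ.+-assoc i j l) (trans (cong (_∸ i) (ℕ.+-assoc i j l)) (ℕ.m+n∸m≡n i (j + l))) ⟩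
        B (i + (j + l)) i * B (j + l) j
          ≡⟨ B-trinomial i j l ⟩
        B (i + (j + l)) (i + j) * B (i + j) i
          ≡⟨ cong (λ m → B m (i + j) * B (i + j) i) (ℕ.+-assoc i j l) ⟨
        B (i + j + l) (i + j) * B (i + j) i ∎
      trinomial : B n i * B (n ∸ i) (t ∸ i) ≡ B n t * B t i
      trinomial = reindex (ℕ.m+[n∸m]≡n i≤t) (ℕ.m+[n∸m]≡n t≤n)

  ⋆-assoc : ∀ x y z → x ⋆ (y ⋆ z) ≐ (x ⋆ y) ⋆ z
  ⋆-assoc x y z .at n = T-regroup x y z n n ℕ.≤-refl

  T-⊕ʳ : ∀ r x y z → T r x (y ⊕ z) ≐ T r x y ⊕ T r x z
  T-⊕ʳ r x y z .at n = trans (∑<-cong (suc r) (λ i _ → expand (+ B n i) (x i) (y (n ∸ i)) (z (n ∸ i)))) (∑<-+ (suc r) (term x y n) (term x z n))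
    where
    expand : ∀ a b c d → a *ᶻ (b *ᶻ (c +ᶻ d)) ≡ a *ᶻ (b *ᶻ c) +ᶻ a *ᶻ (b *ᶻ d)
    expand = solve-∀

  T-⊕ˡ : ∀ r x y z → T r (x ⊕ y) z ≐ T r x z ⊕ T r y z
  T-⊕ˡ r x y z .at n = trans (∑<-cong (suc r) (λ i _ → expand (+ B n i) (x i) (y i) (z (n ∸ i)))) (∑<-+ (suc r) (term x z n) (term y z n))
    where
    expand : ∀ a b c d → a *ᶻ ((b +ᶻ c) *ᶻ d) ≡ a *ᶻ (b *ᶻ d) +ᶻ a *ᶻ (c *ᶻ d)
    expand = solve-∀

  T-⊖ˡ : ∀ r x y → T r (⊖ x) y ≐ ⊖ T r x y
  T-⊖ˡ r x y .at n = trans (∑<-cong (suc r) (λ i _ → pull (+ B n i) (x i) (y (n ∸ i))))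
                       (trans (∑<-*ˡ -1ℤ (suc r) (term x y n)) (ℤ.-1*i≡-i _))
    where
    pull : ∀ a b c → a *ᶻ (-ᶻ b *ᶻ c) ≡ -1ℤ *ᶻ (a *ᶻ (b *ᶻ c))
    pull = solve-∀

  ⋆-⊖ʳ : ∀ x y → x ⋆ ⊖ y ≐ ⊖ (x ⋆ y)
  ⋆-⊖ʳ x y .at n = trans (⋆-comm x (⊖ y) .at n) (trans (T-⊖ˡ n y x .at n) (cong -ᶻ_ (⋆-comm y x .at n)))

  ⋆-⊖ˡ : ∀ x y → ⊖ x ⋆ y ≐ ⊖ (x ⋆ y)
  ⋆-⊖ˡ x y .at n = T-⊖ˡ n x y .at n

  T-δ : ∀ r x → T r δ x ≐ x
  T-δ r x .at n = trans (cong₂ _+ᶻ_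
      (trans (cong (λ b → + b *ᶻ (1ℤ *ᶻ x n)) (B-zero n)) (trans (ℤ.*-identityˡ (1ℤ *ᶻ x n)) (ℤ.*-identityˡ (x n))))
      (∑<-zero r (λ i _ → trans (cong (+ B n (suc i) *ᶻ_) (ℤ.*-zeroˡ (x (n ∸ suc i)))) (ℤ.*-zeroʳ (+ B n (suc i))))))
    (ℤ.+-identityʳ (x n))

  ⋆-identityˡ : ∀ x → δ ⋆ x ≐ x
  ⋆-identityˡ x .at n = T-δ n x .at n

  ⋆-identityʳ : ∀ x → x ⋆ δ ≐ x
  ⋆-identityʳ x .at n = trans (⋆-comm x δ .at n) (⋆-identityˡ x .at n)

  ⋆-zeroˡ : ∀ x → 𝟎 ⋆ x ≐ 𝟎
  ⋆-zeroˡ x .at n = ∑<-zero (suc n) (λ i _ → trans (cong (+ B n i *ᶻ_) (ℤ.*-zeroˡ (x (n ∸ i)))) (ℤ.*-zeroʳ (+ B n i)))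

  -- The Leibniz rule holds term by term, from n = i + (n - i), hence at every truncation.
  T-D : ∀ r x y n → r ≤ n → + n *ᶻ T r x y n ≡ T r (D x) y n +ᶻ T r x (D y) n
  T-D r x y n r≤n = trans (sym (∑<-*ˡ (+ n) (suc r) (term x y n)))
    (trans (∑<-cong (suc r) (λ i i<r → entry i (ℕ.≤-trans (s≤s⁻¹ i<r) r≤n))) (∑<-+ (suc r) (term (D x) y n) (term x (D y) n)))
    where
    expand : ∀ a b p q r → (a +ᶻ b) *ᶻ (p *ᶻ (q *ᶻ r)) ≡ p *ᶻ ((a *ᶻ q) *ᶻ r) +ᶻ p *ᶻ (q *ᶻ (b *ᶻ r))
    expand = solve-∀
    entry : ∀ i → i ≤ n → + n *ᶻ (+ B n i *ᶻ (x i *ᶻ y (n ∸ i))) ≡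
                          + B n i *ᶻ (D x i *ᶻ y (n ∸ i)) +ᶻ + B n i *ᶻ (x i *ᶻ D y (n ∸ i))
    entry i i≤n = trans
      (cong (λ m → m *ᶻ (+ B n i *ᶻ (x i *ᶻ y (n ∸ i)))) (trans (cong +_ (sym (ℕ.m+[n∸m]≡n i≤n))) (ℤ.pos-+ i (n ∸ i))))
      (expand (+ i) (+ (n ∸ i)) (+ B n i) (x i) (y (n ∸ i)))

  D-⋆ : ∀ x y → D (x ⋆ y) ≐ D x ⋆ y ⊕ x ⋆ D y
  D-⋆ x y .at n = T-D n x y n ℕ.≤-refl

  ⊕-cong : ∀ {x x′ y y′} → x ≐ x′ → y ≐ y′ → x ⊕ y ≐ x′ ⊕ y′
  ⊕-cong p q .at n = cong₂ _+ᶻ_ (p .at n) (q .at n)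

  ⊕-comm : ∀ x y → x ⊕ y ≐ y ⊕ x
  ⊕-comm x y .at n = ℤ.+-comm (x n) (y n)

  ⋆-distribˡ-⊕ : ∀ x y z → x ⋆ (y ⊕ z) ≐ x ⋆ y ⊕ x ⋆ z
  ⋆-distribˡ-⊕ x y z .at n = T-⊕ʳ n x y z .at n

  ⋆-swap : ∀ x y z → x ⋆ (y ⋆ z) ≐ y ⋆ (x ⋆ z)
  ⋆-swap x y z = ⋆-assoc x y z ⟫ ⋆-congˡ z (⋆-comm x y) ⟫ ≐-sym (⋆-assoc y x z)

-- Sequences up to an error of given order

module Asymptotics (e q : ℕ) (e<q : e < q) where

  open Growth e q e<q
  open Convolution e q e<q

  -- The size of the first term omitted from an expansion of order r.
  E : ℕ → ℕ → ℕ
  E r n = B n (suc r) * W (n ∸ suc r)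

  infix 4 _≈[_]_
  record _≈[_]_ (X : ℕ → ℤ) (r : ℕ) (Y : ℕ → ℤ) : Set where
    constructor bound
    field
      const threshold : ℕ
      error≤ : ∀ n → threshold ≤ n → ℤ.∣ X n -ᶻ Y n ∣ ≤ const * E r n

  eventually : ∀ {X Y : ℕ → ℤ} {r} N → (∀ n → N ≤ n → X n ≡ Y n) → X ≈[ r ] Y
  eventually {X} N eq = bound 0 N (λ n N≤n → ℕ.≤-reflexive (cong ℤ.∣_∣ (ℤ.i≡j⇒i-j≡0 (eq n N≤n))))

  ≈-reflexive : ∀ {X Y r} → X ≐ Y → X ≈[ r ] Y
  ≈-reflexive eq = eventually 0 (λ n _ → eq .at n)

  ≈-combine : ∀ {X Y X′ Y′ : ℕ → ℤ} {r} (_∙_ : (x x′ : ℤ) → ℤ) →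
    (∀ x y x′ y′ → ℤ.∣ (x ∙ x′) -ᶻ (y ∙ y′) ∣ ≤ ℤ.∣ x -ᶻ y ∣ + ℤ.∣ x′ -ᶻ y′ ∣) →
    X ≈[ r ] Y → X′ ≈[ r ] Y′ → (λ n → X n ∙ X′ n) ≈[ r ] (λ n → Y n ∙ Y′ n)
  ≈-combine {X} {Y} {X′} {Y′} {r} _∙_ le (bound K N b) (bound K′ N′ b′) = bound (K + K′) (N + N′) λ n N≤n → begin
    ℤ.∣ (X n ∙ X′ n) -ᶻ (Y n ∙ Y′ n) ∣            ≤⟨ le (X n) (Y n) (X′ n) (Y′ n) ⟩
    ℤ.∣ X n -ᶻ Y n ∣ + ℤ.∣ X′ n -ᶻ Y′ n ∣          ≤⟨ ℕ.+-mono-≤ (b n (ℕ.≤-trans (ℕ.m≤m+n N N′) N≤n)) (b′ n (ℕ.≤-trans (ℕ.m≤n+m N′ N) N≤n)) ⟩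
    K * E r n + K′ * E r n                        ≡⟨ ℕ.*-distribʳ-+ (E r n) K K′ ⟨
    (K + K′) * E r n                              ∎
    where open ℕ.≤-Reasoning

  ≈-+ : ∀ {X Y X′ Y′ r} → X ≈[ r ] Y → X′ ≈[ r ] Y′ → X ⊕ X′ ≈[ r ] Y ⊕ Y′
  ≈-+ = ≈-combine _+ᶻ_ λ x y x′ y′ →
    subst (λ v → ℤ.∣ v ∣ ≤ ℤ.∣ x -ᶻ y ∣ + ℤ.∣ x′ -ᶻ y′ ∣) (regroup x y x′ y′) (ℤ.∣i+j∣≤∣i∣+∣j∣ (x -ᶻ y) (x′ -ᶻ y′))
    where
    regroup : ∀ x y x′ y′ → (x -ᶻ y) +ᶻ (x′ -ᶻ y′) ≡ (x +ᶻ x′) -ᶻ (y +ᶻ y′)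
    regroup = solve-∀

  ≈-- : ∀ {X Y X′ Y′ r} → X ≈[ r ] Y → X′ ≈[ r ] Y′ → (λ n → X n -ᶻ X′ n) ≈[ r ] (λ n → Y n -ᶻ Y′ n)
  ≈-- = ≈-combine _-ᶻ_ λ x y x′ y′ →
    subst (λ v → ℤ.∣ v ∣ ≤ ℤ.∣ x -ᶻ y ∣ + ℤ.∣ x′ -ᶻ y′ ∣) (regroup x y x′ y′) (ℤ.∣i-j∣≤∣i∣+∣j∣ (x -ᶻ y) (x′ -ᶻ y′))
    where
    regroup : ∀ x y x′ y′ → (x -ᶻ y) -ᶻ (x′ -ᶻ y′) ≡ (x -ᶻ x′) -ᶻ (y -ᶻ y′)
    regroup = solve-∀

  ≈-sym : ∀ {X Y r} → X ≈[ r ] Y → Y ≈[ r ] X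
  ≈-sym {X} {Y} {r} (bound K N b) = bound K N λ n N≤n → subst (_≤ K * E r n) (ℤ.∣i-j∣≡∣j-i∣ (X n) (Y n)) (b n N≤n)

  ≈-trans : ∀ {X Y Z r} → X ≈[ r ] Y → Y ≈[ r ] Z → X ≈[ r ] Z
  ≈-trans {X} {Y} {Z} {r} p q with ≈-+ p q
  ... | bound K N b = bound K N λ n N≤n → subst (λ v → ℤ.∣ v ∣ ≤ K * E r n) (cancel (X n) (Y n) (Z n)) (b n N≤n)
    where
    cancel : ∀ x y z → (x +ᶻ y) -ᶻ (y +ᶻ z) ≡ x -ᶻ z
    cancel = solve-∀

  ≈-∑ : ∀ {r} m (X Y : ℕ → ℕ → ℤ) → (∀ i → i < m → X i ≈[ r ] Y i) →
        (λ n → ∑< m (λ i → X i n)) ≈[ r ] (λ n → ∑< m (λ i → Y i n))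
  ≈-∑ zero    X Y le = ≈-reflexive ≐-refl
  ≈-∑ (suc m) X Y le = ≈-+ (le 0 (s≤s z≤n)) (≈-∑ m (X ∘ suc) (Y ∘ suc) (λ i i<m → le (suc i) (s≤s i<m)))

  -- By `B-trinomial`, choosing e i labels and then e (r + 1 - i) of the others amounts to choosing
  -- e (r + 1) and then e i among these. So an error of order r - i at n - i is one of order r at n,
  -- with a factor that does not depend on n.
  E-shift : ∀ {r n} i → i ≤ r → suc r ≤ n → B n i * E (r ∸ i) (n ∸ i) ≡ B (suc r) i * E r n
  E-shift {r} {n} i i≤r r<n = reindex (trans (ℕ.+-suc i (r ∸ i)) (cong suc (ℕ.m+[n∸m]≡n i≤r))) (ℕ.m+[n∸m]≡n r<n)
    where
    open ≡-Reasoning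
    reindex : ∀ {j l r′ m} → i + j ≡ r′ → r′ + l ≡ m →
         B m i * (B (m ∸ i) j * W (m ∸ i ∸ j)) ≡ B r′ i * (B m r′ * W (m ∸ r′))
    reindex {j} {l} refl refl = begin
      B (i + j + l) i * (B (i + j + l ∸ i) j * W (i + j + l ∸ i ∸ j))
        ≡⟨ cong (λ m → B (i + j + l) i * (B m j * W (m ∸ j))) (trans (cong (_∸ i) (ℕ.+-assoc i j l)) (ℕ.m+n∸m≡n i (j + l))) ⟩
      B (i + j + l) i * (B (j + l) j * W (j + l ∸ j))
        ≡⟨ cong₂ (λ m w → B m i * (B (j + l) j * W w)) (ℕ.+-assoc i j l) (trans (ℕ.m+n∸m≡n j l) (sym (ℕ.m+n∸m≡n (i + j) l))) ⟩
      B (i + (j + l)) i * (B (j + l) j * W (i + j + l ∸ (i + j)))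
        ≡⟨ ℕ.*-assoc (B (i + (j + l)) i) (B (j + l) j) _ ⟨
      B (i + (j + l)) i * B (j + l) j * W (i + j + l ∸ (i + j))
        ≡⟨ cong (_* W (i + j + l ∸ (i + j))) (B-trinomial i j l) ⟩
      B (i + (j + l)) (i + j) * B (i + j) i * W (i + j + l ∸ (i + j))
        ≡⟨ cong (λ m → B m (i + j) * B (i + j) i * W (i + j + l ∸ (i + j))) (ℕ.+-assoc i j l) ⟨
      B (i + j + l) (i + j) * B (i + j) i * W (i + j + l ∸ (i + j))
        ≡⟨ swap (B (i + j + l) (i + j)) (B (i + j) i) (W (i + j + l ∸ (i + j))) ⟩
      B (i + j) i * (B (i + j + l) (i + j) * W (i + j + l ∸ (i + j))) ∎
      where
      swap : ∀ a b c → a * b * c ≡ b * (a * c)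
      swap = ℕ-Solver.solve-∀

  ≈-shift : ∀ {X Y r} i a → i ≤ r → X ≈[ r ∸ i ] Y →
            (λ n → + B n i *ᶻ (a *ᶻ X (n ∸ i))) ≈[ r ] (λ n → + B n i *ᶻ (a *ᶻ Y (n ∸ i)))
  ≈-shift {X} {Y} {r} i a i≤r (bound K N b) = bound (ℤ.∣ a ∣ * K * B (suc r) i) (N + i + suc r) λ n N≤n → begin
    ℤ.∣ + B n i *ᶻ (a *ᶻ X (n ∸ i)) -ᶻ + B n i *ᶻ (a *ᶻ Y (n ∸ i)) ∣
      ≡⟨ cong ℤ.∣_∣ (factor (+ B n i) a (X (n ∸ i)) (Y (n ∸ i))) ⟩
    ℤ.∣ + B n i *ᶻ (a *ᶻ (X (n ∸ i) -ᶻ Y (n ∸ i))) ∣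
      ≡⟨ trans (ℤ.∣i*j∣≡∣i∣*∣j∣ (+ B n i) _) (cong (B n i *_) (ℤ.∣i*j∣≡∣i∣*∣j∣ a _)) ⟩
    B n i * (ℤ.∣ a ∣ * ℤ.∣ X (n ∸ i) -ᶻ Y (n ∸ i) ∣)
      ≤⟨ ℕ.*-monoʳ-≤ (B n i) (ℕ.*-monoʳ-≤ ℤ.∣ a ∣ (b (n ∸ i) (ℕ.m+n≤o⇒m≤o∸n N (ℕ.≤-trans (ℕ.m≤m+n (N + i) (suc r)) N≤n)))) ⟩
    B n i * (ℤ.∣ a ∣ * (K * E (r ∸ i) (n ∸ i)))
      ≡⟨ shuffle (B n i) ℤ.∣ a ∣ K (E (r ∸ i) (n ∸ i)) ⟩
    ℤ.∣ a ∣ * K * (B n i * E (r ∸ i) (n ∸ i))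
      ≡⟨ cong (ℤ.∣ a ∣ * K *_) (E-shift i i≤r (ℕ.≤-trans (ℕ.m≤n+m (suc r) (N + i)) N≤n)) ⟩
    ℤ.∣ a ∣ * K * (B (suc r) i * E r n)
      ≡⟨ ℕ.*-assoc (ℤ.∣ a ∣ * K) (B (suc r) i) (E r n) ⟨
    ℤ.∣ a ∣ * K * B (suc r) i * E r n ∎
    where
    open ℕ.≤-Reasoning
    factor : ∀ b a x y → b *ᶻ (a *ᶻ x) -ᶻ b *ᶻ (a *ᶻ y) ≡ b *ᶻ (a *ᶻ (x -ᶻ y))
    factor = solve-∀
    shuffle : ∀ b a k e → b * (a * (k * e)) ≡ a * k * (b * e)
    shuffle = ℕ-Solver.solve-∀

  ≈-convolve : ∀ (x : ℕ → ℤ) (X Y : ℕ → ℕ → ℤ) → (∀ r → X r ≈[ r ] Y r) → ∀ r →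
    (λ n → ∑< (suc r) (λ i → + B n i *ᶻ (x i *ᶻ X (r ∸ i) (n ∸ i)))) ≈[ r ]
    (λ n → ∑< (suc r) (λ i → + B n i *ᶻ (x i *ᶻ Y (r ∸ i) (n ∸ i))))
  ≈-convolve x X Y le r = ≈-∑ (suc r)
    (λ i n → + B n i *ᶻ (x i *ᶻ X (r ∸ i) (n ∸ i)))
    (λ i n → + B n i *ᶻ (x i *ᶻ Y (r ∸ i) (n ∸ i)))
    (λ i i<r → ≈-shift {X (r ∸ i)} {Y (r ∸ i)} i (x i) (s≤s⁻¹ i<r) (le (r ∸ i)))

  w : ℕ → ℤ
  w n = + W n

  infix 4 _∼_
  _∼_ : (ℕ → ℤ) → (ℕ → ℤ) → Set
  f ∼ F = ∀ r → f ≈[ r ] T r F w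

  -- It is enough to expand f to order r - i at n - i; `T-regroup` assembles these expansions into
  -- one of order r.
  T-∼ : ∀ x {f F} → f ∼ F → ∀ r → T r x f ≈[ r ] T r (x ⋆ F) w
  T-∼ x {f} {F} f∼F r = ≈-trans (≈-convolve x (λ _ → f) (λ r → T r F w) f∼F r)
    (eventually r (λ n r≤n → T-regroup x F w r n r≤n))

  -- The two end terms are at most the edge value each; the interior terms, at most n in number, are
  -- at most decay a / n times it. Hence the constant 2 + decay a.
  middle-≤ : ∀ a l M (h : ℕ → ℤ) → (∀ i i′ → i + i′ ≡ l → ℤ.∣ h i ∣ ≤ M * g (a + i) (a + i′)) →
             ℤ.∣ ∑< (suc l) h ∣ ≤ (2 + decay a) * (M * g a (a + l))
  middle-≤ a zero M h le = begin
    ℤ.∣ h 0 +ᶻ 0ℤ ∣                     ≡⟨ cong ℤ.∣_∣ (ℤ.+-identityʳ (h 0)) ⟩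
    ℤ.∣ h 0 ∣                           ≤⟨ le 0 0 refl ⟩
    M * g (a + 0) (a + 0)               ≡⟨ cong (λ i → M * g i (a + 0)) (ℕ.+-identityʳ a) ⟩
    M * g a (a + 0)                     ≤⟨ ℕ.m≤m+n _ _ ⟩
    (2 + decay a) * (M * g a (a + 0))   ∎
    where open ℕ.≤-Reasoning
  middle-≤ a (suc l) M h le = begin
    ℤ.∣ h 0 +ᶻ ∑< (suc l) (h ∘ suc) ∣
      ≤⟨ ℤ.∣i+j∣≤∣i∣+∣j∣ (h 0) _ ⟩
    ℤ.∣ h 0 ∣ + ℤ.∣ ∑< (suc l) (h ∘ suc) ∣
      ≡⟨ cong (λ v → ℤ.∣ h 0 ∣ + ℤ.∣ v ∣) (∑<-last l (h ∘ suc)) ⟩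
    ℤ.∣ h 0 ∣ + ℤ.∣ ∑< l (h ∘ suc) +ᶻ h (suc l) ∣
      ≤⟨ ℕ.+-monoʳ-≤ ℤ.∣ h 0 ∣ (ℤ.∣i+j∣≤∣i∣+∣j∣ (∑< l (h ∘ suc)) (h (suc l))) ⟩
    ℤ.∣ h 0 ∣ + (ℤ.∣ ∑< l (h ∘ suc) ∣ + ℤ.∣ h (suc l) ∣)
      ≤⟨ ℕ.+-mono-≤ first (ℕ.+-mono-≤ interior last) ⟩
    G + (decay a * G + G)
      ≡⟨ collect G (decay a) ⟩
    (2 + decay a) * G ∎
    where
    open ℕ.≤-Reasoning
    G n : ℕ
    G = M * g a (a + suc l)
    n = suc a + (a + l)
    collect : ∀ G d → G + (d * G + G) ≡ (2 + d) * G
    collect = ℕ-Solver.solve-∀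
    first : ℤ.∣ h 0 ∣ ≤ G
    first = subst (λ i → ℤ.∣ h 0 ∣ ≤ M * g i (a + suc l)) (ℕ.+-identityʳ a) (le 0 (suc l) refl)
    last : ℤ.∣ h (suc l) ∣ ≤ G
    last = begin
      ℤ.∣ h (suc l) ∣               ≤⟨ le (suc l) 0 (ℕ.+-identityʳ (suc l)) ⟩
      M * g (a + suc l) (a + 0)     ≡⟨ cong (M *_) (g-sym (a + suc l) (a + 0)) ⟩
      M * g (a + 0) (a + suc l)     ≡⟨ cong (λ i → M * g i (a + suc l)) (ℕ.+-identityʳ a) ⟩
      G                             ∎
    each : ∀ d → d < l → n * ℤ.∣ h (suc d) ∣ ≤ decay a * G
    each d d<l = begin
      n * ℤ.∣ h (suc d) ∣
        ≤⟨ ℕ.*-monoʳ-≤ n (le (suc d) (suc d′) (cong suc (trans (ℕ.+-suc d d′) l≡))) ⟩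
      n * (M * g (a + suc d) (a + suc d′))
        ≡⟨ cong₂ (λ i j → n * (M * g i j)) (ℕ.+-suc a d) (ℕ.+-suc a d′) ⟩
      n * (M * g (suc a + d) (suc a + d′))
        ≡⟨ pull n M _ ⟩
      M * (n * g (suc a + d) (suc a + d′))
        ≡⟨ cong (λ m → M * (m * g (suc a + d) (suc a + d′))) (trans (cong (λ m → suc a + (a + m)) (sym l≡)) (size a d d′)) ⟩
      M * ((suc a + d + (suc a + d′)) * g (suc a + d) (suc a + d′))
        ≤⟨ ℕ.*-monoʳ-≤ M (g-interior a d d′) ⟩
      M * (decay a * g a (suc (d + (suc a + d′))))
        ≡⟨ cong (λ m → M * (decay a * g a m)) (trans (size′ a d d′) (cong (λ m → a + suc m) l≡)) ⟩
      M * (decay a * g a (a + suc l))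
        ≡⟨ pull M (decay a) _ ⟩
      decay a * G ∎
      where
      d′ : ℕ
      d′ = l ∸ suc d
      l≡ : suc (d + d′) ≡ l
      l≡ = ℕ.m+[n∸m]≡n d<l
      pull : ∀ a b c → a * (b * c) ≡ b * (a * c)
      pull = ℕ-Solver.solve-∀
      size : ∀ a d d′ → suc a + (a + suc (d + d′)) ≡ suc a + d + (suc a + d′)
      size = ℕ-Solver.solve-∀
      size′ : ∀ a d d′ → suc (d + (suc a + d′)) ≡ a + suc (suc (d + d′))
      size′ = ℕ-Solver.solve-∀
    interior : ℤ.∣ ∑< l (h ∘ suc) ∣ ≤ decay a * G
    -- There are l interior terms and l ≤ n, so the factor n cancels.
    interior = ℕ.*-cancelˡ-≤ n (ℕ.≤-trans (∣∑<∣≤ n l (h ∘ suc) each)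
      (ℕ.*-monoˡ-≤ (decay a * G) (ℕ.m≤n⇒m≤o+n (suc a) (ℕ.m≤n+m l a))))

  -- The terms of f ⋆ g with both indices larger than r are negligible.
  split : ∀ r l M f f′ → (∀ i j → i + j ≡ suc r + (l + suc r) → ℤ.∣ f i *ᶻ f′ j ∣ ≤ M * (W i * W j)) →
    let n = suc r + (l + suc r) in
    ℤ.∣ (f ⋆ f′) n -ᶻ (T r f f′ n +ᶻ T r f′ f n) ∣ ≤ (2 + decay (suc r)) * W (suc r) * (M * E r n)
  split r l M f f′ le = begin
    ℤ.∣ (f ⋆ f′) n -ᶻ (T r f f′ n +ᶻ T r f′ f n) ∣
      ≡⟨ cong ℤ.∣_∣ decompose ⟩
    ℤ.∣ ∑< (suc l) h ∣
      ≤⟨ middle-≤ a l M h small ⟩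
    (2 + decay a) * (M * (B (a + (a + l)) a * (W a * W (a + l))))
      ≡⟨ cong₂ (λ m j → (2 + decay a) * (M * (B m a * (W a * W j)))) (cong (λ m → a + m) (ℕ.+-comm a l))
           (trans (ℕ.+-comm a l) (sym (ℕ.m+n∸m≡n a (l + a)))) ⟩
    (2 + decay a) * (M * (B n a * (W a * W (n ∸ a))))
      ≡⟨ shuffle (2 + decay a) M (B n a) (W a) (W (n ∸ a)) ⟩
    (2 + decay a) * W a * (M * E r n) ∎
    where
    open ℕ.≤-Reasoning
    a n : ℕ
    a = suc r
    n = a + (l + a)
    h : ℕ → ℤ
    h i = term f f′ n (a + i)
    shuffle : ∀ c m b x y → c * (m * (b * (x * y))) ≡ c * x * (m * (b * y))
    shuffle = ℕ-Solver.solve-∀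
    small : ∀ i i′ → i + i′ ≡ l → ℤ.∣ h i ∣ ≤ M * g (a + i) (a + i′)
    small i i′ refl = begin
      ℤ.∣ + B n (a + i) *ᶻ (f (a + i) *ᶻ f′ (n ∸ (a + i))) ∣
        ≡⟨ ℤ.∣i*j∣≡∣i∣*∣j∣ (+ B n (a + i)) _ ⟩
      B n (a + i) * ℤ.∣ f (a + i) *ᶻ f′ (n ∸ (a + i)) ∣
        ≤⟨ ℕ.*-monoʳ-≤ (B n (a + i)) (le (a + i) (n ∸ (a + i)) (trans (cong (λ m → a + i + m) n∸) n≡)) ⟩
      B n (a + i) * (M * (W (a + i) * W (n ∸ (a + i))))
        ≡⟨ cong₂ (λ m j → B m (a + i) * (M * (W (a + i) * W j))) (sym n≡) n∸ ⟩
      B (a + i + (a + i′)) (a + i) * (M * (W (a + i) * W (a + i′)))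
        ≡⟨ pull (B (a + i + (a + i′)) (a + i)) M _ ⟩
      M * g (a + i) (a + i′) ∎
      where
      n≡ : a + i + (a + i′) ≡ n
      n≡ = order a i i′
        where
        order : ∀ a i i′ → a + i + (a + i′) ≡ a + (i + i′ + a)
        order = ℕ-Solver.solve-∀
      n∸ : n ∸ (a + i) ≡ a + i′
      n∸ = trans (cong (_∸ (a + i)) (sym n≡)) (ℕ.m+n∸m≡n (a + i) (a + i′))
      pull : ∀ a b c → a * (b * c) ≡ b * (a * c)
      pull = ℕ-Solver.solve-∀
    -- The last r + 1 terms read backwards: by the symmetry of `B` they are the first r + 1 terms of
    -- `f′ ⋆ f`.
    upper : ∑< a (λ i → term f f′ n (a + (suc l + i))) ≡ T r f′ f n
    upper = trans (∑<-reverse r (λ i → term f f′ n (a + (suc l + i)))) (∑<-cong a λ i i<a →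
      trans (cong (term f f′ n) (index i i<a)) (term-sym f f′ (ℕ.≤-trans (ℕ.<⇒≤ i<a) (ℕ.m≤m+n a (l + a)))))
      where
      index : ∀ i → i < a → a + (suc l + (r ∸ i)) ≡ n ∸ i
      index i i<a = sym (begin-equality
        n ∸ i                      ≡⟨ cong (_∸ i) (order r l) ⟩
        a + suc l + r ∸ i          ≡⟨ ℕ.+-∸-assoc (a + suc l) (s≤s⁻¹ i<a) ⟩
        a + suc l + (r ∸ i)        ≡⟨ ℕ.+-assoc a (suc l) (r ∸ i) ⟩
        a + (suc l + (r ∸ i))      ∎)
        where
        order : ∀ r l → suc r + (l + suc r) ≡ suc r + suc l + r
        order = ℕ-Solver.solve-∀
    decompose : (f ⋆ f′) n -ᶻ (T r f f′ n +ᶻ T r f′ f n) ≡ ∑< (suc l) h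
    decompose = trans
      (cong (λ m → ∑< m (term f f′ n) -ᶻ (T r f f′ n +ᶻ T r f′ f n)) (order a l))
      (trans
        (cong (_-ᶻ (T r f f′ n +ᶻ T r f′ f n)) (trans (∑<-split a (suc l + a) (term f f′ n))
          (cong (T r f f′ n +ᶻ_) (trans (∑<-split (suc l) a (λ i → term f f′ n (a + i))) (cong (∑< (suc l) h +ᶻ_) upper)))))
        (cancel (T r f f′ n) (∑< (suc l) h) (T r f′ f n)))
      where
      order : ∀ a l → suc (a + (l + a)) ≡ a + (suc l + a)
      order = ℕ-Solver.solve-∀
      cancel : ∀ x y z → (x +ᶻ (y +ᶻ z)) -ᶻ (x +ᶻ z) ≡ y
      cancel = solve-∀

1+n*i≡0⇒i≡0 : ∀ n i → + suc n *ᶻ i ≡ 0ℤ → i ≡ 0ℤ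
1+n*i≡0⇒i≡0 n i eq with ℤ.i*j≡0⇒i≡0∨j≡0 (+ suc n) eq
... | inj₂ i≡0 = i≡0

-- Expansions of products, inverses and integrals

module Singularity (e q : ℕ) (e<q : e < q) where

  open Growth e q e<q
  open Convolution e q e<q
  open Asymptotics e q e<q


  record Bounded (K : ℕ) (f : ℕ → ℤ) : Set where
    constructor bounded
    field ≤W : ∀ n → ℤ.∣ f n ∣ ≤ K * W n
  open Bounded

  bounded-* : ∀ {K K′ f f′} → Bounded K f → Bounded K′ f′ → ∀ i j → ℤ.∣ f i *ᶻ f′ j ∣ ≤ K * K′ * (W i * W j)
  bounded-* {K} {K′} {f} {f′} b b′ i j = begin
    ℤ.∣ f i *ᶻ f′ j ∣            ≡⟨ ℤ.∣i*j∣≡∣i∣*∣j∣ (f i) (f′ j) ⟩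
    ℤ.∣ f i ∣ * ℤ.∣ f′ j ∣       ≤⟨ ℕ.*-mono-≤ (b .≤W i) (b′ .≤W j) ⟩
    K * W i * (K′ * W j)         ≡⟨ shuffle K (W i) K′ (W j) ⟩
    K * K′ * (W i * W j)         ∎
    where
    open ℕ.≤-Reasoning
    shuffle : ∀ a b c d → a * b * (c * d) ≡ a * c * (b * d)
    shuffle = ℕ-Solver.solve-∀

  -- `middle-≤` at a = 0, where no term is set apart: sequences bounded by a multiple of `W` are
  -- closed under products.
  bounded-⋆ : ∀ {K K′ f f′} → Bounded K f → Bounded K′ f′ →
              Bounded ((2 + decay 0) * (K * K′ * W 0)) (f ⋆ f′)
  bounded-⋆ {K} {K′} {f} {f′} b b′ .≤W n = begin
    ℤ.∣ (f ⋆ f′) n ∣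
      ≤⟨ middle-≤ 0 n (K * K′) (term f f′ n) small ⟩
    (2 + decay 0) * (K * K′ * (B n 0 * (W 0 * W n)))
      ≡⟨ cong (λ b → (2 + decay 0) * (K * K′ * (b * (W 0 * W n)))) (B-zero n) ⟩
    (2 + decay 0) * (K * K′ * (1 * (W 0 * W n)))
      ≡⟨ shuffle (2 + decay 0) (K * K′) (W 0) (W n) ⟩
    (2 + decay 0) * (K * K′ * W 0) * W n ∎
    where
    open ℕ.≤-Reasoning
    shuffle : ∀ a b c d → a * (b * (1 * (c * d))) ≡ a * (b * c) * d
    shuffle = ℕ-Solver.solve-∀
    pull : ∀ a b c → a * (b * c) ≡ b * (a * c)
    pull = ℕ-Solver.solve-∀
    small : ∀ i i′ → i + i′ ≡ n → ℤ.∣ term f f′ n i ∣ ≤ K * K′ * g i i′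
    small i i′ refl = begin
      ℤ.∣ + B n i *ᶻ (f i *ᶻ f′ (n ∸ i)) ∣   ≡⟨ ℤ.∣i*j∣≡∣i∣*∣j∣ (+ B n i) _ ⟩
      B n i * ℤ.∣ f i *ᶻ f′ (n ∸ i) ∣        ≤⟨ ℕ.*-monoʳ-≤ (B n i) (bounded-* b b′ i (n ∸ i)) ⟩
      B n i * (K * K′ * (W i * W (n ∸ i)))   ≡⟨ cong (λ j → B n i * (K * K′ * (W i * W j))) (ℕ.m+n∸m≡n i i′) ⟩
      B n i * (K * K′ * (W i * W i′))        ≡⟨ pull (B n i) (K * K′) (W i * W i′) ⟩
      K * K′ * g i i′                        ∎

  -- From 2 (r + 1) on, the first and the last r + 1 indices do not overlap.
  large : ∀ r n → suc r + suc r ≤ n → ∃[ l ] suc r + (l + suc r) ≡ n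
  large r n le = n ∸ (suc r + suc r) , trans (cong (λ m → suc r + m) (ℕ.+-comm (n ∸ (suc r + suc r)) (suc r)))
    (trans (sym (ℕ.+-assoc (suc r) (suc r) _)) (ℕ.m+[n∸m]≡n le))

  ⋆-split : ∀ {K K′ f f′} → Bounded K f → Bounded K′ f′ → ∀ r → f ⋆ f′ ≈[ r ] T r f f′ ⊕ T r f′ f
  ⋆-split {K} {K′} {f} {f′} b b′ r = bound ((2 + decay (suc r)) * W (suc r) * (K * K′)) (suc r + suc r) λ n le →
    subst (λ n → ℤ.∣ (f ⋆ f′) n -ᶻ (T r f f′ n +ᶻ T r f′ f n) ∣ ≤ (2 + decay (suc r)) * W (suc r) * (K * K′) * E r n)
      (proj₂ (large r n le))
      (ℕ.≤-trans (split r (proj₁ (large r n le)) (K * K′) f f′ (λ i j _ → bounded-* b b′ i j))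
                 (ℕ.≤-reflexive (sym (ℕ.*-assoc ((2 + decay (suc r)) * W (suc r)) (K * K′) _))))

  -- In the terms kept by `⋆-split` one index is at most r; the factor at the other index, which is
  -- large, is replaced by its expansion.
  ⋆-∼ : ∀ {K K′ f f′ F F′} → Bounded K f → Bounded K′ f′ → f ∼ F → f′ ∼ F′ → f ⋆ f′ ∼ f ⋆ F′ ⊕ f′ ⋆ F
  ⋆-∼ {f = f} {f′} {F} {F′} b b′ f∼F f′∼F′ r =
    ≈-trans (⋆-split b b′ r)
      (≈-trans (≈-+ (T-∼ f {f′} {F′} f′∼F′ r) (T-∼ f′ {f} {F} f∼F r)) (≈-reflexive (≐-sym (T-⊕ˡ r (f ⋆ F′) (f′ ⋆ F) w))))

  -- As u ⋆ w = δ, the small-index terms T r w u and T r u w cancel up to E r;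
  -- convolving with u isolates u.
  inverse-∼ : ∀ {K u} → Bounded K u → u ⋆ w ≐ δ → u ∼ u ⋆ ⊖ u
  inverse-∼ {K} {u} b uw≐δ r = ≈-trans
    (eventually r (λ n r≤n → sym (trans (T-regroup u w u r n r≤n) (trans (T-cong r uw≐δ (≐-refl {u}) .at n) (T-δ r u .at n)))))
    (≈-trans (≈-convolve u (λ r → T r w u) (λ r → T r (⊖ u) w) flip r)
             (eventually r (λ n r≤n → T-regroup u (⊖ u) w r n r≤n)))
    where
    bw : Bounded 1 w
    bw .≤W n = ℕ.≤-reflexive (sym (ℕ.*-identityˡ (W n)))
    flip : ∀ r → T r w u ≈[ r ] T r (⊖ u) w
    flip r = ≈-trans (≈-reflexive (pointwise λ n → isolate (T r u w n) (T r w u n)))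
      (≈-trans (≈-- (≈-trans (≈-sym (⋆-split b bw r)) vanish) (≈-reflexive (≐-refl {T r u w})))
               (≈-reflexive (pointwise λ n → trans (ℤ.+-identityˡ (-ᶻ T r u w n)) (sym (T-⊖ˡ r u w .at n)))))
      where
      isolate : ∀ x y → y ≡ (x +ᶻ y) -ᶻ x
      isolate = solve-∀
      vanish : u ⋆ w ≈[ r ] 𝟎
      vanish = eventually 1 λ { (suc n) _ → uw≐δ .at (suc n) }

  -- D f = D w ⋆ d contributes n T r d w: the terms with small index in d come
  -- with n ∸ i, the others, rewritten through G, with the missing i.
  integrate-∼ : ∀ {K f d G} → Bounded K d → D f ≐ D w ⋆ d → d ∼ G → D w ⋆ G ≐ D d → f ∼ d
  integrate-∼ {K} {f} {d} {G} b Df≐ d∼G Dw⋆G≐ r = bound (K₂ * K + K₁) (suc r + suc r + N) λ n le →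
    let instance _ = >-nonZero (ℕ.≤-trans (s≤s z≤n) le)
        l , n≡ = large r n (ℕ.≤-trans (ℕ.m≤m+n (suc r + suc r) N) le)
        r≤n = ℕ.≤-trans (ℕ.n≤1+n r) (ℕ.≤-trans (ℕ.≤-trans (ℕ.m≤m+n (suc r) (suc r)) (ℕ.m≤m+n (suc r + suc r) N)) le)
        -- `D w` is not bounded by a multiple of `W`, but for a fixed n its values up to n are at
        -- most n times those of `W`. So `split` applies with M = n * K, and this n is cancelled
        -- against the one that multiplies f n.
        near = subst (λ n → ℤ.∣ (D w ⋆ d) n -ᶻ (T r (D w) d n +ᶻ T r d (D w) n) ∣ ≤ K₂ * (n * K * E r n))
                 n≡ (split r l ((suc r + (l + suc r)) * K) (D w) d (weigh (suc r + (l + suc r))))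
    in ℕ.*-cancelˡ-≤ n (begin
      n * ℤ.∣ f n -ᶻ T r d w n ∣
        ≡⟨ ℤ.∣i*j∣≡∣i∣*∣j∣ (+ n) (f n -ᶻ T r d w n) ⟨
      ℤ.∣ + n *ᶻ (f n -ᶻ T r d w n) ∣
        ≡⟨ cong ℤ.∣_∣ (rewriting n r≤n) ⟩
      ℤ.∣ ((D w ⋆ d) n -ᶻ (T r (D w) d n +ᶻ T r d (D w) n)) +ᶻ (T r (D w) d n -ᶻ T r (D d) w n) ∣
        ≤⟨ ℤ.∣i+j∣≤∣i∣+∣j∣ ((D w ⋆ d) n -ᶻ (T r (D w) d n +ᶻ T r d (D w) n)) _ ⟩
      ℤ.∣ (D w ⋆ d) n -ᶻ (T r (D w) d n +ᶻ T r d (D w) n) ∣ + ℤ.∣ T r (D w) d n -ᶻ T r (D d) w n ∣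
        ≤⟨ ℕ.+-mono-≤ near (close n (ℕ.≤-trans (ℕ.m≤n+m N (suc r + suc r)) le)) ⟩
      K₂ * (n * K * E r n) + K₁ * E r n
        ≤⟨ ℕ.+-monoʳ-≤ (K₂ * (n * K * E r n)) (ℕ.m≤n*m (K₁ * E r n) n) ⟩
      K₂ * (n * K * E r n) + n * (K₁ * E r n)
        ≡⟨ collect K₂ n K K₁ (E r n) ⟩
      n * ((K₂ * K + K₁) * E r n) ∎)
    where
    open ℕ.≤-Reasoning
    open _≈[_]_ (≈-trans (T-∼ (D w) d∼G r) (≈-reflexive (T-cong r Dw⋆G≐ (≐-refl {w}))))
      renaming (const to K₁; threshold to N; error≤ to close)
    K₂ : ℕ
    K₂ = (2 + decay (suc r)) * W (suc r)
    collect : ∀ c n k k₁ e → c * (n * k * e) + n * (k₁ * e) ≡ n * ((c * k + k₁) * e)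
    collect = ℕ-Solver.solve-∀
    weigh : ∀ n i j → i + j ≡ n → ℤ.∣ D w i *ᶻ d j ∣ ≤ n * K * (W i * W j)
    weigh n i j refl = begin
      ℤ.∣ + i *ᶻ + W i *ᶻ d j ∣           ≡⟨ trans (ℤ.∣i*j∣≡∣i∣*∣j∣ (+ i *ᶻ + W i) (d j)) (cong (_* ℤ.∣ d j ∣) (ℤ.∣i*j∣≡∣i∣*∣j∣ (+ i) (+ W i))) ⟩
      i * W i * ℤ.∣ d j ∣                 ≤⟨ ℕ.*-mono-≤ (ℕ.*-monoˡ-≤ (W i) (ℕ.m≤m+n i j)) (b .≤W j) ⟩
      (i + j) * W i * (K * W j)           ≡⟨ shuffle (i + j) (W i) K (W j) ⟩
      (i + j) * K * (W i * W j)           ∎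
      where
      shuffle : ∀ a b c d → a * b * (c * d) ≡ a * c * (b * d)
      shuffle = ℕ-Solver.solve-∀
    rewriting : ∀ n → r ≤ n → + n *ᶻ (f n -ᶻ T r d w n) ≡
      ((D w ⋆ d) n -ᶻ (T r (D w) d n +ᶻ T r d (D w) n)) +ᶻ (T r (D w) d n -ᶻ T r (D d) w n)
    rewriting n r≤n = trans (distribute (+ n) (f n) (T r d w n))
      (trans (cong₂ _-ᶻ_ (Df≐ .at n) (T-D r d w n r≤n))
             (reorder ((D w ⋆ d) n) (T r (D d) w n) (T r d (D w) n) (T r (D w) d n)))
      where
      distribute : ∀ a b c → a *ᶻ (b -ᶻ c) ≡ a *ᶻ b -ᶻ a *ᶻ c
      distribute = solve-∀
      reorder : ∀ x a b c → x -ᶻ (a +ᶻ b) ≡ (x -ᶻ (c +ᶻ b)) +ᶻ (c -ᶻ a)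
      reorder = solve-∀

  module _ (c u : ℕ → ℤ) (α : ℕ → ℕ → ℤ)
           (u-zero : u 0 ≡ 1ℤ) (α-zero : α 0 ≐ δ)
           (Dw≐ : D w ≐ D c ⋆ w) (Du≐ : D u ≐ D c ⋆ ⊖ u) (Dα≐ : ∀ m → D (α (suc m)) ≐ D c ⋆ α m)
           (u-bounded : Bounded 1 u) (α-bounded : ∀ m → Bounded 1 (α m)) where

    -- `d 0` is the derivative of the constant series `α 0`. With it, D (α m) = D w ⋆ d m holds from
    -- m = 0 on, where the induction starts.
    d : ℕ → ℕ → ℤ
    d zero    = 𝟎
    d (suc m) = α m ⋆ u

    W-zero : W 0 ≡ 1
    W-zero = cong (λ m → matchings (2 * m)) (ℕ.*-zeroʳ q)

    D[u⋆w]≐𝟎 : D (u ⋆ w) ≐ 𝟎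
    D[u⋆w]≐𝟎 =
      D-⋆ u w ⟫
      ⊕-cong (⋆-congˡ w (Du≐ ⟫ ⋆-⊖ʳ (D c) u) ⟫ ⋆-⊖ˡ (D c ⋆ u) w)
             (⋆-congʳ u Dw≐ ⟫ ⋆-assoc u (D c) w ⟫ ⋆-congˡ w (⋆-comm u (D c))) ⟫
      pointwise (λ n → ℤ.+-inverseˡ ((D c ⋆ u ⋆ w) n))

    -- A series with zero derivative is constant, and the value at 0 is 1.
    u⋆w≐δ : u ⋆ w ≐ δ
    u⋆w≐δ .at zero = trans (ℤ.+-identityʳ (+ B 0 0 *ᶻ (u 0 *ᶻ w 0)))
      (cong₂ (λ b x → + b *ᶻ x) (B-zero 0) (cong₂ (λ x y → x *ᶻ + y) u-zero W-zero))
    u⋆w≐δ .at (suc n) = 1+n*i≡0⇒i≡0 n ((u ⋆ w) (suc n)) (D[u⋆w]≐𝟎 .at (suc n))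

    -- D c is the logarithmic derivative of `w`, and u is the inverse of `w`.
    Dc≐ : D c ≐ D w ⋆ u
    Dc≐ = ≐-sym (
      ⋆-congˡ u Dw≐ ⟫ ≐-sym (⋆-assoc (D c) w u) ⟫
      ⋆-congʳ (D c) (⋆-comm w u ⟫ u⋆w≐δ) ⟫ ⋆-identityʳ (D c))

    Dα≐Dw⋆d : ∀ m → D (α m) ≐ D w ⋆ d m
    Dα≐Dw⋆d zero = pointwise null ⟫ ≐-sym (⋆-comm (D w) 𝟎 ⟫ ⋆-zeroˡ (D w))
      where
      null : ∀ n → D (α 0) n ≡ 0ℤ
      null zero    = refl
      null (suc n) = trans (cong (+ suc n *ᶻ_) (α-zero .at (suc n))) (ℤ.*-zeroʳ (+ suc n))
    Dα≐Dw⋆d (suc m) =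
      Dα≐ m ⟫ ⋆-congˡ (α m) Dc≐ ⟫ ≐-sym (⋆-assoc (D w) u (α m)) ⟫ ⋆-congʳ (D w) (⋆-comm u (α m))

    α∼d : ∀ m → α m ∼ d m
    -- `δ` differs from 0 only at n = 0, so beyond the threshold 1 there is no error at all.
    α∼d zero r = eventually 1 λ { (suc n) _ → trans (α-zero .at (suc n)) (sym (null (suc n))) }
      where
      null : ∀ n → T r 𝟎 w n ≡ 0ℤ
      null n = ∑<-zero (suc r) (λ i _ → trans (cong (+ B n i *ᶻ_) (ℤ.*-zeroˡ (w (n ∸ i)))) (ℤ.*-zeroʳ (+ B n i)))
    -- G is the formal derivative of `α m ⋆ u` with respect to `w`, built from the derivatives `d m`
    -- of `α m` and -u² of u. The last argument is then the chain rule for D, which follows from the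
    -- Leibniz rule.
    α∼d (suc m) = integrate-∼ {G = α m ⋆ (u ⋆ ⊖ u) ⊕ u ⋆ d m} (bounded-⋆ (α-bounded m) u-bounded) (Dα≐Dw⋆d (suc m))
      (⋆-∼ {F = d m} {F′ = u ⋆ ⊖ u} (α-bounded m) u-bounded (α∼d m) (inverse-∼ u-bounded u⋆w≐δ))
      (≐-sym (
        D-⋆ (α m) u ⟫
        ⊕-cong
          (⋆-congˡ u (Dα≐Dw⋆d m) ⟫ ≐-sym (⋆-assoc (D w) (d m) u) ⟫ ⋆-congʳ (D w) (⋆-comm (d m) u))
          (⋆-congʳ (α m) (Du≐ ⟫ ⋆-congˡ (⊖ u) Dc≐ ⟫ ≐-sym (⋆-assoc (D w) u (⊖ u))) ⟫
            ⋆-swap (α m) (D w) (u ⋆ ⊖ u)) ⟫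
        ⊕-comm (D w ⋆ (u ⋆ d m)) (D w ⋆ (α m ⋆ (u ⋆ ⊖ u))) ⟫
        ≐-sym (⋆-distribˡ-⊕ (D w) (α m ⋆ (u ⋆ ⊖ u)) (u ⋆ d m))))

-- Passage from integers to rationals

fromℚᵘ-+ : ∀ p q → ℚ.fromℚᵘ p ℚ.+ ℚ.fromℚᵘ q ≡ ℚ.fromℚᵘ (p ℚᵘ.+ q)
fromℚᵘ-+ p q = ℚ.toℚᵘ-injective (ℚᵘ.≃-trans (ℚ.toℚᵘ-homo-+ (ℚ.fromℚᵘ p) (ℚ.fromℚᵘ q))
  (ℚᵘ.≃-trans (ℚᵘ.+-cong (ℚ.toℚᵘ-fromℚᵘ p) (ℚ.toℚᵘ-fromℚᵘ q)) (ℚᵘ.≃-sym (ℚ.toℚᵘ-fromℚᵘ (p ℚᵘ.+ q)))))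

fromℚᵘ-* : ∀ p q → ℚ.fromℚᵘ p ℚ.* ℚ.fromℚᵘ q ≡ ℚ.fromℚᵘ (p ℚᵘ.* q)
fromℚᵘ-* p q = ℚ.toℚᵘ-injective (ℚᵘ.≃-trans (ℚ.toℚᵘ-homo-* (ℚ.fromℚᵘ p) (ℚ.fromℚᵘ q))
  (ℚᵘ.≃-trans (ℚᵘ.*-cong (ℚ.toℚᵘ-fromℚᵘ p) (ℚ.toℚᵘ-fromℚᵘ q)) (ℚᵘ.≃-sym (ℚ.toℚᵘ-fromℚᵘ (p ℚᵘ.* q)))))

fromℚᵘ-mono-≤ : ∀ {p q} → p ℚᵘ.≤ q → ℚ.fromℚᵘ p ℚ.≤ ℚ.fromℚᵘ q
fromℚᵘ-mono-≤ {p} {q} p≤q = ℚ.toℚᵘ-cancel-≤ (ℚᵘ.≤-trans (ℚᵘ.≤-reflexive (ℚ.toℚᵘ-fromℚᵘ p))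
  (ℚᵘ.≤-trans p≤q (ℚᵘ.≤-reflexive (ℚᵘ.≃-sym (ℚ.toℚᵘ-fromℚᵘ q)))))

ι : ℤ → ℚ
ι i = i ℚ./ 1

ι-+ : ∀ i j → ι (i +ᶻ j) ≡ ι i ℚ.+ ι j
ι-+ i j = sym (trans (fromℚᵘ-+ (mkℚᵘ i 0) (mkℚᵘ j 0)) (ℚ.fromℚᵘ-cong {mkℚᵘ i 0 ℚᵘ.+ mkℚᵘ j 0} {mkℚᵘ (i +ᶻ j) 0} (*≡* (eq i j))))
  where
  eq : ∀ i j → (i *ᶻ 1ℤ +ᶻ j *ᶻ 1ℤ) *ᶻ 1ℤ ≡ (i +ᶻ j) *ᶻ 1ℤ
  eq = solve-∀

ι-* : ∀ i j → ι (i *ᶻ j) ≡ ι i ℚ.* ι j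
ι-* i j = sym (trans (fromℚᵘ-* (mkℚᵘ i 0) (mkℚᵘ j 0)) (ℚ.fromℚᵘ-cong {mkℚᵘ i 0 ℚᵘ.* mkℚᵘ j 0} {mkℚᵘ (i *ᶻ j) 0} (*≡* refl)))

ι-mono-≤ : ∀ {i j} → i ℤ.≤ j → ι i ℚ.≤ ι j
ι-mono-≤ {i} {j} i≤j = fromℚᵘ-mono-≤ {mkℚᵘ i 0} {mkℚᵘ j 0} (*≤* (ℤ.*-monoʳ-≤-nonNeg 1ℤ i≤j))

ι-neg : ∀ i → ι (-ᶻ i) ≡ ℚ.- ι i
ι-neg i = begin
  ι (-ᶻ i)          ≡⟨ cong ι (ℤ.-1*i≡-i i) ⟨
  ι (-1ℤ *ᶻ i)      ≡⟨ ι-* -1ℤ i ⟩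
  (ℚ.- ℚ.1ℚ) ℚ.* ι i ≡⟨ ℚ.neg-distribˡ-* ℚ.1ℚ (ι i) ⟨
  ℚ.- (ℚ.1ℚ ℚ.* ι i) ≡⟨ cong ℚ.-_ (ℚ.*-identityˡ (ι i)) ⟩
  ℚ.- ι i           ∎
  where open ≡-Reasoning

∣ι∣ : ∀ i → ℚ.∣ ι i ∣ ≡ ι (+ ℤ.∣ i ∣)
∣ι∣ i with ℤ.+∣i∣≡i⊎+∣i∣≡-i i
... | inj₁ eq = trans (ℚ.0≤p⇒∣p∣≡p (ι-mono-≤ (subst (0ℤ ℤ.≤_) eq (ℤ.+≤+ z≤n)))) (cong ι (sym eq))
... | inj₂ eq = begin
  ℚ.∣ ι i ∣          ≡⟨ ℚ.∣-p∣≡∣p∣ (ι i) ⟨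
  ℚ.∣ ℚ.- ι i ∣      ≡⟨ cong ℚ.∣_∣ (ι-neg i) ⟨
  ℚ.∣ ι (-ᶻ i) ∣     ≡⟨ ℚ.0≤p⇒∣p∣≡p (ι-mono-≤ (subst (0ℤ ℤ.≤_) eq (ℤ.+≤+ z≤n))) ⟩
  ι (-ᶻ i)           ≡⟨ cong ι eq ⟨
  ι (+ ℤ.∣ i ∣)      ∎
  where open ≡-Reasoning

//-ι : ∀ a b → a // b ≡ ι (+ a) ℚ.* (1 // b)
//-ι a zero    = sym (ℚ.*-zeroʳ (ι (+ a)))
//-ι a (suc b) = sym (trans (fromℚᵘ-* (mkℚᵘ (+ a) 0) (mkℚᵘ 1ℤ b))
  (ℚ.fromℚᵘ-cong {mkℚᵘ (+ a) 0 ℚᵘ.* mkℚᵘ 1ℤ b} {mkℚᵘ (+ a) b} (*≡* (cong₂ _*ᶻ_ (ℤ.*-identityʳ (+ a)) (cong (λ m → + suc m) (sym (ℕ.+-identityʳ b)))))))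

//-nonNeg : ∀ a b → 0ℚ ℚ.≤ a // b
//-nonNeg a zero    = ℚ.≤-refl
//-nonNeg a (suc b) = fromℚᵘ-mono-≤ {mkℚᵘ 0ℤ 0} {mkℚᵘ (+ a) b}
  (*≤* (subst (0ℤ ℤ.≤_) (sym (ℤ.*-identityʳ (+ a))) (ℤ.+≤+ z≤n)))

p*ι↧p≡ι↥p : ∀ p → p ℚ.* ι (ℚ.↧ p) ≡ ι (ℚ.↥ p)
p*ι↧p≡ι↥p p@(ℚ.mkℚ n d _) = begin
  p ℚ.* ι (+ suc d)                             ≡⟨ cong (ℚ._* ι (+ suc d)) (ℚ.fromℚᵘ-toℚᵘ p) ⟨
  ℚ.fromℚᵘ (mkℚᵘ n d) ℚ.* ι (+ suc d)           ≡⟨ fromℚᵘ-* (mkℚᵘ n d) (mkℚᵘ (+ suc d) 0) ⟩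
  ℚ.fromℚᵘ (mkℚᵘ n d ℚᵘ.* mkℚᵘ (+ suc d) 0)     ≡⟨ ℚ.fromℚᵘ-cong {mkℚᵘ n d ℚᵘ.* mkℚᵘ (+ suc d) 0} {mkℚᵘ n 0} (*≡* (cross n d)) ⟩
  ι n                                           ∎
  where
  open ≡-Reasoning
  cross : ∀ n d → n *ᶻ + suc d *ᶻ 1ℤ ≡ n *ᶻ + suc (d * 1)
  cross n d = trans (ℤ.*-identityʳ _) (cong (λ m → n *ᶻ + suc m) (sym (ℕ.*-identityʳ d)))

0<p⇒1≤↥p : ∀ p → 0ℚ ℚ.< p → 1ℤ ℤ.≤ ℚ.↥ p
0<p⇒1≤↥p p@(ℚ.mkℚ _ _ _) 0<p = ℤ.i<j⇒suc[i]≤j (ℤ.positive⁻¹ (ℚ.↥ p) {{ℚ.positive 0<p}})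

expansion-cong : ∀ {p p′ : Seq} {c c′ : ℕ → ℤ} {g g′ : ℕ → Seq} →
  (∀ n → p n ≡ p′ n) → (∀ k → c k ≡ c′ k) → (∀ k n → g k n ≡ g′ k n) →
  AsymptoticExpansion p c g → AsymptoticExpansion p′ c′ g′
expansion-cong {p} {p′} {c} {c′} {g} {g′} p≡ c≡ g≡ exp = record
  { scale = λ k η 0<η → let n₀ , le = scale k η 0<η in
      n₀ , λ n n₀≤n → subst₂ (λ x y → ℚ.∣ x ∣ ℚ.≤ η ℚ.* ℚ.∣ y ∣) (g≡ (suc k) n) (g≡ k n) (le n n₀≤n)
  ; remainder = λ r → let K , n₀ , le = remainder r in
      K , n₀ , λ n n₀≤n → subst₂ (λ x y → ℚ.∣ x ∣ ℚ.≤ K ℚ.* ℚ.∣ y ∣)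
        (cong₂ ℚ._-_ (p≡ n) (cong (foldr ℚ._+_ 0ℚ) (List.map-cong (λ k → cong₂ (λ a b → (a ℚ./ 1) ℚ.* b) (c≡ k) (g≡ k n)) (upTo (suc r)))))
        (g≡ (suc r) n) (le n n₀≤n)
  }
  where open AsymptoticExpansion exp

module Transfer (e q : ℕ) (e<q : e < q) where

  open Growth e q e<q
  open Convolution e q e<q
  open Asymptotics e q e<q

  scaleℚ : ℕ → Seq
  scaleℚ k n = (B n k // 1) ℚ.* (W (n ∸ k) // W n)

  -- Each quantity of the expansion at n is an integer times this nonnegative factor, so an estimate
  -- in ℚ becomes an estimate of integers.
  κ : ℕ → ℚ
  κ n = 1 // W n

  κ-nonNeg : ∀ n → ℚ.NonNegative (κ n)
  κ-nonNeg n = ℚ.nonNegative (//-nonNeg 1 (W n))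

  scaleℚ-ι : ∀ k n → scaleℚ k n ≡ ι (+ (B n k * W (n ∸ k))) ℚ.* κ n
  scaleℚ-ι k n = begin
    ι (+ B n k) ℚ.* (W (n ∸ k) // W n)          ≡⟨ cong (ι (+ B n k) ℚ.*_) (//-ι (W (n ∸ k)) (W n)) ⟩
    ι (+ B n k) ℚ.* (ι (+ W (n ∸ k)) ℚ.* κ n)   ≡⟨ ℚ.*-assoc (ι (+ B n k)) (ι (+ W (n ∸ k))) (κ n) ⟨
    ι (+ B n k) ℚ.* ι (+ W (n ∸ k)) ℚ.* κ n     ≡⟨ cong (ℚ._* κ n) (ι-* (+ B n k) (+ W (n ∸ k))) ⟨
    ι (+ B n k *ᶻ + W (n ∸ k)) ℚ.* κ n          ≡⟨ cong (λ i → ι i ℚ.* κ n) (ℤ.pos-* (B n k) (W (n ∸ k))) ⟨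
    ι (+ (B n k * W (n ∸ k))) ℚ.* κ n           ∎
    where open ≡-Reasoning

  ∣ικ∣ : ∀ i n → ℚ.∣ ι i ℚ.* κ n ∣ ≡ ι (+ ℤ.∣ i ∣) ℚ.* κ n
  ∣ικ∣ i n = trans (ℚ.∣p*q∣≡∣p∣*∣q∣ (ι i) (κ n)) (cong₂ ℚ._*_ (∣ι∣ i) (ℚ.0≤p⇒∣p∣≡p (//-nonNeg 1 (W n))))

  ικ-mono : ∀ {i j} n → i ℤ.≤ j → ι i ℚ.* κ n ℚ.≤ ι j ℚ.* κ n
  ικ-mono n i≤j = ℚ.*-monoʳ-≤-nonNeg (κ n) {{κ-nonNeg n}} (ι-mono-≤ i≤j)

  scaleℚ-o : ∀ k → scaleℚ (suc k) =o scaleℚ k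
  -- By `BW-step` the ratio of the two scales is at most 1 / (n - k - 1), and η is at least the
  -- inverse of its denominator, since its numerator is at least 1.
  scaleℚ-o k η 0<η = suc k + ℚ.↧ₙ η , λ n le → begin
    ℚ.∣ scaleℚ (suc k) n ∣             ≡⟨ trans (cong ℚ.∣_∣ (scaleℚ-ι (suc k) n)) (∣ικ∣ (+ x n) n) ⟩
    ι (+ x n) ℚ.* κ n                  ≤⟨ ℚ.*-monoʳ-≤-nonNeg (κ n) {{κ-nonNeg n}} (small n le) ⟩
    η ℚ.* ι (+ y n) ℚ.* κ n            ≡⟨ ℚ.*-assoc η (ι (+ y n)) (κ n) ⟩
    η ℚ.* (ι (+ y n) ℚ.* κ n)          ≡⟨ cong (η ℚ.*_) (trans (cong ℚ.∣_∣ (scaleℚ-ι k n)) (∣ικ∣ (+ y n) n)) ⟨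
    η ℚ.* ℚ.∣ scaleℚ k n ∣             ∎
    where
    open ℚ.≤-Reasoning
    x y : ℕ → ℕ
    x n = B n (suc k) * W (n ∸ suc k)
    y n = B n k * W (n ∸ k)
    instance
      η-nonNeg : ℚ.NonNegative η
      η-nonNeg = ℚ.nonNegative (ℚ.<⇒≤ 0<η)
    drop : ∀ n → suc k + ℚ.↧ₙ η ≤ n → ℚ.↧ₙ η * x n ≤ y n
    drop n le = subst (λ n → ℚ.↧ₙ η * x n ≤ y n) n≡
      (subst₂ (λ a b → ℚ.↧ₙ η * (B n′ (suc k) * W a) ≤ B n′ k * W b)
        (sym (trans (cong (_∸ suc k) (ℕ.+-suc k j)) (ℕ.m+n∸m≡n (suc k) j))) (sym (ℕ.m+n∸m≡n k (suc j)))
        (ℕ.≤-trans (ℕ.*-monoˡ-≤ (B n′ (suc k) * W j) (ℕ.m+n≤o⇒m≤o∸n (ℚ.↧ₙ η) (subst (_≤ n) (ℕ.+-comm (suc k) (ℚ.↧ₙ η)) le))) (BW-step k j)))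
      where
      j n′ : ℕ
      j = n ∸ suc k
      n′ = k + suc j
      n≡ : n′ ≡ n
      n≡ = trans (ℕ.+-suc k j) (ℕ.m+[n∸m]≡n (ℕ.≤-trans (ℕ.m≤m+n (suc k) (ℚ.↧ₙ η)) le))
    small : ∀ n → suc k + ℚ.↧ₙ η ≤ n → ι (+ x n) ℚ.≤ η ℚ.* ι (+ y n)
    small n le = begin
      ι (+ x n)                                ≡⟨ cong ι (ℤ.*-identityˡ (+ x n)) ⟨
      ι (1ℤ *ᶻ + x n)                          ≤⟨ ι-mono-≤ (ℤ.*-monoʳ-≤-nonNeg (+ x n) (0<p⇒1≤↥p η 0<η)) ⟩
      ι (ℚ.↥ η *ᶻ + x n)                       ≡⟨ ι-* (ℚ.↥ η) (+ x n) ⟩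
      ι (ℚ.↥ η) ℚ.* ι (+ x n)                  ≡⟨ cong (ℚ._* ι (+ x n)) (p*ι↧p≡ι↥p η) ⟨
      η ℚ.* ι (ℚ.↧ η) ℚ.* ι (+ x n)            ≡⟨ ℚ.*-assoc η (ι (ℚ.↧ η)) (ι (+ x n)) ⟩
      η ℚ.* (ι (ℚ.↧ η) ℚ.* ι (+ x n))          ≡⟨ cong (η ℚ.*_) (ι-* (ℚ.↧ η) (+ x n)) ⟨
      η ℚ.* ι (ℚ.↧ η *ᶻ + x n)                 ≡⟨ cong (λ i → η ℚ.* ι i) (ℤ.pos-* (ℚ.↧ₙ η) (x n)) ⟨
      η ℚ.* ι (+ (ℚ.↧ₙ η * x n))               ≤⟨ ℚ.*-monoˡ-≤-nonNeg η (ι-mono-≤ (ℤ.+≤+ (drop n le))) ⟩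
      η ℚ.* ι (+ y n)                          ∎

  -- A general h in place of `id` lets the induction shift the index.
  ∑-ι : ∀ m (h : ℕ → ℕ) (f : ℕ → ℚ) (φ : ℕ → ℤ) n → (∀ i → f (h i) ≡ ι (φ i) ℚ.* κ n) →
        foldr ℚ._+_ 0ℚ (map f (applyUpTo h m)) ≡ ι (∑< m φ) ℚ.* κ n
  ∑-ι zero    h f φ n eq = sym (ℚ.*-zeroˡ (κ n))
  ∑-ι (suc m) h f φ n eq = begin
    f (h 0) ℚ.+ foldr ℚ._+_ 0ℚ (map f (applyUpTo (h ∘ suc) m))
      ≡⟨ cong₂ ℚ._+_ (eq 0) (∑-ι m (h ∘ suc) f (φ ∘ suc) n (eq ∘ suc)) ⟩
    ι (φ 0) ℚ.* κ n ℚ.+ ι (∑< m (φ ∘ suc)) ℚ.* κ n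
      ≡⟨ ℚ.*-distribʳ-+ (κ n) (ι (φ 0)) (ι (∑< m (φ ∘ suc))) ⟨
    (ι (φ 0) ℚ.+ ι (∑< m (φ ∘ suc))) ℚ.* κ n
      ≡⟨ cong (ℚ._* κ n) (ι-+ (φ 0) (∑< m (φ ∘ suc))) ⟨
    ι (∑< (suc m) φ) ℚ.* κ n ∎
    where open ≡-Reasoning

  expansion : ∀ {f F} (a : ℕ → ℕ) → (∀ n → + a n ≡ f n) → f ∼ F →
              AsymptoticExpansion (λ n → a n // W n) F scaleℚ
  expansion {f} {F} a a≡f f∼F = record
    { scale = scaleℚ-o
    ; remainder = λ r → let open _≈[_]_ (f∼F r) in
        ι (+ const) , threshold , λ n le → begin
          ℚ.∣ a n // W n ℚ.- ∑[k≤ r ] (λ k → (F k ℚ./ 1) ℚ.* scaleℚ k n) ∣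
            ≡⟨ cong ℚ.∣_∣ (difference r n) ⟩
          ℚ.∣ ι (f n -ᶻ T r F w n) ℚ.* κ n ∣
            ≡⟨ ∣ικ∣ (f n -ᶻ T r F w n) n ⟩
          ι (+ ℤ.∣ f n -ᶻ T r F w n ∣) ℚ.* κ n
            ≤⟨ ικ-mono n (ℤ.+≤+ (error≤ n le)) ⟩
          ι (+ (const * E r n)) ℚ.* κ n
            ≡⟨ cong (λ i → ι i ℚ.* κ n) (ℤ.pos-* const (E r n)) ⟩
          ι (+ const *ᶻ + E r n) ℚ.* κ n
            ≡⟨ cong (ℚ._* κ n) (ι-* (+ const) (+ E r n)) ⟩
          ι (+ const) ℚ.* ι (+ E r n) ℚ.* κ n
            ≡⟨ ℚ.*-assoc (ι (+ const)) (ι (+ E r n)) (κ n) ⟩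
          ι (+ const) ℚ.* (ι (+ E r n) ℚ.* κ n)
            ≡⟨ cong (ι (+ const) ℚ.*_) (trans (cong ℚ.∣_∣ (scaleℚ-ι (suc r) n)) (∣ικ∣ (+ E r n) n)) ⟨
          ι (+ const) ℚ.* ℚ.∣ scaleℚ (suc r) n ∣ ∎
    }
    where
    open ℚ.≤-Reasoning
    entry : ∀ n k → (F k ℚ./ 1) ℚ.* scaleℚ k n ≡ ι (term F w n k) ℚ.* κ n
    entry n k = begin-equality
      ι (F k) ℚ.* scaleℚ k n                              ≡⟨ cong (ι (F k) ℚ.*_) (scaleℚ-ι k n) ⟩
      ι (F k) ℚ.* (ι (+ (B n k * W (n ∸ k))) ℚ.* κ n)     ≡⟨ ℚ.*-assoc (ι (F k)) _ (κ n) ⟨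
      ι (F k) ℚ.* ι (+ (B n k * W (n ∸ k))) ℚ.* κ n       ≡⟨ cong (ℚ._* κ n) (ι-* (F k) (+ (B n k * W (n ∸ k)))) ⟨
      ι (F k *ᶻ + (B n k * W (n ∸ k))) ℚ.* κ n            ≡⟨ cong (λ i → ι (F k *ᶻ i) ℚ.* κ n) (ℤ.pos-* (B n k) (W (n ∸ k))) ⟩
      ι (F k *ᶻ (+ B n k *ᶻ + W (n ∸ k))) ℚ.* κ n         ≡⟨ cong (λ i → ι i ℚ.* κ n) (swap (F k) (+ B n k) (+ W (n ∸ k))) ⟩
      ι (term F w n k) ℚ.* κ n                            ∎
      where
      swap : ∀ a b c → a *ᶻ (b *ᶻ c) ≡ b *ᶻ (a *ᶻ c)
      swap = solve-∀
    difference : ∀ r n → a n // W n ℚ.- ∑[k≤ r ] (λ k → (F k ℚ./ 1) ℚ.* scaleℚ k n) ≡ ι (f n -ᶻ T r F w n) ℚ.* κ n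
    difference r n = begin-equality
      a n // W n ℚ.- ∑[k≤ r ] (λ k → (F k ℚ./ 1) ℚ.* scaleℚ k n)
        ≡⟨ cong₂ ℚ._-_ (trans (//-ι (a n) (W n)) (cong (λ i → ι i ℚ.* κ n) (a≡f n)))
                       (∑-ι (suc r) id _ (term F w n) n (entry n)) ⟩
      ι (f n) ℚ.* κ n ℚ.- ι (T r F w n) ℚ.* κ n
        ≡⟨ cong (ι (f n) ℚ.* κ n ℚ.+_) (ℚ.neg-distribˡ-* (ι (T r F w n)) (κ n)) ⟩
      ι (f n) ℚ.* κ n ℚ.+ (ℚ.- ι (T r F w n)) ℚ.* κ n
        ≡⟨ ℚ.*-distribʳ-+ (κ n) (ι (f n)) (ℚ.- ι (T r F w n)) ⟨
      (ι (f n) ℚ.- ι (T r F w n)) ℚ.* κ n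
        ≡⟨ cong (λ x → (ι (f n) ℚ.+ x) ℚ.* κ n) (ι-neg (T r F w n)) ⟨
      (ι (f n) ℚ.+ ι (-ᶻ T r F w n)) ℚ.* κ n
        ≡⟨ cong (ℚ._* κ n) (ι-+ (f n) (-ᶻ T r F w n)) ⟨
      ι (f n -ᶻ T r F w n) ℚ.* κ n ∎

open ≡-Reasoning

-- Counting by double sums

private variable
  A A′ : Set

𝟙 : Dec A → ℤ
𝟙 d = if does d then 1ℤ else 0ℤ

𝟙-yes : (d : Dec A) → A → 𝟙 d ≡ 1ℤ
𝟙-yes d a rewrite dec-true d a = refl

𝟙-no : (d : Dec A) → ¬ A → 𝟙 d ≡ 0ℤ
𝟙-no d ¬a rewrite dec-false d ¬a = refl

𝟙-no-* : (d : Dec A) (x : ℤ) → ¬ A → 𝟙 d *ᶻ x ≡ 0ℤ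
𝟙-no-* d x ¬a rewrite 𝟙-no d ¬a = refl

𝟙-⇔ : (d : Dec A) (e : Dec A′) → (A → A′) → (A′ → A) → 𝟙 d ≡ 𝟙 e
𝟙-⇔ d (yes b) f g = 𝟙-yes d (g b)
𝟙-⇔ d (no ¬b) f g = 𝟙-no d (¬b ∘ f)

𝟙-× : (d : Dec A) (e : Dec A′) → 𝟙 (d ×-dec e) ≡ 𝟙 d *ᶻ 𝟙 e
𝟙-× (yes _) (yes _) = refl
𝟙-× (yes _) (no _)  = refl
𝟙-× (no _)  (yes _) = refl
𝟙-× (no _)  (no _)  = refl

𝟙-guard : (d : Dec A) {x y : ℤ} → (A → x ≡ y) → 𝟙 d *ᶻ x ≡ 𝟙 d *ᶻ y
𝟙-guard (yes a) eq = cong (1ℤ *ᶻ_) (eq a)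
𝟙-guard (no _)  _  = refl

𝟙-guard-⇔ : (d : Dec A) (e : Dec A′) {x y : ℤ} → (A → A′) → (A′ → A) → (A′ → x ≡ y) →
            𝟙 d *ᶻ x ≡ 𝟙 e *ᶻ y
𝟙-guard-⇔ d e {x} f g eq = trans (cong (_*ᶻ x) (𝟙-⇔ d e f g)) (𝟙-guard e eq)

∑ : List A → (A → ℤ) → ℤ
∑ []       f = 0ℤ
∑ (x ∷ xs) f = f x +ᶻ ∑ xs f

∑-cong : ∀ (xs : List A) {f g} → (∀ x → f x ≡ g x) → ∑ xs f ≡ ∑ xs g
∑-cong []       eq = refl
∑-cong (x ∷ xs) eq = cong₂ _+ᶻ_ (eq x) (∑-cong xs eq)

∑-zero : ∀ (xs : List A) → ∑ xs (λ _ → 0ℤ) ≡ 0ℤ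
∑-zero []       = refl
∑-zero (x ∷ xs) = trans (ℤ.+-identityˡ _) (∑-zero xs)

∑-+ : ∀ (xs : List A) f g → ∑ xs (λ x → f x +ᶻ g x) ≡ ∑ xs f +ᶻ ∑ xs g
∑-+ []       f g = refl
∑-+ (x ∷ xs) f g = trans (cong (f x +ᶻ g x +ᶻ_) (∑-+ xs f g)) (interchange (f x) (g x) _ _)

∑-*ˡ : ∀ c (xs : List A) f → ∑ xs (λ x → c *ᶻ f x) ≡ c *ᶻ ∑ xs f
∑-*ˡ c []       f = sym (ℤ.*-zeroʳ c)
∑-*ˡ c (x ∷ xs) f = trans (cong (c *ᶻ f x +ᶻ_) (∑-*ˡ c xs f)) (sym (ℤ.*-distribˡ-+ c (f x) _))

∑-*ʳ : ∀ c (xs : List A) f → ∑ xs (λ x → f x *ᶻ c) ≡ ∑ xs f *ᶻ c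
∑-*ʳ c xs f = begin
  ∑ xs (λ x → f x *ᶻ c)  ≡⟨ ∑-cong xs (λ x → ℤ.*-comm (f x) c) ⟩
  ∑ xs (λ x → c *ᶻ f x)  ≡⟨ ∑-*ˡ c xs f ⟩
  c *ᶻ ∑ xs f            ≡⟨ ℤ.*-comm c _ ⟩
  ∑ xs f *ᶻ c            ∎

∑-swap : ∀ (xs : List A) (ys : List A′) (f : A → A′ → ℤ) →
         ∑ xs (λ x → ∑ ys (f x)) ≡ ∑ ys (λ y → ∑ xs (λ x → f x y))
∑-swap []       ys f = sym (∑-zero ys)
∑-swap (x ∷ xs) ys f = begin
  ∑ ys (f x) +ᶻ ∑ xs (λ x → ∑ ys (f x))                ≡⟨ cong (∑ ys (f x) +ᶻ_) (∑-swap xs ys f) ⟩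
  ∑ ys (f x) +ᶻ ∑ ys (λ y → ∑ xs (λ x → f x y))        ≡⟨ ∑-+ ys (f x) (λ y → ∑ xs (λ x → f x y)) ⟨
  ∑ ys (λ y → f x y +ᶻ ∑ xs (λ x → f x y))             ∎

∑-++ : ∀ (xs ys : List A) f → ∑ (xs ++ ys) f ≡ ∑ xs f +ᶻ ∑ ys f
∑-++ []       ys f = sym (ℤ.+-identityˡ _)
∑-++ (x ∷ xs) ys f = trans (cong (f x +ᶻ_) (∑-++ xs ys f)) (sym (ℤ.+-assoc (f x) _ _))

∑-map : ∀ (h : A → A′) xs f → ∑ (map h xs) f ≡ ∑ xs (f ∘ h)
∑-map h []       f = refl
∑-map h (x ∷ xs) f = cong (f (h x) +ᶻ_) (∑-map h xs f)

∑-concatMap : ∀ (h : A → List A′) xs f → ∑ (concatMap h xs) f ≡ ∑ xs (λ x → ∑ (h x) f)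
∑-concatMap h []       f = refl
∑-concatMap h (x ∷ xs) f = trans (∑-++ (h x) _ f) (cong (∑ (h x) f +ᶻ_) (∑-concatMap h xs f))

∑-cartesianProduct : ∀ (xs : List A) (ys : List A′) f →
                     ∑ (cartesianProduct xs ys) f ≡ ∑ xs (λ x → ∑ ys (λ y → f (x , y)))
∑-cartesianProduct []       ys f = refl
∑-cartesianProduct (x ∷ xs) ys f =
  trans (∑-++ (map (x ,_) ys) _ f) (cong₂ _+ᶻ_ (∑-map (x ,_) ys f) (∑-cartesianProduct xs ys f))

∑-filter : ∀ {P : A → Set} (P? : ∀ x → Dec (P x)) xs f →
           ∑ (filter P? xs) f ≡ ∑ xs (λ x → 𝟙 (P? x) *ᶻ f x)
∑-filter P? []       f = refl
∑-filter P? (x ∷ xs) f with does (P? x)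
... | true  = cong₂ _+ᶻ_ (sym (ℤ.*-identityˡ (f x))) (∑-filter P? xs f)
... | false = trans (∑-filter P? xs f) (sym (ℤ.+-identityˡ _))

length-filter≡∑ : ∀ {P : A → Set} (P? : ∀ x → Dec (P x)) xs →
                  + length (filter P? xs) ≡ ∑ xs (λ x → 𝟙 (P? x))
length-filter≡∑ P? [] = refl
length-filter≡∑ P? (x ∷ xs) with does (P? x)
... | true  = cong (1ℤ +ᶻ_) (length-filter≡∑ P? xs)
... | false = trans (length-filter≡∑ P? xs) (sym (ℤ.+-identityˡ _))

∑-nonneg-≤ : ∀ (xs : List A) {f : A → ℤ} {g : A → ℤ} → (∀ x → + ℤ.∣ f x ∣ ℤ.≤ g x) →
             + ℤ.∣ ∑ xs f ∣ ℤ.≤ ∑ xs g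
∑-nonneg-≤ []       le = ℤ.≤-refl
∑-nonneg-≤ (x ∷ xs) {f} le =
  ℤ.≤-trans (ℤ.+≤+ (ℤ.∣i+j∣≤∣i∣+∣j∣ (f x) (∑ xs f))) (ℤ.+-mono-≤ (le x) (∑-nonneg-≤ xs le))

-- The first hypothesis states that exactly one entry satisfies E without comparing entries, as
-- functions are listed only up to pointwise equality. The bijections below are summed in this form.
∑-dirac : ∀ (xs : List A) {E : A → Set} (E? : ∀ x → Dec (E x)) {f : A → ℤ} {v} →
          ∑ xs (λ x → 𝟙 (E? x)) ≡ 1ℤ → (∀ x → E x → f x ≡ v) →
          ∑ xs (λ x → 𝟙 (E? x) *ᶻ f x) ≡ v
∑-dirac xs E? {f} {v} once eq = begin
  ∑ xs (λ x → 𝟙 (E? x) *ᶻ f x)  ≡⟨ ∑-cong xs (λ x → 𝟙-guard (E? x) (eq x)) ⟩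
  ∑ xs (λ x → 𝟙 (E? x) *ᶻ v)    ≡⟨ ∑-*ʳ v xs _ ⟩
  ∑ xs (λ x → 𝟙 (E? x)) *ᶻ v    ≡⟨ cong (_*ᶻ v) once ⟩
  1ℤ *ᶻ v                       ≡⟨ ℤ.*-identityˡ v ⟩
  v                             ∎

∑-tabulate-zero : ∀ n (h : Fin n → A) (f : A → ℤ) → (∀ i → f (h i) ≡ 0ℤ) → ∑ (tabulate h) f ≡ 0ℤ
∑-tabulate-zero zero    h f eq = refl
∑-tabulate-zero (suc n) h f eq = cong₂ _+ᶻ_ (eq zero) (∑-tabulate-zero n (h ∘ suc) f (eq ∘ suc))

∑-tabulate-once : ∀ n (h : Fin n → A) {E : A → Set} (E? : ∀ x → Dec (E x)) j →
                  E (h j) → (∀ i → E (h i) → i ≡ j) → ∑ (tabulate h) (λ x → 𝟙 (E? x)) ≡ 1ℤ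
∑-tabulate-once (suc n) h E? zero e uniq = cong₂ _+ᶻ_ (𝟙-yes (E? _) e)
  (∑-tabulate-zero n (h ∘ suc) _ (λ i → 𝟙-no (E? _) (λ e′ → Fin.0≢1+n (sym (uniq (suc i) e′)))))
∑-tabulate-once (suc n) h E? (suc j) e uniq = trans
  (cong₂ _+ᶻ_ (𝟙-no (E? _) (λ e′ → Fin.0≢1+n (uniq zero e′)))
    (∑-tabulate-once n (h ∘ suc) E? j e (λ i e′ → Fin.suc-injective (uniq (suc i) e′))))
  (ℤ.+-identityˡ 1ℤ)

∑-allFin-once : ∀ {n} {E : Fin n → Set} (E? : ∀ x → Dec (E x)) j → E j → (∀ i → E i → i ≡ j) →
                ∑ (allFin n) (λ x → 𝟙 (E? x)) ≡ 1ℤ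
∑-allFin-once = ∑-tabulate-once _ id

-- Lists in which each object occurs once

_≟ˢ_ : ∀ {k} (S T : Subset k) → Dec (S ≡ T)
_≟ˢ_ = Vec.≡-dec Bool._≟_

∑-subsets-once : ∀ {k} (T : Subset k) → ∑ (subsets k) (λ S → 𝟙 (S ≟ˢ T)) ≡ 1ℤ
∑-subsets-once Vec.[] = refl
∑-subsets-once {suc k} (b Vec.∷ T) = begin
  ∑ (subsets (suc k)) (λ S → 𝟙 (S ≟ˢ (b Vec.∷ T)))
    ≡⟨ ∑-++ (map (outside Vec.∷_) (subsets k)) _ _ ⟩
  ∑ (map (outside Vec.∷_) (subsets k)) _ +ᶻ ∑ (map (inside Vec.∷_) (subsets k)) _
    ≡⟨ cong₂ _+ᶻ_ (∑-map _ (subsets k) _) (∑-map _ (subsets k) _) ⟩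
  ∑ (subsets k) (λ S → 𝟙 ((outside Vec.∷ S) ≟ˢ (b Vec.∷ T))) +ᶻ
  ∑ (subsets k) (λ S → 𝟙 ((inside Vec.∷ S) ≟ˢ (b Vec.∷ T)))
    ≡⟨ heads b ⟩
  1ℤ ∎
  where
  same : ∀ b → ∑ (subsets k) (λ S → 𝟙 ((b Vec.∷ S) ≟ˢ (b Vec.∷ T))) ≡ 1ℤ
  same b = trans (∑-cong (subsets k) (λ S → 𝟙-⇔ ((b Vec.∷ S) ≟ˢ (b Vec.∷ T)) (S ≟ˢ T) Vec.∷-injectiveʳ (cong (b Vec.∷_))))
                 (∑-subsets-once T)
  diff : ∀ {b c} → b ≢ c → ∑ (subsets k) (λ S → 𝟙 ((b Vec.∷ S) ≟ˢ (c Vec.∷ T))) ≡ 0ℤ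
  diff {b} {c} ne = trans (∑-cong (subsets k) (λ S → 𝟙-no ((b Vec.∷ S) ≟ˢ (c Vec.∷ T)) (ne ∘ Vec.∷-injectiveˡ)))
                  (∑-zero (subsets k))
  heads : ∀ b → ∑ (subsets k) (λ S → 𝟙 ((outside Vec.∷ S) ≟ˢ (b Vec.∷ T))) +ᶻ
                ∑ (subsets k) (λ S → 𝟙 ((inside Vec.∷ S) ≟ˢ (b Vec.∷ T))) ≡ 1ℤ
  heads true  = cong₂ _+ᶻ_ (diff {outside} {inside} (λ ())) (same true)
  heads false = cong₂ _+ᶻ_ (same false) (diff {inside} {outside} (λ ()))

endos : ∀ M → List (Fin M → Fin M)
endos M = map finToFun (allFin (M ^ M))

_≗?_ : ∀ {M} (s t : Fin M → Fin M) → Dec (∀ x → s x ≡ t x)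
s ≗? t = Fin.all? (λ x → s x Fin.≟ t x)

∑-endos-once : ∀ {M} (t : Fin M → Fin M) → ∑ (endos M) (λ s → 𝟙 (s ≗? t)) ≡ 1ℤ
∑-endos-once {M} t = trans (∑-map finToFun (allFin (M ^ M)) (λ s → 𝟙 (s ≗? t)))
  (∑-allFin-once (λ i → finToFun i ≗? t) (funToFin t) (Fin.finToFun-funToFin t)
    (λ i eq → trans (sym (Fin.funToFin-finToFin {M} {M} i)) (funToFin-cong eq)))
  where
  funToFin-cong : ∀ {m n} {f g : Fin m → Fin n} → (∀ x → f x ≡ g x) → funToFin f ≡ funToFin g
  funToFin-cong {zero}  eq = refl
  funToFin-cong {suc m} eq = cong₂ combine (eq zero) (funToFin-cong (eq ∘ suc))

-- Sums over subsets by size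

-- Each of n elements goes to the left or to the right part, so F is summed over the subsets of an
-- n-element set at the sizes of subset and complement. This form follows the recursion on subsets;
-- binomial coefficients enter only in `binomialSum-≡`.
binomialSum : ℕ → (ℕ → ℕ → ℤ) → ℤ
binomialSum zero    F = F 0 0
binomialSum (suc n) F = binomialSum n (λ i j → F (suc i) j) +ᶻ binomialSum n (λ i j → F i (suc j))

∑-subsets-∷ : ∀ k (f : Subset (suc k) → ℤ) →
              ∑ (subsets (suc k)) f ≡ ∑ (subsets k) (f ∘ (inside Vec.∷_)) +ᶻ ∑ (subsets k) (f ∘ (outside Vec.∷_))
∑-subsets-∷ k f = begin
  ∑ (subsets (suc k)) f
    ≡⟨ ∑-++ (map (outside Vec.∷_) (subsets k)) _ f ⟩
  ∑ (map (outside Vec.∷_) (subsets k)) f +ᶻ ∑ (map (inside Vec.∷_) (subsets k)) f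
    ≡⟨ cong₂ _+ᶻ_ (∑-map _ (subsets k) f) (∑-map _ (subsets k) f) ⟩
  ∑ (subsets k) (f ∘ (outside Vec.∷_)) +ᶻ ∑ (subsets k) (f ∘ (inside Vec.∷_))
    ≡⟨ ℤ.+-comm (∑ (subsets k) (f ∘ (outside Vec.∷_))) _ ⟩
  ∑ (subsets k) (f ∘ (inside Vec.∷_)) +ᶻ ∑ (subsets k) (f ∘ (outside Vec.∷_)) ∎

∑-⊆ : ∀ {k} (U : Subset k) (F : ℕ → ℕ → ℤ) →
      ∑ (subsets k) (λ S → 𝟙 (S Subset.⊆? U) *ᶻ F ∣ S ∣ ∣ U ─ S ∣) ≡ binomialSum ∣ U ∣ F
∑-⊆ Vec.[] F = trans (ℤ.+-identityʳ _) (ℤ.*-identityˡ (F 0 0))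
∑-⊆ {suc k} (outside Vec.∷ U) F = begin
  ∑ (subsets (suc k)) (λ S → 𝟙 (S Subset.⊆? (outside Vec.∷ U)) *ᶻ F ∣ S ∣ ∣ (outside Vec.∷ U) ─ S ∣)
    ≡⟨ ∑-subsets-∷ k (λ S → 𝟙 (S Subset.⊆? (outside Vec.∷ U)) *ᶻ F ∣ S ∣ ∣ (outside Vec.∷ U) ─ S ∣) ⟩
  _ ≡⟨ cong₂ _+ᶻ_
         (trans (∑-cong (subsets k) λ S → 𝟙-no-* ((inside Vec.∷ S) Subset.⊆? (outside Vec.∷ U)) (F (suc ∣ S ∣) ∣ U ─ S ∣)
                   (λ le → out (le Vec.here)))
                (∑-zero (subsets k)))
         (∑-cong (subsets k) λ S → 𝟙-guard-⇔ ((outside Vec.∷ S) Subset.⊆? (outside Vec.∷ U)) (S Subset.⊆? U)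
            Subset.drop-∷-⊆ Subset.s⊆s (λ _ → refl)) ⟩
  0ℤ +ᶻ ∑ (subsets k) (λ S → 𝟙 (S Subset.⊆? U) *ᶻ F ∣ S ∣ ∣ U ─ S ∣)
    ≡⟨ ℤ.+-identityˡ _ ⟩
  ∑ (subsets k) (λ S → 𝟙 (S Subset.⊆? U) *ᶻ F ∣ S ∣ ∣ U ─ S ∣)
    ≡⟨ ∑-⊆ U F ⟩
  binomialSum ∣ U ∣ F ∎
  where
  out : ¬ (zero ∈ (outside Vec.∷ U))
  out ()
∑-⊆ {suc k} (inside Vec.∷ U) F = begin
  ∑ (subsets (suc k)) (λ S → 𝟙 (S Subset.⊆? (inside Vec.∷ U)) *ᶻ F ∣ S ∣ ∣ (inside Vec.∷ U) ─ S ∣)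
    ≡⟨ ∑-subsets-∷ k (λ S → 𝟙 (S Subset.⊆? (inside Vec.∷ U)) *ᶻ F ∣ S ∣ ∣ (inside Vec.∷ U) ─ S ∣) ⟩
  _ ≡⟨ cong₂ _+ᶻ_
         (∑-cong (subsets k) λ S → 𝟙-guard-⇔ ((inside Vec.∷ S) Subset.⊆? (inside Vec.∷ U)) (S Subset.⊆? U)
            Subset.drop-∷-⊆ Subset.s⊆s (λ _ → refl))
         (∑-cong (subsets k) λ S → 𝟙-guard-⇔ ((outside Vec.∷ S) Subset.⊆? (inside Vec.∷ U)) (S Subset.⊆? U)
            Subset.drop-∷-⊆ Subset.out⊆ (λ _ → refl)) ⟩
  ∑ (subsets k) (λ S → 𝟙 (S Subset.⊆? U) *ᶻ F (suc ∣ S ∣) ∣ U ─ S ∣) +ᶻ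
  ∑ (subsets k) (λ S → 𝟙 (S Subset.⊆? U) *ᶻ F ∣ S ∣ (suc ∣ U ─ S ∣))
    ≡⟨ cong₂ _+ᶻ_ (∑-⊆ U (λ i j → F (suc i) j)) (∑-⊆ U (λ i j → F i (suc j))) ⟩
  binomialSum (suc ∣ U ∣) F ∎

infix 4 _∈_⊆?_
_∈_⊆?_ : ∀ {k} x (S U : Subset k) → Dec (x ∈ S × S ⊆ U)
x ∈ S ⊆? U = (x Subset.∈? S) ×-dec (S Subset.⊆? U)

-- The place of x is forced and the other n elements are free, whence the shift of i.
∑-∈⊆ : ∀ {k} (U : Subset k) {x n} (F : ℕ → ℕ → ℤ) → x ∈ U → ∣ U ∣ ≡ suc n →
       ∑ (subsets k) (λ S → 𝟙 (x ∈ S ⊆? U) *ᶻ F ∣ S ∣ ∣ U ─ S ∣) ≡ binomialSum n (λ i j → F (suc i) j)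
∑-∈⊆ {suc k} (b Vec.∷ U) {zero} {n} F Vec.here eq = begin
  ∑ (subsets (suc k)) (λ S → 𝟙 (zero ∈ S ⊆? (inside Vec.∷ U)) *ᶻ F ∣ S ∣ ∣ (inside Vec.∷ U) ─ S ∣)
    ≡⟨ ∑-subsets-∷ k (λ S → 𝟙 (zero ∈ S ⊆? (inside Vec.∷ U)) *ᶻ F ∣ S ∣ ∣ (inside Vec.∷ U) ─ S ∣) ⟩
  _ ≡⟨ cong₂ _+ᶻ_
         (∑-cong (subsets k) λ S → 𝟙-guard-⇔ (zero ∈ (inside Vec.∷ S) ⊆? (inside Vec.∷ U)) (S Subset.⊆? U)
            (λ (_ , le) → Subset.drop-∷-⊆ le) (λ le → Vec.here , Subset.s⊆s le) (λ _ → refl))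
         (trans (∑-cong (subsets k) λ S → 𝟙-no-* (zero ∈ (outside Vec.∷ S) ⊆? (inside Vec.∷ U)) (F ∣ S ∣ (suc ∣ U ─ S ∣))
                   (λ { (() , _) }))
                (∑-zero (subsets k))) ⟩
  ∑ (subsets k) (λ S → 𝟙 (S Subset.⊆? U) *ᶻ F (suc ∣ S ∣) ∣ U ─ S ∣) +ᶻ 0ℤ
    ≡⟨ ℤ.+-identityʳ _ ⟩
  ∑ (subsets k) (λ S → 𝟙 (S Subset.⊆? U) *ᶻ F (suc ∣ S ∣) ∣ U ─ S ∣)
    ≡⟨ ∑-⊆ U (λ i j → F (suc i) j) ⟩
  binomialSum ∣ U ∣ (λ i j → F (suc i) j)
    ≡⟨ cong (λ m → binomialSum m _) (ℕ.suc-injective eq) ⟩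
  binomialSum n (λ i j → F (suc i) j) ∎
∑-∈⊆ {suc k} (outside Vec.∷ U) {suc x} {n} F (Vec.there x∈U) eq = begin
  ∑ (subsets (suc k)) (λ S → 𝟙 (suc x ∈ S ⊆? (outside Vec.∷ U)) *ᶻ F ∣ S ∣ ∣ (outside Vec.∷ U) ─ S ∣)
    ≡⟨ ∑-subsets-∷ k (λ S → 𝟙 (suc x ∈ S ⊆? (outside Vec.∷ U)) *ᶻ F ∣ S ∣ ∣ (outside Vec.∷ U) ─ S ∣) ⟩
  _ ≡⟨ cong₂ _+ᶻ_
         (trans (∑-cong (subsets k) λ S → 𝟙-no-* (suc x ∈ (inside Vec.∷ S) ⊆? (outside Vec.∷ U)) (F (suc ∣ S ∣) ∣ U ─ S ∣)
                   (λ (_ , le) → out (le Vec.here)))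
                (∑-zero (subsets k)))
         (∑-cong (subsets k) λ S → 𝟙-guard-⇔ (suc x ∈ (outside Vec.∷ S) ⊆? (outside Vec.∷ U)) (x ∈ S ⊆? U)
            (λ (m , le) → Subset.drop-there m , Subset.drop-∷-⊆ le) (λ (m , le) → Vec.there m , Subset.s⊆s le) (λ _ → refl)) ⟩
  0ℤ +ᶻ ∑ (subsets k) (λ S → 𝟙 (x ∈ S ⊆? U) *ᶻ F ∣ S ∣ ∣ U ─ S ∣)
    ≡⟨ ℤ.+-identityˡ _ ⟩
  ∑ (subsets k) (λ S → 𝟙 (x ∈ S ⊆? U) *ᶻ F ∣ S ∣ ∣ U ─ S ∣)
    ≡⟨ ∑-∈⊆ U F x∈U eq ⟩
  binomialSum n (λ i j → F (suc i) j) ∎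
  where
  out : ¬ (zero ∈ (outside Vec.∷ U))
  out ()
-- The head and x would be two elements of a set of size 1.
∑-∈⊆ {suc k} (inside Vec.∷ U) {suc x} {zero} F (Vec.there x∈U) eq =
  ⊥-elim (ℕ.n≮0 (subst (∣ U - x ∣ <_) (ℕ.suc-injective eq) (Subset.x∈p⇒∣p-x∣<∣p∣ x∈U)))
∑-∈⊆ {suc k} (inside Vec.∷ U) {suc x} {suc n} F (Vec.there x∈U) eq = begin
  ∑ (subsets (suc k)) (λ S → 𝟙 (suc x ∈ S ⊆? (inside Vec.∷ U)) *ᶻ F ∣ S ∣ ∣ (inside Vec.∷ U) ─ S ∣)
    ≡⟨ ∑-subsets-∷ k (λ S → 𝟙 (suc x ∈ S ⊆? (inside Vec.∷ U)) *ᶻ F ∣ S ∣ ∣ (inside Vec.∷ U) ─ S ∣) ⟩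
  _ ≡⟨ cong₂ _+ᶻ_
         (∑-cong (subsets k) λ S → 𝟙-guard-⇔ (suc x ∈ (inside Vec.∷ S) ⊆? (inside Vec.∷ U)) (x ∈ S ⊆? U)
            (λ (m , le) → Subset.drop-there m , Subset.drop-∷-⊆ le) (λ (m , le) → Vec.there m , Subset.s⊆s le) (λ _ → refl))
         (∑-cong (subsets k) λ S → 𝟙-guard-⇔ (suc x ∈ (outside Vec.∷ S) ⊆? (inside Vec.∷ U)) (x ∈ S ⊆? U)
            (λ (m , le) → Subset.drop-there m , Subset.drop-∷-⊆ le) (λ (m , le) → Vec.there m , Subset.out⊆ le) (λ _ → refl)) ⟩
  ∑ (subsets k) (λ S → 𝟙 (x ∈ S ⊆? U) *ᶻ F (suc ∣ S ∣) ∣ U ─ S ∣) +ᶻ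
  ∑ (subsets k) (λ S → 𝟙 (x ∈ S ⊆? U) *ᶻ F ∣ S ∣ (suc ∣ U ─ S ∣))
    ≡⟨ cong₂ _+ᶻ_ (∑-∈⊆ U (λ i j → F (suc i) j) x∈U (ℕ.suc-injective eq))
                  (∑-∈⊆ U (λ i j → F i (suc j)) x∈U (ℕ.suc-injective eq)) ⟩
  binomialSum (suc n) (λ i j → F (suc i) j) ∎

∑-∁ : ∀ k (F : ℕ → ℕ → ℤ) → ∑ (subsets k) (λ U → F ∣ U ∣ ∣ ∁ U ∣) ≡ binomialSum k F
∑-∁ zero    F = ℤ.+-identityʳ _
∑-∁ (suc k) F = begin
  ∑ (subsets (suc k)) (λ U → F ∣ U ∣ ∣ ∁ U ∣)
    ≡⟨ ∑-subsets-∷ k (λ U → F ∣ U ∣ ∣ ∁ U ∣) ⟩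
  ∑ (subsets k) (λ U → F (suc ∣ U ∣) ∣ ∁ U ∣) +ᶻ ∑ (subsets k) (λ U → F ∣ U ∣ (suc ∣ ∁ U ∣))
    ≡⟨ cong₂ _+ᶻ_ (∑-∁ k (λ i j → F (suc i) j)) (∑-∁ k (λ i j → F i (suc j))) ⟩
  binomialSum (suc k) F ∎

-- Induction by Pascal's rule; the second sum is lengthened by a term with coefficient `n C suc n`,
-- which is 0, so that its tail lines up with the first sum.
binomialSum-≡ : ∀ n F → binomialSum n F ≡ ∑< (suc n) (λ i → + (n C i) *ᶻ F i (n ∸ i))
binomialSum-≡ zero    F = sym (trans (ℤ.+-identityʳ _) (ℤ.*-identityˡ (F 0 0)))
binomialSum-≡ (suc n) F = begin
  binomialSum n (λ i j → F (suc i) j) +ᶻ binomialSum n (λ i j → F i (suc j))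
    ≡⟨ cong₂ _+ᶻ_ (binomialSum-≡ n (λ i j → F (suc i) j)) (binomialSum-≡ n (λ i j → F i (suc j))) ⟩
  ∑< (suc n) a +ᶻ ∑< (suc n) (λ i → + (n C i) *ᶻ F i (suc (n ∸ i)))
    ≡⟨ cong (∑< (suc n) a +ᶻ_) (trans
         (∑<-cong (suc n) (λ i i<n → cong (λ m → + (n C i) *ᶻ F i m) (sym (ℕ.+-∸-assoc 1 (s≤s⁻¹ i<n)))))
         (sym (trans (∑<-last (suc n) b) (trans (cong (∑< (suc n) b +ᶻ_) bₙ₊₁≡0) (ℤ.+-identityʳ _))))) ⟩
  ∑< (suc n) a +ᶻ (b 0 +ᶻ ∑< (suc n) (b ∘ suc))
    ≡⟨ shuffle (∑< (suc n) a) (b 0) _ ⟩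
  b 0 +ᶻ (∑< (suc n) a +ᶻ ∑< (suc n) (b ∘ suc))
    ≡⟨ cong (b 0 +ᶻ_) (sym (∑<-+ (suc n) a (b ∘ suc))) ⟩
  b 0 +ᶻ ∑< (suc n) (λ i → a i +ᶻ b (suc i))
    ≡⟨ cong (b 0 +ᶻ_) (∑<-cong (suc n) (λ i _ → pascal i)) ⟩
  b 0 +ᶻ ∑< (suc n) (λ i → + (suc n C suc i) *ᶻ F (suc i) (n ∸ i)) ∎
  where
  a b : ℕ → ℤ
  a i = + (n C i) *ᶻ F (suc i) (n ∸ i)
  b i = + (n C i) *ᶻ F i (suc n ∸ i)
  bₙ₊₁≡0 : b (suc n) ≡ 0ℤ
  bₙ₊₁≡0 = cong (λ m → + m *ᶻ F (suc n) (n ∸ n)) (k>n⇒nCk≡0 {n} {suc n} ℕ.≤-refl)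
  shuffle : ∀ x y z → x +ᶻ (y +ᶻ z) ≡ y +ᶻ (x +ᶻ z)
  shuffle = solve-∀
  pascal : ∀ i → a i +ᶻ b (suc i) ≡ + (suc n C suc i) *ᶻ F (suc i) (n ∸ i)
  pascal i = trans (sym (ℤ.*-distribʳ-+ (F (suc i) (n ∸ i)) (+ (n C i)) (+ (n C suc i))))
                   (cong (λ m → + m *ᶻ F (suc i) (n ∸ i)) (nCk+nC[k+1]≡[n+1]C[k+1] n i))

if-yes : ∀ {A X : Set} (d : Dec A) {x y : X} → A → (if does d then x else y) ≡ x
if-yes d a rewrite dec-true d a = refl

if-no : ∀ {A X : Set} (d : Dec A) {x y : X} → ¬ A → (if does d then x else y) ≡ y
if-no d ¬a rewrite dec-false d ¬a = refl

does⇒ : ∀ {A : Set} (d : Dec A) → does d ≡ true → A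
does⇒ (yes a) _ = a

x∈p─q⇒x∉q : ∀ {n} {p q : Subset n} {x} → x ∈ p ─ q → x ∉ q
x∈p─q⇒x∉q {p = _ Vec.∷ _} {inside Vec.∷ _} {zero}  ()
x∈p─q⇒x∉q {p = _ Vec.∷ _} {outside Vec.∷ _} {zero} _ ()
x∈p─q⇒x∉q {p = _ Vec.∷ p} {inside Vec.∷ q} {suc x} (Vec.there m) (Vec.there m′) = x∈p─q⇒x∉q {p = p} m m′
x∈p─q⇒x∉q {p = _ Vec.∷ p} {outside Vec.∷ q} {suc x} (Vec.there m) (Vec.there m′) = x∈p─q⇒x∉q {p = p} m m′

x∈p─q⇒x∈p : ∀ {n} {p q : Subset n} {x} → x ∈ p ─ q → x ∈ p
x∈p─q⇒x∈p {p = p} {q} = Subset.p─q⊆p p q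

-- Surfaces and their components

module Gluing {k : ℕ} (P : ℕ) where

  Gluing : Set
  Gluing = Side k P → Side k P

  pol : Side k P → Fin k
  pol = polygon {k} P

  pol∈? : ∀ (S : Subset k) z → Dec (pol z ∈ S)
  pol∈? S z = pol z Subset.∈? S

  Closed : Subset k → Gluing → Set
  Closed V s = ∀ z → pol z ∈ V → pol (s z) ∈ V

  open IsSurface

  surface-closed : ∀ {U : Subset k} {s : Gluing} → IsSurface P U s → Closed U s
  surface-closed {U} {s} σ z z∈U with pol∈? U (s z)
  ... | yes sz∈U = sz∈U
  ... | no  sz∉U = ⊥-elim (sz∉U (subst (λ y → pol y ∈ U)
                     (trans (sym (involutive σ z)) (unused σ (s z) sz∉U)) z∈U))

  closed-─ : ∀ {U S : Subset k} {s : Gluing} → (∀ z → s (s z) ≡ z) → Closed U s → Closed S s → Closed (U ─ S) s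
  closed-─ {U} {S} {s} inv cU cS z z∈ =
    Subset.x∈p∧x∉q⇒x∈p─q (cU z (x∈p─q⇒x∈p z∈))
      (λ sz∈S → x∈p─q⇒x∉q {p = U} z∈ (subst (λ y → pol y ∈ S) (inv z) (cS (s z) sz∈S)))

  join : Subset k → Gluing → Gluing → Gluing
  join S s′ s″ z = if does (pol∈? S z) then s′ z else s″ z

  join-∈ : ∀ S s′ s″ {z} → pol z ∈ S → join S s′ s″ z ≡ s′ z
  join-∈ S s′ s″ {z} = if-yes (pol∈? S z)

  join-∉ : ∀ S s′ s″ {z} → pol z ∉ S → join S s′ s″ z ≡ s″ z
  join-∉ S s′ s″ {z} = if-no (pol∈? S z)

  -- A surface fixes the sides outside its label set, so cutting s down to S means joining it with
  -- the identity.
  restrict : Subset k → Gluing → Gluing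
  restrict S s = join S s id

  surface-cong : ∀ {U : Subset k} {s t : Gluing} → (∀ z → s z ≡ t z) → IsSurface P U s → IsSurface P U t
  surface-cong {s = s} {t} eq σ = isSurface
    (λ z → trans (sym (trans (eq (s z)) (cong t (eq z)))) (involutive σ z))
    (λ z z∈U tz≡z → glued σ z z∈U (trans (eq z) tz≡z))
    (λ z z∉U → trans (sym (eq z)) (unused σ z z∉U))

  restrict-surface : ∀ {U V : Subset k} {s : Gluing} → V ⊆ U → Closed V s → IsSurface P U s → IsSurface P V (restrict V s)
  restrict-surface {U} {V} {s} V⊆U cV σ = isSurface inv
    (λ z z∈V eq → glued σ z (V⊆U z∈V) (trans (sym (join-∈ V s id z∈V)) eq))
    (λ z z∉V → join-∉ V s id z∉V)
    where
    inv : ∀ z → restrict V s (restrict V s z) ≡ z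
    inv z with pol∈? V z
    ... | yes z∈V = trans (join-∈ V s id (cV z z∈V)) (involutive σ z)
    ... | no  z∉V = join-∉ V s id z∉V

  join-closed : ∀ {S : Subset k} {s′ s″ : Gluing} → IsSurface P S s′ → Closed S (join S s′ s″)
  join-closed {S} {s′} {s″} σ′ z z∈S = subst (λ y → pol y ∈ S) (sym (join-∈ S s′ s″ z∈S)) (surface-closed σ′ z z∈S)

  surface-─-∉ : ∀ {U S : Subset k} {s : Gluing} → IsSurface P (U ─ S) s → ∀ z → pol z ∉ S → pol (s z) ∉ S
  surface-─-∉ {U} {S} {s} σ z z∉S with pol∈? (U ─ S) z
  ... | yes z∈ = x∈p─q⇒x∉q {p = U} (surface-closed σ z z∈)
  ... | no  z∉ = subst (λ y → pol y ∉ S) (sym (unused σ z z∉)) z∉S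

  join-surface : ∀ {U S : Subset k} {s′ s″ : Gluing} → S ⊆ U → IsSurface P S s′ → IsSurface P (U ─ S) s″ →
                 IsSurface P U (join S s′ s″)
  join-surface {U} {S} {s′} {s″} S⊆U σ′ σ″ = isSurface inv glue unuse
    where
    inv : ∀ z → join S s′ s″ (join S s′ s″ z) ≡ z
    inv z with pol∈? S z
    ... | yes z∈S = trans (join-∈ S s′ s″ (surface-closed σ′ z z∈S)) (involutive σ′ z)
    ... | no  z∉S = trans (join-∉ S s′ s″ (surface-─-∉ σ″ z z∉S)) (involutive σ″ z)
    glue : ∀ z → pol z ∈ U → join S s′ s″ z ≢ z
    glue z z∈U with pol∈? S z
    ... | yes z∈S = glued σ′ z z∈S
    ... | no  z∉S = glued σ″ z (Subset.x∈p∧x∉q⇒x∈p─q z∈U z∉S)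
    unuse : ∀ z → pol z ∉ U → join S s′ s″ z ≡ z
    unuse z z∉U = trans (join-∉ S s′ s″ (z∉U ∘ S⊆U)) (unused σ″ z (z∉U ∘ x∈p─q⇒x∈p))

  connected-closed : ∀ {V : Subset k} {s : Gluing} {u v : Fin k} → Closed V s → u ∈ V → Connected {k} P s u v → v ∈ V
  connected-closed         c u∈V ε = u∈V
  connected-closed {V} {s} c u∈V ((z , refl , refl) ◅ rs) = connected-closed c (c z u∈V) rs

  connected-transfer : ∀ {V : Subset k} {s t : Gluing} {u v : Fin k} → Closed V s → (∀ z → pol z ∈ V → s z ≡ t z) →
                       u ∈ V → Connected {k} P s u v → Connected {k} P t u v
  connected-transfer c eq u∈V ε = ε
  connected-transfer c eq u∈V ((z , refl , refl) ◅ rs) =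
    (z , refl , cong pol (sym (eq z u∈V))) ◅ connected-transfer c eq (c z u∈V) rs

  connected-cong : ∀ {s t : Gluing} {u v : Fin k} → (∀ z → s z ≡ t z) → Connected {k} P s u v → Connected {k} P t u v
  connected-cong eq = Star.map (λ { (z , p , q) → z , p , trans (cong pol (sym (eq z))) q })

  connected-sym : ∀ {s : Gluing} {u v : Fin k} → (∀ z → s (s z) ≡ z) → Connected {k} P s u v → Connected {k} P s v u
  connected-sym {s} inv = Star.reverse (λ { (z , p , q) → s z , q , trans (cong pol (inv z)) p })

  component : Gluing → Fin k → Subset k
  component s x = Vec.tabulate (λ v → does (connected? {k} P s x v))

  ∈component⇒ : ∀ {s : Gluing} {x v : Fin k} → v ∈ component s x → Connected {k} P s x v
  ∈component⇒ {s} {x} {v} v∈ = does⇒ (connected? {k} P s x v)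
    (trans (sym (Vec.lookup∘tabulate (λ v → does (connected? {k} P s x v)) v)) (Vec.[]=⇒lookup v∈))

  ⇒∈component : ∀ {s : Gluing} {x v : Fin k} → Connected {k} P s x v → v ∈ component s x
  ⇒∈component {s} {x} {v} c = Vec.lookup⇒[]= v _
    (trans (Vec.lookup∘tabulate (λ v → does (connected? {k} P s x v)) v) (dec-true (connected? {k} P s x v) c))

  component-closed : ∀ {s : Gluing} {x : Fin k} → Closed (component s x) s
  component-closed {s} {x} z z∈ = ⇒∈component (∈component⇒ z∈ ◅◅ ((z , refl , refl) ◅ ε))

  component-⊆ : ∀ {s : Gluing} {x : Fin k} {U : Subset k} → IsSurface P U s → x ∈ U → component s x ⊆ U
  component-⊆ σ x∈U v∈ = connected-closed (surface-closed σ) x∈U (∈component⇒ v∈)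

  -- For x in S, a surface on S with this property is a connected one; the root x is the polygon
  -- whose component is split off.
  Spanned : Fin k → Subset k → Gluing → Set
  Spanned x S s = ∀ v → v ∈ S → Connected {k} P s x v

  spanned? : ∀ x S s → Dec (Spanned x S s)
  spanned? x S s = Fin.all? (λ v → (v Subset.∈? S) →-dec connected? {k} P s x v)

  Triple : Set
  Triple = Subset k × Gluing × Gluing

  -- The graph of the map that sends s to the component of x with the two restrictions of s.
  -- `SplitParts` describes its image and `join` inverts it. Surfaces are compared pointwise, so the
  -- bijection is handled as a relation.
  Splits : Fin k → Subset k → Gluing → Triple → Set
  Splits x U s (S , s′ , s″) =
    S ≡ component s x × (∀ z → s′ z ≡ restrict S s z) × (∀ z → s″ z ≡ restrict (U ─ S) s z)

  SplitParts : Fin k → Subset k → Triple → Set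
  SplitParts x U (S , s′ , s″) =
    (x ∈ S × S ⊆ U) × (IsSurface P S s′ × Spanned x S s′) × IsSurface P (U ─ S) s″

  splits⇒parts : ∀ {x : Fin k} {U : Subset k} {s : Gluing} {t : Triple} → x ∈ U → IsSurface P U s → Splits x U s t → SplitParts x U t
  splits⇒parts {x} {U} {s} {S , s′ , s″} x∈U σ (refl , eq′ , eq″) =
    (⇒∈component ε , S⊆U) ,
    (surface-cong (sym ∘ eq′) (restrict-surface S⊆U component-closed σ) ,
     λ v v∈S → connected-cong (sym ∘ eq′)
       (connected-transfer component-closed (λ z z∈S → sym (join-∈ (component s x) s id z∈S)) (⇒∈component ε) (∈component⇒ v∈S))) ,
    surface-cong (sym ∘ eq″)
      (restrict-surface x∈p─q⇒x∈p (closed-─ (involutive σ) (surface-closed σ) component-closed) σ)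
    where
    S⊆U : component s x ⊆ U
    S⊆U = component-⊆ σ x∈U

  splits⇒join : ∀ {x : Fin k} {U : Subset k} {s : Gluing} {t : Triple} → x ∈ U → IsSurface P U s → Splits x U s t →
                ∀ z → s z ≡ join (proj₁ t) (proj₁ (proj₂ t)) (proj₂ (proj₂ t)) z
  splits⇒join {x} {U} {s} {S , s′ , s″} x∈U σ (refl , eq′ , eq″) z with pol∈? S z
  ... | yes z∈S = sym (trans (eq′ z) (join-∈ S s id z∈S))
  ... | no  z∉S with pol∈? U z
  ...   | yes z∈U = sym (trans (eq″ z) (join-∈ (U ─ S) s id (Subset.x∈p∧x∉q⇒x∈p─q z∈U z∉S)))
  ...   | no  z∉U = trans (unused σ z z∉U) (sym (trans (eq″ z) (join-∉ (U ─ S) s id (z∉U ∘ x∈p─q⇒x∈p))))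

  parts⇒surface : ∀ {x : Fin k} {U : Subset k} {t : Triple} → SplitParts x U t →
                  IsSurface P U (join (proj₁ t) (proj₁ (proj₂ t)) (proj₂ (proj₂ t)))
  parts⇒surface ((_ , S⊆U) , (σ′ , _) , σ″) = join-surface S⊆U σ′ σ″

  parts⇒splits : ∀ {x : Fin k} {U : Subset k} {t : Triple} → SplitParts x U t →
                 Splits x U (join (proj₁ t) (proj₁ (proj₂ t)) (proj₂ (proj₂ t))) t
  parts⇒splits {x} {U} {S , s′ , s″} ((x∈S , S⊆U) , (σ′ , span) , σ″) =
    Subset.⊆-antisym (λ v∈S → ⇒∈component (connected-transfer (surface-closed σ′) (λ z z∈S → sym (join-∈ S s′ s″ z∈S)) x∈S (span _ v∈S)))
                     (λ v∈ → connected-closed (join-closed σ′) x∈S (∈component⇒ v∈)) ,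
    eq′ , eq″
    where
    eq′ : ∀ z → s′ z ≡ restrict S (join S s′ s″) z
    eq′ z with pol∈? S z
    ... | yes _   = refl
    ... | no  z∉S = unused σ′ z z∉S
    eq″ : ∀ z → s″ z ≡ restrict (U ─ S) (join S s′ s″) z
    eq″ z with pol∈? (U ─ S) z
    ... | yes z∈ = sym (join-∉ S s′ s″ (x∈p─q⇒x∉q {p = U} z∈))
    ... | no  z∉ = unused σ″ z z∉

  splits-cong : ∀ {x : Fin k} {U : Subset k} {s t : Gluing} {r : Triple} → (∀ z → s z ≡ t z) → Splits x U s r → Splits x U t r
  splits-cong {x} {U} {s} {t} {S , s′ , s″} eq (refl , eq′ , eq″) =
    Subset.⊆-antisym (λ v∈ → ⇒∈component (connected-cong eq (∈component⇒ v∈)))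
                     (λ v∈ → ⇒∈component (connected-cong (sym ∘ eq) (∈component⇒ v∈))) ,
    (λ z → trans (eq′ z) (restrict-cong S z)) ,
    (λ z → trans (eq″ z) (restrict-cong (U ─ S) z))
    where
    restrict-cong : ∀ V z → restrict V s z ≡ restrict V t z
    restrict-cong V z with pol∈? V z
    ... | yes _ = eq z
    ... | no  _ = refl

-- Class representatives in lists

module _ {A : Set} where

  filter-comm : ∀ {Q R : A → Set} (Q? : ∀ x → Dec (Q x)) (R? : ∀ x → Dec (R x)) xs →
                filter Q? (filter R? xs) ≡ filter R? (filter Q? xs)
  filter-comm Q? R? [] = refl
  filter-comm Q? R? (x ∷ xs) with does (R? x) in eqR | does (Q? x) in eqQ
  ... | true  | true  rewrite eqR | eqQ = cong (x ∷_) (filter-comm Q? R? xs)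
  ... | true  | false rewrite eqQ = filter-comm Q? R? xs
  ... | false | true  rewrite eqR = filter-comm Q? R? xs
  ... | false | false = filter-comm Q? R? xs

  filter-filter : ∀ {O Q R : A → Set} (O? : ∀ x → Dec (O x)) (Q? : ∀ x → Dec (Q x)) (R? : ∀ x → Dec (R x)) →
                  (∀ {x} → Q x → R x → O x) → (∀ {x} → O x → Q x × R x) →
                  ∀ xs → filter Q? (filter R? xs) ≡ filter O? xs
  filter-filter O? Q? R? f g [] = refl
  filter-filter O? Q? R? f g (x ∷ xs) with R? x
  ... | no ¬r = trans (filter-filter O? Q? R? f g xs) (sym (List.filter-reject O? (¬r ∘ proj₂ ∘ g)))
  ... | yes r with Q? x
  ...   | yes q = trans (cong (x ∷_) (filter-filter O? Q? R? f g xs)) (sym (List.filter-accept O? (f q r)))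
  ...   | no ¬q = trans (filter-filter O? Q? R? f g xs) (sym (List.filter-reject O? (¬q ∘ proj₁ ∘ g)))

  filter-cong-All : ∀ {V Q R : A → Set} (Q? : ∀ x → Dec (Q x)) (R? : ∀ x → Dec (R x)) →
                    (∀ {x} → V x → Q x → R x) → (∀ {x} → V x → R x → Q x) →
                    ∀ {xs} → All V xs → filter Q? xs ≡ filter R? xs
  filter-cong-All Q? R? f g [] = refl
  filter-cong-All Q? R? f g (_∷_ {x} v vs) with Q? x
  ... | yes q = trans (cong (x ∷_) (filter-cong-All Q? R? f g vs)) (sym (List.filter-accept R? (f v q)))
  ... | no ¬q = trans (filter-cong-All Q? R? f g vs) (sym (List.filter-reject R? (¬q ∘ g v)))

  length-partition : ∀ {Q : A → Set} (Q? : ∀ x → Dec (Q x)) xs →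
                     length xs ≡ length (filter Q? xs) + length (filter (¬? ∘ Q?) xs)
  length-partition Q? [] = refl
  length-partition Q? (x ∷ xs) with does (Q? x)
  ... | true  = cong suc (length-partition Q? xs)
  ... | false = trans (cong suc (length-partition Q? xs)) (sym (ℕ.+-suc _ _))

  module _ {R : A → A → Set} (R? : ∀ x y → Dec (R x y)) where

    -- As Q passes from y to x along R x y, an entry outside Q removes only entries outside Q; and
    -- the removal caused by an entry in Q commutes with the filter.
    filter-deduplicate : ∀ {Q : A → Set} (Q? : ∀ x → Dec (Q x)) →
                         (∀ {x y} → R x y → Q y → Q x) →
                         ∀ xs → filter Q? (deduplicate R? xs) ≡ deduplicate R? (filter Q? xs)
    filter-deduplicate Q? resp [] = refl
    filter-deduplicate Q? resp (x ∷ xs) with Q? x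
    ... | yes q = cong (x ∷_) (trans (filter-comm Q? (¬? ∘ R? x) (deduplicate R? xs))
                                     (cong (filter (¬? ∘ R? x)) (filter-deduplicate Q? resp xs)))
    ... | no ¬q = trans (filter-filter Q? Q? (¬? ∘ R? x) (λ q _ → q) (λ q → q , λ r → ¬q (resp r q)) (deduplicate R? xs))
                        (filter-deduplicate Q? resp xs)

    length-deduplicate-total : ∀ {V : A → Set} → (∀ {x y} → V x → V y → R x y) →
                               ∀ {x xs} → x List.∈ xs → All V xs → length (deduplicate R? xs) ≡ 1
    length-deduplicate-total tot {xs = y ∷ ys} _ (v ∷ vs) = cong (suc ∘ length)
      (List.filter-none (¬? ∘ R? y) (All.map (λ v′ ¬r → ¬r (tot v v′)) (All.deduplicate⁺ R? vs)))

    deduplicate-cong : ∀ {V : A → Set} {R′ : A → A → Set} (R′? : ∀ x y → Dec (R′ x y)) →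
                       (∀ {x y} → V x → V y → R x y → R′ x y) → (∀ {x y} → V x → V y → R′ x y → R x y) →
                       ∀ {xs} → All V xs → deduplicate R? xs ≡ deduplicate R′? xs
    deduplicate-cong R′? f g [] = refl
    deduplicate-cong R′? f g (_∷_ {x} v vs) = cong (x ∷_) (trans
      (filter-cong-All (¬? ∘ R? x) (¬? ∘ R′? x) (λ v′ ¬r → ¬r ∘ g v v′) (λ v′ ¬r → ¬r ∘ f v v′) (All.deduplicate⁺ R? vs))
      (cong (filter (¬? ∘ R′? x)) (deduplicate-cong R′? f g vs)))

module Decomposition {k : ℕ} (P : ℕ) where

  open Gluing {k} P

  -- The component of x contributes a single representative. On the remaining polygons s and its
  -- restriction agree, so they have the same connections there and the same representatives.
  π₀-split : ∀ {x U} {s : Gluing} {t : Triple} → x ∈ U → IsSurface P U s → Splits x U s t →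
             π₀ P U s ≡ suc (π₀ P (U ─ proj₁ t) (proj₂ (proj₂ t)))
  π₀-split {x} {U} {s} {S , s′ , s″} x∈U σ sp@(refl , _ , eq″) = begin
    length (deduplicate con? xs)
      ≡⟨ length-partition (Subset._∈? S) (deduplicate con? xs) ⟩
    length (filter (Subset._∈? S) (deduplicate con? xs)) + length (filter (¬? ∘ (Subset._∈? S)) (deduplicate con? xs))
      ≡⟨ cong₂ (λ ys zs → length ys + length zs)
           (filter-deduplicate con? (Subset._∈? S) (λ c y∈S → ⇒∈component (∈component⇒ y∈S ◅◅ connected-sym inv c)) xs)
           (filter-deduplicate con? (¬? ∘ (Subset._∈? S)) (λ c y∉S x∈S → y∉S (⇒∈component (∈component⇒ x∈S ◅◅ c))) xs) ⟩
    length (deduplicate con? (filter (Subset._∈? S) xs)) + length (deduplicate con? (filter (¬? ∘ (Subset._∈? S)) xs))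
      ≡⟨ cong₂ _+_
           (length-deduplicate-total con? {V = _∈ S}
             (λ a b → connected-sym inv (∈component⇒ a) ◅◅ ∈component⇒ b)
             (List.∈-filter⁺ (Subset._∈? S) (List.∈-filter⁺ (Subset._∈? U) (List.∈-allFin x) x∈U) (⇒∈component ε))
             (All.all-filter (Subset._∈? S) xs))
           (cong length (trans
             (cong (deduplicate con?)
               (filter-filter (Subset._∈? (U ─ S)) (¬? ∘ (Subset._∈? S)) (Subset._∈? U)
                 (λ ∉S ∈U → Subset.x∈p∧x∉q⇒x∈p─q ∈U ∉S) (λ m → x∈p─q⇒x∉q {p = U} m , x∈p─q⇒x∈p m) (allFin k)))
             (deduplicate-cong con? {V = _∈ (U ─ S)} (connected? {k} P s″)
               (λ a _ → connected-transfer closed (λ z z∈ → sym (s″≡s z z∈)) a)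
               (λ a _ → connected-transfer (surface-closed (proj₂ (proj₂ (splits⇒parts x∈U σ sp)))) s″≡s a)
               (All.all-filter (Subset._∈? (U ─ S)) (allFin k))))) ⟩
    suc (π₀ P (U ─ S) s″) ∎
    where
    inv = IsSurface.involutive σ
    con? = connected? {k} P s
    xs = filter (Subset._∈? U) (allFin k)
    closed : Closed (U ─ S) s
    closed = closed-─ inv (surface-closed σ) component-closed
    s″≡s : ∀ z → pol z ∈ U ─ S → s″ z ≡ s z
    s″≡s z z∈ = trans (eq″ z) (join-∈ (U ─ S) s id z∈)

∑-cartesianProduct-once : ∀ {A B : Set} (xs : List A) (ys : List B) {Q : A → Set} {R : A → B → Set}
  (Q? : ∀ x → Dec (Q x)) (R? : ∀ x y → Dec (R x y)) →
  ∑ xs (λ x → 𝟙 (Q? x)) ≡ 1ℤ → (∀ x → ∑ ys (λ y → 𝟙 (R? x y)) ≡ 1ℤ) →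
  ∑ (cartesianProduct xs ys) (λ (x , y) → 𝟙 (Q? x ×-dec R? x y)) ≡ 1ℤ
∑-cartesianProduct-once xs ys Q? R? onceQ onceR = begin
  ∑ (cartesianProduct xs ys) (λ (x , y) → 𝟙 (Q? x ×-dec R? x y))
    ≡⟨ ∑-cartesianProduct xs ys _ ⟩
  ∑ xs (λ x → ∑ ys (λ y → 𝟙 (Q? x ×-dec R? x y)))
    ≡⟨ ∑-cong xs (λ x → trans (∑-cong ys (λ y → 𝟙-× (Q? x) (R? x y)))
                              (trans (∑-*ˡ (𝟙 (Q? x)) ys _) (cong (𝟙 (Q? x) *ᶻ_) (onceR x)))) ⟩
  ∑ xs (λ x → 𝟙 (Q? x) *ᶻ 1ℤ)
    ≡⟨ ∑-*ʳ 1ℤ xs _ ⟩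
  ∑ xs (λ x → 𝟙 (Q? x)) *ᶻ 1ℤ
    ≡⟨ cong (_*ᶻ 1ℤ) onceQ ⟩
  1ℤ ∎

-- Recursion by splitting off a component

module Counting {k : ℕ} (P : ℕ) where

  open Gluing {k} P
  open Decomposition {k} P

  gluings : List Gluing
  gluings = endos (k * P)

  -- One recursion serves for φ = 1 (all surfaces), φ = [· = m] (m components)
  -- and φ = (-1)^· (signed count).
  weighted : Subset k → (ℕ → ℤ) → ℤ
  weighted U φ = ∑ gluings (λ s → 𝟙 (isSurface? P U s) *ᶻ φ (π₀ P U s))

  spanned : Fin k → Subset k → ℤ
  spanned x S = ∑ gluings (λ s → 𝟙 (isSurface? P S s ×-dec spanned? x S s))

  triples : List Triple
  triples = cartesianProduct (subsets k) (cartesianProduct gluings gluings)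

  splits? : ∀ x U s t → Dec (Splits x U s t)
  splits? x U s (S , s′ , s″) =
    (S ≟ˢ component s x) ×-dec ((s′ ≗? restrict S s) ×-dec (s″ ≗? restrict (U ─ S) s))

  parts? : ∀ x U t → Dec (SplitParts x U t)
  parts? x U (S , s′ , s″) =
    (x ∈ S ⊆? U) ×-dec ((isSurface? P S s′ ×-dec spanned? x S s′) ×-dec isSurface? P (U ─ S) s″)

  splits-once : ∀ x U s → ∑ triples (λ t → 𝟙 (splits? x U s t)) ≡ 1ℤ
  splits-once x U s = ∑-cartesianProduct-once (subsets k) _
    (_≟ˢ component s x) (λ S (s′ , s″) → (s′ ≗? restrict S s) ×-dec (s″ ≗? restrict (U ─ S) s))
    (∑-subsets-once (component s x))
    (λ S → ∑-cartesianProduct-once gluings gluings (_≗? restrict S s) (λ _ s″ → s″ ≗? restrict (U ─ S) s)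
             (∑-endos-once (restrict S s)) (λ _ → ∑-endos-once (restrict (U ─ S) s)))

  joinᵗ : Triple → Gluing
  joinᵗ (S , s′ , s″) = join S s′ s″

  -- Double counting on the graph `Splits`: each surface is paired with its one triple, the sums are
  -- exchanged, and each admissible triple is paired with its one surface, the join. The component
  -- removed accounts for the shift of φ.
  weighted-rec : ∀ {x U} → x ∈ U → ∀ φ →
    weighted U φ ≡ ∑ (subsets k) (λ S → 𝟙 (x ∈ S ⊆? U) *ᶻ (spanned x S *ᶻ weighted (U ─ S) (φ ∘ suc)))
  weighted-rec {x} {U} x∈U φ = begin
    ∑ gluings (λ s → wt s)
      ≡⟨ ∑-cong gluings (λ s → sym (trans (∑-*ʳ (wt s) triples _)
           (trans (cong (_*ᶻ wt s) (splits-once x U s)) (ℤ.*-identityˡ (wt s))))) ⟩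
    ∑ gluings (λ s → ∑ triples (λ t → 𝟙 (splits? x U s t) *ᶻ wt s))
      ≡⟨ ∑-swap gluings triples (λ s t → 𝟙 (splits? x U s t) *ᶻ wt s) ⟩
    ∑ triples (λ t → ∑ gluings (λ s → 𝟙 (splits? x U s t) *ᶻ wt s))
      ≡⟨ ∑-cong triples (λ t → trans (∑-cong gluings (λ s → bijection s t))
           (∑-dirac gluings (_≗? joinᵗ t) (∑-endos-once (joinᵗ t)) (λ _ _ → refl))) ⟩
    ∑ triples (λ t → 𝟙 (parts? x U t) *ᶻ wt″ t)
      ≡⟨ ∑-cartesianProduct (subsets k) (cartesianProduct gluings gluings) (λ t → 𝟙 (parts? x U t) *ᶻ wt″ t) ⟩
    ∑ (subsets k) (λ S → ∑ (cartesianProduct gluings gluings) (λ r → 𝟙 (parts? x U (S , r)) *ᶻ wt″ (S , r)))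
      ≡⟨ ∑-cong (subsets k) factor ⟩
    ∑ (subsets k) (λ S → 𝟙 (x ∈ S ⊆? U) *ᶻ (spanned x S *ᶻ weighted (U ─ S) (φ ∘ suc))) ∎
    where
    wt : Gluing → ℤ
    wt s = 𝟙 (isSurface? P U s) *ᶻ φ (π₀ P U s)
    wt″ : Triple → ℤ
    wt″ (S , s′ , s″) = φ (suc (π₀ P (U ─ S) s″))

    bijection : ∀ s t → 𝟙 (splits? x U s t) *ᶻ wt s ≡ 𝟙 (s ≗? joinᵗ t) *ᶻ (𝟙 (parts? x U t) *ᶻ wt″ t)
    bijection s t = begin
      𝟙 (splits? x U s t) *ᶻ (𝟙 (isSurface? P U s) *ᶻ φ (π₀ P U s))
        ≡⟨ ℤ.*-assoc (𝟙 (splits? x U s t)) (𝟙 (isSurface? P U s)) (φ (π₀ P U s)) ⟨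
      𝟙 (splits? x U s t) *ᶻ 𝟙 (isSurface? P U s) *ᶻ φ (π₀ P U s)
        ≡⟨ cong (_*ᶻ φ (π₀ P U s)) (𝟙-× (splits? x U s t) (isSurface? P U s)) ⟨
      𝟙 (splits? x U s t ×-dec isSurface? P U s) *ᶻ φ (π₀ P U s)
        ≡⟨ 𝟙-guard (splits? x U s t ×-dec isSurface? P U s) (λ (sp , σ) → cong φ (π₀-split x∈U σ sp)) ⟩
      𝟙 (splits? x U s t ×-dec isSurface? P U s) *ᶻ wt″ t
        ≡⟨ cong (_*ᶻ wt″ t) (𝟙-⇔ (splits? x U s t ×-dec isSurface? P U s) ((s ≗? joinᵗ t) ×-dec parts? x U t)
             (λ (sp , σ) → splits⇒join x∈U σ sp , splits⇒parts x∈U σ sp)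
             (λ (eq , p) → splits-cong (sym ∘ eq) (parts⇒splits p) , surface-cong (sym ∘ eq) (parts⇒surface p))) ⟩
      𝟙 ((s ≗? joinᵗ t) ×-dec parts? x U t) *ᶻ wt″ t
        ≡⟨ cong (_*ᶻ wt″ t) (𝟙-× (s ≗? joinᵗ t) (parts? x U t)) ⟩
      𝟙 (s ≗? joinᵗ t) *ᶻ 𝟙 (parts? x U t) *ᶻ wt″ t
        ≡⟨ ℤ.*-assoc (𝟙 (s ≗? joinᵗ t)) (𝟙 (parts? x U t)) (wt″ t) ⟩
      𝟙 (s ≗? joinᵗ t) *ᶻ (𝟙 (parts? x U t) *ᶻ wt″ t) ∎

    factor : ∀ S → ∑ (cartesianProduct gluings gluings) (λ r → 𝟙 (parts? x U (S , r)) *ᶻ wt″ (S , r)) ≡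
                   𝟙 (x ∈ S ⊆? U) *ᶻ (spanned x S *ᶻ weighted (U ─ S) (φ ∘ suc))
    factor S = begin
      ∑ (cartesianProduct gluings gluings) (λ r → 𝟙 (parts? x U (S , r)) *ᶻ wt″ (S , r))
        ≡⟨ ∑-cartesianProduct gluings gluings (λ r → 𝟙 (parts? x U (S , r)) *ᶻ wt″ (S , r)) ⟩
      ∑ gluings (λ s′ → ∑ gluings (λ s″ → 𝟙 (parts? x U (S , s′ , s″)) *ᶻ wt″ (S , s′ , s″)))
        ≡⟨ ∑-cong gluings (λ s′ → trans (∑-cong gluings (pull s′)) (∑-*ˡ (a *ᶻ b s′) gluings c)) ⟩
      ∑ gluings (λ s′ → a *ᶻ b s′ *ᶻ W)
        ≡⟨ ∑-*ʳ W gluings (λ s′ → a *ᶻ b s′) ⟩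
      ∑ gluings (λ s′ → a *ᶻ b s′) *ᶻ W
        ≡⟨ cong (_*ᶻ W) (∑-*ˡ a gluings b) ⟩
      a *ᶻ spanned x S *ᶻ W
        ≡⟨ ℤ.*-assoc a (spanned x S) W ⟩
      a *ᶻ (spanned x S *ᶻ W) ∎
      where
      a W : ℤ
      a = 𝟙 (x ∈ S ⊆? U)
      W = weighted (U ─ S) (φ ∘ suc)
      b c : Gluing → ℤ
      b s′ = 𝟙 (isSurface? P S s′ ×-dec spanned? x S s′)
      c s″ = 𝟙 (isSurface? P (U ─ S) s″) *ᶻ φ (suc (π₀ P (U ─ S) s″))
      pull : ∀ s′ s″ → 𝟙 (parts? x U (S , s′ , s″)) *ᶻ wt″ (S , s′ , s″) ≡ a *ᶻ b s′ *ᶻ c s″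
      pull s′ s″ = begin
        𝟙 (parts? x U (S , s′ , s″)) *ᶻ w
          ≡⟨ cong (_*ᶻ w) (trans
               (𝟙-× (x ∈ S ⊆? U) ((isSurface? P S s′ ×-dec spanned? x S s′) ×-dec isSurface? P (U ─ S) s″))
               (cong (a *ᶻ_) (𝟙-× (isSurface? P S s′ ×-dec spanned? x S s′) (isSurface? P (U ─ S) s″)))) ⟩
        a *ᶻ (b s′ *ᶻ 𝟙 (isSurface? P (U ─ S) s″)) *ᶻ w
          ≡⟨ reassoc a (b s′) (𝟙 (isSurface? P (U ─ S) s″)) w ⟩
        a *ᶻ b s′ *ᶻ c s″ ∎
        where
        w : ℤ
        w = φ (suc (π₀ P (U ─ S) s″))
        reassoc : ∀ p q r t → p *ᶻ (q *ᶻ r) *ᶻ t ≡ p *ᶻ q *ᶻ (r *ᶻ t)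
        reassoc = solve-∀

  weighted-empty : ∀ {U} → ∣ U ∣ ≡ 0 → ∀ φ → weighted U φ ≡ φ 0
  weighted-empty {U} ∣U∣≡0 φ = begin
    ∑ gluings (λ s → 𝟙 (isSurface? P U s) *ᶻ φ (π₀ P U s))
      ≡⟨ ∑-cong gluings (λ s → 𝟙-guard-⇔ (isSurface? P U s) (s ≗? id)
           (λ σ z → IsSurface.unused σ z empty)
           (λ eq → isSurface (λ z → trans (eq (s z)) (eq z)) (λ z z∈U → ⊥-elim (empty z∈U)) (λ z _ → eq z))
           (λ _ → cong (φ ∘ length ∘ deduplicate (connected? {k} P s))
             (List.filter-none (Subset._∈? U) {allFin k} (All.tabulate (λ {v} _ → empty))))) ⟩
    ∑ gluings (λ s → 𝟙 (s ≗? id) *ᶻ φ 0)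
      ≡⟨ ∑-dirac gluings (_≗? id) (∑-endos-once {k * P} id) (λ _ _ → refl) ⟩
    φ 0 ∎
    where
    empty : ∀ {v} → v ∉ U
    empty v∈U = ℕ.n≮0 (subst (∣ U - _ ∣ <_) ∣U∣≡0 (Subset.x∈p⇒∣p-x∣<∣p∣ v∈U))

-- Cardinality of subsets

∑-allFin-suc : ∀ n (f : Fin (suc n) → ℤ) → ∑ (allFin (suc n)) f ≡ f zero +ᶻ ∑ (allFin n) (f ∘ suc)
∑-allFin-suc n f = cong (f zero +ᶻ_) (trans (cong (λ xs → ∑ xs f) (sym (List.map-tabulate id suc)))
                                            (∑-map suc (allFin n) f))

∑-∈ : ∀ {n} (T : Subset n) → ∑ (allFin n) (λ x → 𝟙 (x Subset.∈? T)) ≡ + ∣ T ∣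
∑-∈ Vec.[] = refl
∑-∈ {suc n} (inside Vec.∷ T) = trans (∑-allFin-suc n (λ x → 𝟙 (x Subset.∈? (inside Vec.∷ T))))
  (cong (1ℤ +ᶻ_) (trans
    (∑-cong (allFin n) (λ x → 𝟙-⇔ (suc x Subset.∈? (inside Vec.∷ T)) (x Subset.∈? T) Subset.drop-there Vec.there)) (∑-∈ T)))
∑-∈ {suc n} (outside Vec.∷ T) = trans (∑-allFin-suc n (λ x → 𝟙 (x Subset.∈? (outside Vec.∷ T))))
  (trans (cong (0ℤ +ᶻ_) (trans
    (∑-cong (allFin n) (λ x → 𝟙-⇔ (suc x Subset.∈? (outside Vec.∷ T)) (x Subset.∈? T) Subset.drop-there Vec.there)) (∑-∈ T)))
         (ℤ.+-identityˡ _))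

∣p∣≡1+∣p-x∣ : ∀ {n} {p : Subset n} {x} → x ∈ p → ∣ p ∣ ≡ suc ∣ p - x ∣
∣p∣≡1+∣p-x∣ {p = inside Vec.∷ p}  {zero}  Vec.here        = cong (suc ∘ ∣_∣) (sym (Subset.p─⊥≡p p))
∣p∣≡1+∣p-x∣ {p = inside Vec.∷ p}  {suc x} (Vec.there x∈p) = cong suc (∣p∣≡1+∣p-x∣ x∈p)
∣p∣≡1+∣p-x∣ {p = outside Vec.∷ p} {suc x} (Vec.there x∈p) = ∣p∣≡1+∣p-x∣ x∈p

∣p∣≡1+n⇒nonempty : ∀ {k n} (p : Subset k) → ∣ p ∣ ≡ suc n → ∃[ x ] x ∈ p
∣p∣≡1+n⇒nonempty (inside Vec.∷ p)  eq = zero , Vec.here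
∣p∣≡1+n⇒nonempty (outside Vec.∷ p) eq = let x , x∈p = ∣p∣≡1+n⇒nonempty p eq in suc x , Vec.there x∈p

∣p∣≡0⇒∉ : ∀ {k} {p : Subset k} → ∣ p ∣ ≡ 0 → ∀ {x} → x ∉ p
∣p∣≡0⇒∉ eq x∈p = ℕ.0≢1+n (trans (sym eq) (∣p∣≡1+∣p-x∣ x∈p))

x∈p-y⇒x≢y : ∀ {n} {p : Subset n} {x y} → x ∈ p - y → x ≢ y
x∈p-y⇒x≢y {p = p} {y = y} m refl = x∈p─q⇒x∉q {p = p} m (Subset.x∈⁅x⁆ y)

-- Matchings on a subset of the sides

record IsMatching {M : ℕ} (T : Subset M) (s : Fin M → Fin M) : Set where
  constructor isMatching
  field
    involutive : ∀ x → s (s x) ≡ x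
    matched    : ∀ {x} → x ∈ T → s x ≢ x
    unmatched  : ∀ {x} → x ∉ T → s x ≡ x

module Matching {M : ℕ} where

  open IsMatching

  matching-closed : ∀ {T : Subset M} {s x} → IsMatching T s → x ∈ T → s x ∈ T
  matching-closed {T} {s} {x} μ x∈T with s x Subset.∈? T
  ... | yes m = m
  ... | no ¬m = ⊥-elim (matched μ x∈T (trans (sym (unmatched μ ¬m)) (involutive μ x)))

  pair : (x y : Fin M) → (Fin M → Fin M) → Fin M → Fin M
  pair x y r z = if does (z Fin.≟ x) then y else (if does (z Fin.≟ y) then x else r z)

  pair-x : ∀ x y r → pair x y r x ≡ y
  pair-x x y r = if-yes (x Fin.≟ x) refl

  pair-y : ∀ {x y} r → y ≢ x → pair x y r y ≡ x
  pair-y {x} {y} r y≢x = trans (if-no (y Fin.≟ x) y≢x) (if-yes (y Fin.≟ y) refl)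

  pair-z : ∀ {x y z} r → z ≢ x → z ≢ y → pair x y r z ≡ r z
  pair-z {x} {y} {z} r z≢x z≢y = trans (if-no (z Fin.≟ x) z≢x) (if-no (z Fin.≟ y) z≢y)

  fixOutside : Subset M → (Fin M → Fin M) → Fin M → Fin M
  fixOutside T s z = if does (z Subset.∈? T) then s z else z

  -- The partner of x and the matching left on the other points; as with `Splits`, a relation stands
  -- for a bijection, here with inverse `pair`.
  Unpairs : Subset M → Fin M → (Fin M → Fin M) → Fin M × (Fin M → Fin M) → Set
  Unpairs T x s (y , r) = y ≡ s x × (∀ z → r z ≡ fixOutside (T - x - y) s z)

  Parts : Subset M → Fin M → Fin M × (Fin M → Fin M) → Set
  Parts T x (y , r) = y ∈ T - x × IsMatching (T - x - y) r

  remove₂⁺ : ∀ {T : Subset M} {x y z} → z ∈ T → z ≢ x → z ≢ y → z ∈ T - x - y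
  remove₂⁺ z∈T z≢x z≢y = Subset.x∈p∧x≢y⇒x∈p-y (Subset.x∈p∧x≢y⇒x∈p-y z∈T z≢x) z≢y

  remove₂-≢ₓ : ∀ {T : Subset M} {x y z} → z ∈ T - x - y → z ≢ x
  remove₂-≢ₓ {T} z∈ = x∈p-y⇒x≢y {p = T} (x∈p─q⇒x∈p z∈)

  remove₂-≢ᵧ : ∀ {T : Subset M} {x y z} → z ∈ T - x - y → z ≢ y
  remove₂-≢ᵧ {T} {x} = x∈p-y⇒x≢y {p = T - x}

  remove₂⁻ : ∀ {T : Subset M} {x y z} → z ∈ T - x - y → z ∈ T
  remove₂⁻ z∈ = x∈p─q⇒x∈p (x∈p─q⇒x∈p z∈)

  unpairs⇒parts : ∀ {T : Subset M} {x s t} → x ∈ T → IsMatching T s → Unpairs T x s t → Parts T x t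
  unpairs⇒parts {T} {x} {s} {y , r} x∈T μ (refl , eq) =
    Subset.x∈p∧x≢y⇒x∈p-y (matching-closed μ x∈T) (matched μ x∈T) ,
    isMatching inv (λ m e → matched μ (remove₂⁻ m) (trans (sym (r≡s m)) e)) (λ ¬m → trans (eq _) (if-no (_ Subset.∈? _) ¬m))
    where
    r≡s : ∀ {z} → z ∈ T - x - s x → r z ≡ s z
    r≡s {z} m = trans (eq z) (if-yes (z Subset.∈? (T - x - s x)) m)
    closed : ∀ {z} → z ∈ T - x - s x → s z ∈ T - x - s x
    closed {z} m = remove₂⁺ (matching-closed μ (remove₂⁻ m))
      (λ e → remove₂-≢ᵧ {T} m (trans (sym (involutive μ z)) (cong s e)))
      (λ e → remove₂-≢ₓ m (trans (sym (involutive μ z)) (trans (cong s e) (involutive μ x))))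
    inv : ∀ z → r (r z) ≡ z
    inv z with z Subset.∈? (T - x - s x)
    ... | yes m = trans (cong r (r≡s m)) (trans (r≡s (closed m)) (involutive μ z))
    ... | no ¬m = trans (cong r rz≡z) rz≡z
      where
      rz≡z : r z ≡ z
      rz≡z = trans (eq z) (if-no (z Subset.∈? (T - x - s x)) ¬m)

  unpairs⇒pair : ∀ {T : Subset M} {x s t} → x ∈ T → IsMatching T s → Unpairs T x s t →
                 ∀ z → s z ≡ pair x (proj₁ t) (proj₂ t) z
  unpairs⇒pair {T} {x} {s} {_ , r} x∈T μ (refl , eq) z with z Fin.≟ x | z Fin.≟ s x | z Subset.∈? T
  ... | yes refl | _        | _       = refl
  ... | no  _    | yes refl | _       = involutive μ x
  ... | no  z≢x  | no z≢y   | yes z∈T = sym (trans (eq z) (if-yes (z Subset.∈? (T - x - s x)) (remove₂⁺ z∈T z≢x z≢y)))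
  ... | no  z≢x  | no z≢y   | no  z∉T =
    trans (unmatched μ z∉T) (sym (trans (eq z) (if-no (z Subset.∈? (T - x - s x)) (z∉T ∘ remove₂⁻))))

  parts⇒matching : ∀ {T : Subset M} {x t} → x ∈ T → Parts T x t → IsMatching T (pair x (proj₁ t) (proj₂ t))
  parts⇒matching {T} {x} {y , r} x∈T (y∈ , ρ) = isMatching inv mat unm
    where
    y≢x : y ≢ x
    y≢x = x∈p-y⇒x≢y {p = T} y∈
    rx≡x : r x ≡ x
    rx≡x = unmatched ρ (λ m → remove₂-≢ₓ m refl)
    ry≡y : r y ≡ y
    ry≡y = unmatched ρ (λ m → remove₂-≢ᵧ {T} m refl)
    avoid : ∀ {z v} → r v ≡ v → z ≢ v → r z ≢ v
    avoid {z} rv≡v z≢v rz≡v = z≢v (trans (sym (involutive ρ z)) (trans (cong r rz≡v) rv≡v))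
    inv : ∀ z → pair x y r (pair x y r z) ≡ z
    inv z with z Fin.≟ x | z Fin.≟ y
    ... | yes refl | _        = pair-y r y≢x
    ... | no  _    | yes refl = pair-x x y r
    ... | no  z≢x  | no z≢y   = trans (pair-z r (avoid rx≡x z≢x) (avoid ry≡y z≢y)) (involutive ρ z)
    mat : ∀ {z} → z ∈ T → pair x y r z ≢ z
    mat {z} z∈T with z Fin.≟ x | z Fin.≟ y
    ... | yes refl | _        = y≢x
    ... | no  _    | yes refl = y≢x ∘ sym
    ... | no  z≢x  | no z≢y   = matched ρ (remove₂⁺ z∈T z≢x z≢y)
    unm : ∀ {z} → z ∉ T → pair x y r z ≡ z
    unm {z} z∉T = trans (pair-z r (λ { refl → z∉T x∈T }) (λ { refl → z∉T (x∈p─q⇒x∈p y∈) }))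
                        (unmatched ρ (z∉T ∘ remove₂⁻))

  parts⇒unpairs : ∀ {T : Subset M} {x t} → Parts T x t → Unpairs T x (pair x (proj₁ t) (proj₂ t)) t
  parts⇒unpairs {T} {x} {y , r} (y∈ , ρ) = sym (pair-x x y r) , fix
    where
    fix : ∀ z → r z ≡ fixOutside (T - x - y) (pair x y r) z
    fix z with z Subset.∈? (T - x - y)
    ... | yes m = sym (pair-z r (remove₂-≢ₓ m) (remove₂-≢ᵧ {T} m))
    ... | no ¬m = unmatched ρ ¬m

  matching-cong : ∀ {T : Subset M} {s t} → (∀ z → s z ≡ t z) → IsMatching T s → IsMatching T t
  matching-cong {s = s} {t} eq μ = isMatching
    (λ z → trans (sym (trans (eq (s z)) (cong t (eq z)))) (involutive μ z))
    (λ z∈T e → matched μ z∈T (trans (eq _) e))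
    (λ z∉T → trans (sym (eq _)) (unmatched μ z∉T))

  unpairs-cong : ∀ {T : Subset M} {x s t r} → (∀ z → s z ≡ t z) → Unpairs T x s r → Unpairs T x t r
  unpairs-cong {T} {x} {s} {t} {y , r} eq (e , f) =
    trans e (eq x) , λ z → trans (f z) (fix z)
    where
    fix : ∀ z → fixOutside (T - x - y) s z ≡ fixOutside (T - x - y) t z
    fix z with does (z Subset.∈? (T - x - y))
    ... | true  = eq z
    ... | false = refl

  isMatching? : ∀ (T : Subset M) s → Dec (IsMatching T s)
  isMatching? T s = map′ (λ (i , m , u) → isMatching i (m _) (u _))
                         (λ μ → involutive μ , (λ _ → matched μ) , λ _ → unmatched μ)
    (Fin.all? (λ x → s (s x) Fin.≟ x)
      ×-dec (Fin.all? (λ x → (x Subset.∈? T) →-dec ¬? (s x Fin.≟ x))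
      ×-dec Fin.all? (λ x → ¬? (x Subset.∈? T) →-dec (s x Fin.≟ x))))
    where open import Relation.Nullary.Decidable using (map′)

  unpairs? : ∀ T x s t → Dec (Unpairs T x s t)
  unpairs? T x s (y , r) = (y Fin.≟ s x) ×-dec (r ≗? fixOutside (T - x - y) s)

  parts? : ∀ T x t → Dec (Parts T x t)
  parts? T x (y , r) = (y Subset.∈? (T - x)) ×-dec isMatching? (T - x - y) r

  #matchings : Subset M → ℤ
  #matchings T = ∑ (endos M) (λ s → 𝟙 (isMatching? T s))

  #matchings-rec : ∀ {T x} → x ∈ T →
    #matchings T ≡ ∑ (allFin M) (λ y → 𝟙 (y Subset.∈? (T - x)) *ᶻ #matchings (T - x - y))
  #matchings-rec {T} {x} x∈T = begin
    ∑ (endos M) (λ s → 𝟙 (isMatching? T s))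
      ≡⟨ ∑-cong (endos M) (λ s → sym (trans (∑-*ʳ (𝟙 (isMatching? T s)) pairs _)
           (trans (cong (_*ᶻ 𝟙 (isMatching? T s)) (once s)) (ℤ.*-identityˡ _)))) ⟩
    ∑ (endos M) (λ s → ∑ pairs (λ t → 𝟙 (unpairs? T x s t) *ᶻ 𝟙 (isMatching? T s)))
      ≡⟨ ∑-swap (endos M) pairs (λ s t → 𝟙 (unpairs? T x s t) *ᶻ 𝟙 (isMatching? T s)) ⟩
    ∑ pairs (λ t → ∑ (endos M) (λ s → 𝟙 (unpairs? T x s t) *ᶻ 𝟙 (isMatching? T s)))
      ≡⟨ ∑-cong pairs (λ t → trans (∑-cong (endos M) (λ s → bijection s t))
           (∑-dirac (endos M) (_≗? unpair t) (∑-endos-once (unpair t)) (λ _ _ → refl))) ⟩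
    ∑ pairs (λ t → 𝟙 (parts? T x t))
      ≡⟨ ∑-cartesianProduct (allFin M) (endos M) (λ t → 𝟙 (parts? T x t)) ⟩
    ∑ (allFin M) (λ y → ∑ (endos M) (λ r → 𝟙 (parts? T x (y , r))))
      ≡⟨ ∑-cong (allFin M) (λ y → trans
           (∑-cong (endos M) (λ r → 𝟙-× (y Subset.∈? (T - x)) (isMatching? (T - x - y) r)))
           (∑-*ˡ (𝟙 (y Subset.∈? (T - x))) (endos M) (λ r → 𝟙 (isMatching? (T - x - y) r)))) ⟩
    ∑ (allFin M) (λ y → 𝟙 (y Subset.∈? (T - x)) *ᶻ #matchings (T - x - y)) ∎
    where
    pairs : List (Fin M × (Fin M → Fin M))
    pairs = cartesianProduct (allFin M) (endos M)
    unpair : Fin M × (Fin M → Fin M) → Fin M → Fin M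
    unpair (y , r) = pair x y r
    once : ∀ s → ∑ pairs (λ t → 𝟙 (unpairs? T x s t)) ≡ 1ℤ
    once s = ∑-cartesianProduct-once (allFin M) (endos M) (Fin._≟ s x) (λ y r → r ≗? fixOutside (T - x - y) s)
      (∑-allFin-once (Fin._≟ s x) (s x) refl (λ _ → id)) (λ y → ∑-endos-once (fixOutside (T - x - y) s))
    bijection : ∀ s t → 𝟙 (unpairs? T x s t) *ᶻ 𝟙 (isMatching? T s) ≡ 𝟙 (s ≗? unpair t) *ᶻ 𝟙 (parts? T x t)
    bijection s t = begin
      𝟙 (unpairs? T x s t) *ᶻ 𝟙 (isMatching? T s)
        ≡⟨ 𝟙-× (unpairs? T x s t) (isMatching? T s) ⟨
      𝟙 (unpairs? T x s t ×-dec isMatching? T s)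
        ≡⟨ 𝟙-⇔ (unpairs? T x s t ×-dec isMatching? T s) ((s ≗? unpair t) ×-dec parts? T x t)
             (λ (u , μ) → unpairs⇒pair x∈T μ u , unpairs⇒parts x∈T μ u)
             (λ (eq , p) → unpairs-cong (sym ∘ eq) (parts⇒unpairs p) , matching-cong (sym ∘ eq) (parts⇒matching x∈T p)) ⟩
      𝟙 ((s ≗? unpair t) ×-dec parts? T x t)
        ≡⟨ 𝟙-× (s ≗? unpair t) (parts? T x t) ⟩
      𝟙 (s ≗? unpair t) *ᶻ 𝟙 (parts? T x t) ∎

  #matchings-≡ : ∀ n (T : Subset M) → ∣ T ∣ ≡ n → #matchings T ≡ + matchings n
  #matchings-≡ zero T eq = trans
    (∑-cong (endos M) (λ s → 𝟙-⇔ (isMatching? T s) (s ≗? id)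
      (λ μ z → unmatched μ (∣p∣≡0⇒∉ eq))
      (λ e → isMatching (λ z → trans (e (s z)) (e z)) (λ m → ⊥-elim (∣p∣≡0⇒∉ eq m)) (λ _ → e _))))
    (∑-endos-once {M} id)
  #matchings-≡ (suc n) T eq = trans (#matchings-rec x∈T) (rest n refl)
    where
    x = proj₁ (∣p∣≡1+n⇒nonempty T eq)
    x∈T = proj₂ (∣p∣≡1+n⇒nonempty T eq)
    ∣T-x∣ : ∣ T - x ∣ ≡ n
    ∣T-x∣ = ℕ.suc-injective (trans (sym (∣p∣≡1+∣p-x∣ x∈T)) eq)
    -- m is a copy of n, split without disturbing x, whose definition mentions n. If n = 0 then x
    -- has no possible partner; otherwise it has n of them, and n - 1 points remain.
    rest : ∀ m → m ≡ n → ∑ (allFin M) (λ y → 𝟙 (y Subset.∈? (T - x)) *ᶻ #matchings (T - x - y)) ≡ + matchings (suc m)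
    rest zero refl = trans
      (∑-cong (allFin M) (λ y → 𝟙-no-* (y Subset.∈? (T - x)) (#matchings (T - x - y)) (∣p∣≡0⇒∉ ∣T-x∣)))
      (∑-zero (allFin M))
    rest (suc m) refl = begin
      ∑ (allFin M) (λ y → 𝟙 (y Subset.∈? (T - x)) *ᶻ #matchings (T - x - y))
        ≡⟨ ∑-cong (allFin M) (λ y → 𝟙-guard (y Subset.∈? (T - x)) (λ y∈ →
             #matchings-≡ m (T - x - y) (ℕ.suc-injective (trans (sym (∣p∣≡1+∣p-x∣ y∈)) ∣T-x∣)))) ⟩
      ∑ (allFin M) (λ y → 𝟙 (y Subset.∈? (T - x)) *ᶻ + matchings m)
        ≡⟨ ∑-*ʳ (+ matchings m) (allFin M) (λ y → 𝟙 (y Subset.∈? (T - x))) ⟩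
      ∑ (allFin M) (λ y → 𝟙 (y Subset.∈? (T - x))) *ᶻ + matchings m
        ≡⟨ cong (_*ᶻ + matchings m) (trans (∑-∈ (T - x)) (cong +_ ∣T-x∣)) ⟩
      + suc m *ᶻ + matchings m
        ≡⟨ ℤ.pos-* (suc m) (matchings m) ⟨
      + matchings (suc (suc m)) ∎

-- Surfaces as matchings of polygon sides

∑-const : ∀ {A : Set} (xs : List A) c → ∑ xs (λ _ → c) ≡ + length xs *ᶻ c
∑-const []       c = refl
∑-const (x ∷ xs) c = begin
  c +ᶻ ∑ xs (λ _ → c)          ≡⟨ cong (c +ᶻ_) (∑-const xs c) ⟩
  c +ᶻ + length xs *ᶻ c        ≡⟨ cong (_+ᶻ + length xs *ᶻ c) (ℤ.*-identityˡ c) ⟨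
  1ℤ *ᶻ c +ᶻ + length xs *ᶻ c  ≡⟨ ℤ.*-distribʳ-+ c 1ℤ (+ length xs) ⟨
  + suc (length xs) *ᶻ c       ∎

-- Through `combine` and `remQuot` a side is a polygon with one of P positions, so each polygon is
-- met P times.
∑-quotient : ∀ k P (g : Fin k → ℤ) →
             ∑ (allFin (k * P)) (λ z → g (quotient {k} P z)) ≡ + P *ᶻ ∑ (allFin k) g
∑-quotient k P g = begin
  ∑ (allFin (k * P)) (λ z → g (quot z))
    ≡⟨ ∑-cong (allFin (k * P)) (λ z → sym (trans (∑-*ʳ (g (quot z)) pairs _)
         (trans (cong (_*ᶻ g (quot z)) (once z)) (ℤ.*-identityˡ _)))) ⟩
  ∑ (allFin (k * P)) (λ z → ∑ pairs (λ t → 𝟙 (at? t z) *ᶻ g (quot z)))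
    ≡⟨ ∑-swap (allFin (k * P)) pairs (λ z t → 𝟙 (at? t z) *ᶻ g (quot z)) ⟩
  ∑ pairs (λ t → ∑ (allFin (k * P)) (λ z → 𝟙 (at? t z) *ᶻ g (quot z)))
    ≡⟨ ∑-cong pairs (λ t → ∑-dirac (allFin (k * P)) (at? t) (once′ t) (λ _ (e , _) → cong g (sym e))) ⟩
  ∑ pairs (λ t → g (proj₁ t))
    ≡⟨ ∑-cartesianProduct (allFin k) (allFin P) (λ t → g (proj₁ t)) ⟩
  ∑ (allFin k) (λ u → ∑ (allFin P) (λ _ → g u))
    ≡⟨ ∑-cong (allFin k) (λ u → trans (∑-const (allFin P) (g u))
         (cong (λ n → + n *ᶻ g u) (List.length-tabulate {n = P} id))) ⟩
  ∑ (allFin k) (λ u → + P *ᶻ g u)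
    ≡⟨ ∑-*ˡ (+ P) (allFin k) g ⟩
  + P *ᶻ ∑ (allFin k) g ∎
  where
  pairs : List (Fin k × Fin P)
  pairs = cartesianProduct (allFin k) (allFin P)
  quot : Fin (k * P) → Fin k
  quot = quotient {k} P
  rem : Fin (k * P) → Fin P
  rem = proj₂ ∘ remQuot {k} P
  at? : ∀ t z → Dec (proj₁ t ≡ quot z × proj₂ t ≡ rem z)
  at? (u , j) z = (u Fin.≟ quot z) ×-dec (j Fin.≟ rem z)
  once : ∀ z → ∑ pairs (λ t → 𝟙 (at? t z)) ≡ 1ℤ
  once z = ∑-cartesianProduct-once (allFin k) (allFin P) (Fin._≟ quot z) (λ _ j → j Fin.≟ rem z)
    (∑-allFin-once (Fin._≟ quot z) (quot z) refl (λ _ → id))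
    (λ _ → ∑-allFin-once (Fin._≟ rem z) (rem z) refl (λ _ → id))
  once′ : ∀ t → ∑ (allFin (k * P)) (λ z → 𝟙 (at? t z)) ≡ 1ℤ
  once′ (u , j) = ∑-allFin-once (at? (u , j)) (combine u j)
    (sym (cong proj₁ (Fin.remQuot-combine {k} u j)) , sym (cong proj₂ (Fin.remQuot-combine {k} u j)))
    (λ { z (refl , refl) → sym (Fin.combine-remQuot {k} P z) })

module _ {k : ℕ} (P : ℕ) where

  open Gluing {k} P
  open Counting {k} P
  open Matching {k * P}

  sides : Subset k → Subset (k * P)
  sides U = Vec.tabulate (λ z → does (pol∈? U z))

  ∈sides⇒ : ∀ {U z} → z ∈ sides U → pol z ∈ U
  ∈sides⇒ {U} {z} z∈ = does⇒ (pol∈? U z) (trans (sym (Vec.lookup∘tabulate (λ z → does (pol∈? U z)) z)) (Vec.[]=⇒lookup z∈))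

  ⇒∈sides : ∀ {U z} → pol z ∈ U → z ∈ sides U
  ⇒∈sides {U} {z} m = Vec.lookup⇒[]= z (sides U)
    (trans (Vec.lookup∘tabulate (λ z → does (pol∈? U z)) z) (dec-true (pol∈? U z) m))

  ∣sides∣ : ∀ U → ∣ sides U ∣ ≡ P * ∣ U ∣
  ∣sides∣ U = ℤ.+-injective (begin
    + ∣ sides U ∣
      ≡⟨ ∑-∈ (sides U) ⟨
    ∑ (allFin (k * P)) (λ z → 𝟙 (z Subset.∈? sides U))
      ≡⟨ ∑-cong (allFin (k * P)) (λ z → 𝟙-⇔ (z Subset.∈? sides U) (pol∈? U z) ∈sides⇒ ⇒∈sides) ⟩
    ∑ (allFin (k * P)) (λ z → 𝟙 (pol z Subset.∈? U))
      ≡⟨ ∑-quotient k P (λ u → 𝟙 (u Subset.∈? U)) ⟩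
    + P *ᶻ ∑ (allFin k) (λ u → 𝟙 (u Subset.∈? U))
      ≡⟨ cong (+ P *ᶻ_) (∑-∈ U) ⟩
    + P *ᶻ + ∣ U ∣
      ≡⟨ ℤ.pos-* P ∣ U ∣ ⟨
    + (P * ∣ U ∣) ∎)

  -- The conditions on a surface are those on a matching of `sides U`, and there are P ∣ U ∣ such
  -- sides.
  weighted-one : ∀ U → weighted U (λ _ → 1ℤ) ≡ + matchings (P * ∣ U ∣)
  weighted-one U = begin
    weighted U (λ _ → 1ℤ)
      ≡⟨ ∑-cong gluings (λ s → trans (ℤ.*-identityʳ _) (𝟙-⇔ (isSurface? P U s) (isMatching? (sides U) s)
           (λ σ → isMatching (IsSurface.involutive σ) (IsSurface.glued σ _ ∘ ∈sides⇒) (λ z∉ → IsSurface.unused σ _ (z∉ ∘ ⇒∈sides)))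
           (λ μ → isSurface (IsMatching.involutive μ) (λ z → IsMatching.matched μ ∘ ⇒∈sides) (λ z z∉ → IsMatching.unmatched μ (z∉ ∘ ∈sides⇒))))) ⟩
    #matchings (sides U)
      ≡⟨ #matchings-≡ (P * ∣ U ∣) (sides U) (∣sides∣ U) ⟩
    + matchings (P * ∣ U ∣) ∎

-- Dependence of the counts on the size alone

p⊆q∧∣q∣≤∣p∣⇒p≡q : ∀ {n} {p q : Subset n} → p ⊆ q → ∣ q ∣ ≤ ∣ p ∣ → p ≡ q
p⊆q∧∣q∣≤∣p∣⇒p≡q {p = p} {q} p⊆q le = Subset.⊆-antisym p⊆q q⊆p
  where
  q⊆p : q ⊆ p
  q⊆p {x} x∈q with x Subset.∈? p
  ... | yes x∈p = x∈p
  ... | no  x∉p = ⊥-elim (ℕ.<⇒≱ (Subset.p⊂q⇒∣p∣<∣q∣ (p⊆q , x , x∈q , x∉p)) le)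

module Sizes (P : ℕ) where

  spanned : ∀ {k} → Fin k → Subset k → ℤ
  spanned {k} = Counting.spanned {k} P

  weighted : ∀ {k} → Subset k → (ℕ → ℤ) → ℤ
  weighted {k} = Counting.weighted {k} P

  surfaceCount : ℕ → ℕ
  surfaceCount n = matchings (P * n)

  w : ℕ → ℤ
  w n = + surfaceCount n

  -- Defined on one model of each size, the full set rooted at polygon 0; the empty surface does not
  -- count as connected.
  connectedCount : ℕ → ℤ
  connectedCount zero    = 0ℤ
  connectedCount (suc n) = spanned {suc n} zero ⊤

  weight : (ℕ → ℤ) → ℕ → ℤ
  weight φ n = weighted {n} ⊤ φ

  w-zero : w 0 ≡ 1ℤ
  w-zero = cong (λ m → + matchings m) (ℕ.*-zeroʳ P)

  -- The defect depends on n alone and vanishes by definition of connectedCount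
  -- on the full set of n + 1 polygons, hence spanned depends only on the size.
  defect : ℕ → ℤ
  defect n = w (suc n) -ᶻ binomialSum n (λ i j → connectedCount (suc i) *ᶻ w j)

  -- From the recursion with φ = 1 subtract the same sum with `connectedCount` for `spanned`. By
  -- hypothesis the proper subsets S cancel, and S = U remains with the weight w 0 = 1.
  spanned-defect : ∀ {k n} (U : Subset k) {x} → x ∈ U → ∣ U ∣ ≡ suc n →
    (∀ S → x ∈ S → ∣ S ∣ ≤ n → spanned x S ≡ connectedCount ∣ S ∣) →
    spanned x U -ᶻ connectedCount ∣ U ∣ ≡ defect n
  spanned-defect {k} {n} U {x} x∈U eq IH = begin
    excess U
      ≡⟨ ∑-dirac (subsets k) (_≟ˢ U) (∑-subsets-once U) (λ { _ refl → refl }) ⟨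
    ∑ (subsets k) (λ S → 𝟙 (S ≟ˢ U) *ᶻ excess S)
      ≡⟨ ∑-cong (subsets k) only-U ⟩
    ∑ (subsets k) (λ S → 𝟙 (x ∈ S ⊆? U) *ᶻ (spanned x S *ᶻ w ∣ U ─ S ∣) +ᶻ
                         -1ℤ *ᶻ (𝟙 (x ∈ S ⊆? U) *ᶻ (connectedCount ∣ S ∣ *ᶻ w ∣ U ─ S ∣)))
      ≡⟨ ∑-+ (subsets k) _ _ ⟩
    ∑ (subsets k) (λ S → 𝟙 (x ∈ S ⊆? U) *ᶻ (spanned x S *ᶻ w ∣ U ─ S ∣)) +ᶻ
    ∑ (subsets k) (λ S → -1ℤ *ᶻ (𝟙 (x ∈ S ⊆? U) *ᶻ (connectedCount ∣ S ∣ *ᶻ w ∣ U ─ S ∣)))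
      ≡⟨ cong₂ _+ᶻ_ all-w (trans (∑-*ˡ -1ℤ (subsets k) _)
           (cong (-1ℤ *ᶻ_) (∑-∈⊆ U (λ i j → connectedCount i *ᶻ w j) x∈U eq))) ⟩
    w (suc n) +ᶻ -1ℤ *ᶻ binomialSum n (λ i j → connectedCount (suc i) *ᶻ w j)
      ≡⟨ cong (w (suc n) +ᶻ_) (ℤ.-1*i≡-i (binomialSum n (λ i j → connectedCount (suc i) *ᶻ w j))) ⟩
    defect n ∎
    where
    excess : Subset k → ℤ
    excess S = spanned x S -ᶻ connectedCount ∣ S ∣
    all-w : ∑ (subsets k) (λ S → 𝟙 (x ∈ S ⊆? U) *ᶻ (spanned x S *ᶻ w ∣ U ─ S ∣)) ≡ w (suc n)
    all-w = begin
      ∑ (subsets k) (λ S → 𝟙 (x ∈ S ⊆? U) *ᶻ (spanned x S *ᶻ w ∣ U ─ S ∣))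
        ≡⟨ ∑-cong (subsets k) (λ S → cong (λ v → 𝟙 (x ∈ S ⊆? U) *ᶻ (spanned x S *ᶻ v)) (weighted-one P (U ─ S))) ⟨
      ∑ (subsets k) (λ S → 𝟙 (x ∈ S ⊆? U) *ᶻ (spanned x S *ᶻ weighted (U ─ S) (λ _ → 1ℤ)))
        ≡⟨ Counting.weighted-rec P x∈U (λ _ → 1ℤ) ⟨
      weighted U (λ _ → 1ℤ)
        ≡⟨ weighted-one P U ⟩
      w ∣ U ∣
        ≡⟨ cong w eq ⟩
      w (suc n) ∎
    w∣U─U∣ : w ∣ U ─ U ∣ ≡ 1ℤ
    w∣U─U∣ = trans (cong w (ℕ.n≤0⇒n≡0 (ℕ.≮⇒≥ λ pos → no-member pos))) w-zero
      where
      no-member : ¬ (0 < ∣ U ─ U ∣)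
      no-member pos with ∣ U ─ U ∣ in e
      ... | suc m = let y , y∈ = ∣p∣≡1+n⇒nonempty (U ─ U) e in x∈p─q⇒x∉q {p = U} y∈ (x∈p─q⇒x∈p y∈)
    expand : ∀ a b c d → a *ᶻ ((b -ᶻ c) *ᶻ d) ≡ a *ᶻ (b *ᶻ d) +ᶻ -1ℤ *ᶻ (a *ᶻ (c *ᶻ d))
    expand = solve-∀
    only-U : ∀ S → 𝟙 (S ≟ˢ U) *ᶻ excess S ≡
             𝟙 (x ∈ S ⊆? U) *ᶻ (spanned x S *ᶻ w ∣ U ─ S ∣) +ᶻ
             -1ℤ *ᶻ (𝟙 (x ∈ S ⊆? U) *ᶻ (connectedCount ∣ S ∣ *ᶻ w ∣ U ─ S ∣))
    only-U S = trans (lemma S (S ≟ˢ U) (x ∈ S ⊆? U))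
                     (expand (𝟙 (x ∈ S ⊆? U)) (spanned x S) (connectedCount ∣ S ∣) (w ∣ U ─ S ∣))
      where
      lemma : ∀ S (d : Dec (S ≡ U)) (e : Dec (x ∈ S × S ⊆ U)) → 𝟙 d *ᶻ excess S ≡ 𝟙 e *ᶻ (excess S *ᶻ w ∣ U ─ S ∣)
      lemma S (yes refl) e = begin
        1ℤ *ᶻ excess U                       ≡⟨ cong (1ℤ *ᶻ_) (trans (cong (excess U *ᶻ_) w∣U─U∣) (ℤ.*-identityʳ (excess U))) ⟨
        1ℤ *ᶻ (excess U *ᶻ w ∣ U ─ U ∣)      ≡⟨ cong (_*ᶻ (excess U *ᶻ w ∣ U ─ U ∣)) (𝟙-yes e (x∈U , id)) ⟨
        𝟙 e *ᶻ (excess U *ᶻ w ∣ U ─ U ∣)     ∎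
      lemma S (no S≢U) (no _) = refl
      lemma S (no S≢U) (yes (x∈S , S⊆U)) = sym (begin
        1ℤ *ᶻ (excess S *ᶻ w ∣ U ─ S ∣)
          ≡⟨ cong (λ v → 1ℤ *ᶻ (v *ᶻ w ∣ U ─ S ∣)) (ℤ.i≡j⇒i-j≡0 (IH S x∈S ∣S∣≤n)) ⟩
        0ℤ *ᶻ excess S ∎)
        where
        ∣S∣≤n : ∣ S ∣ ≤ n
        ∣S∣≤n = s≤s⁻¹ (subst (∣ S ∣ <_) eq (ℕ.≰⇒> (λ le → S≢U (p⊆q∧∣q∣≤∣p∣⇒p≡q S⊆U le))))

  -- The induction is on a bound N and for all k at once, because its hypothesis is used both for
  -- subsets of U and for subsets of the full set of n + 1 polygons.
  spanned-size-≤ : ∀ N {k} (U : Subset k) {x} → x ∈ U → ∣ U ∣ ≤ N → spanned x U ≡ connectedCount ∣ U ∣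
  defect≡0 : ∀ n → defect n ≡ 0ℤ

  spanned-size-≤ zero    U x∈U le = ⊥-elim (∣p∣≡0⇒∉ (ℕ.n≤0⇒n≡0 le) x∈U)
  spanned-size-≤ (suc N) {k} U {x} x∈U le = ℤ.i-j≡0⇒i≡j _ _ (trans
    (spanned-defect U x∈U ∣U∣≡ (λ S x∈S ∣S∣≤ → spanned-size-≤ N S x∈S (ℕ.≤-trans ∣S∣≤ n≤N)))
    (trans (sym (spanned-defect {suc n} ⊤ {zero} Vec.here (Subset.∣⊤∣≡n (suc n))
                  (λ S x∈S ∣S∣≤ → spanned-size-≤ N S x∈S (ℕ.≤-trans ∣S∣≤ n≤N))))
           (ℤ.i≡j⇒i-j≡0 (cong connectedCount (sym (Subset.∣⊤∣≡n (suc n)))))))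
    where
    n : ℕ
    n = ∣ U - x ∣
    ∣U∣≡ : ∣ U ∣ ≡ suc n
    ∣U∣≡ = ∣p∣≡1+∣p-x∣ x∈U
    n≤N : n ≤ N
    n≤N = s≤s⁻¹ (subst (_≤ suc N) ∣U∣≡ le)

  defect≡0 n = trans
    (sym (spanned-defect {suc n} ⊤ {zero} Vec.here (Subset.∣⊤∣≡n (suc n)) (λ S x∈S _ → spanned-size-≤ ∣ S ∣ S x∈S ℕ.≤-refl)))
    (ℤ.i≡j⇒i-j≡0 (cong connectedCount (sym (Subset.∣⊤∣≡n (suc n)))))

  -- The comparison with full sets is a hypothesis here, so that `weighted-size-≤` can supply it by
  -- induction for U and for the full set alike.
  weighted-suc : ∀ {k n} (U : Subset k) → ∣ U ∣ ≡ suc n → ∀ φ →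
    (∀ (V : Subset k) → ∣ V ∣ ≤ n → weighted V (φ ∘ suc) ≡ weight (φ ∘ suc) ∣ V ∣) →
    weighted U φ ≡ binomialSum n (λ i j → connectedCount (suc i) *ᶻ weight (φ ∘ suc) j)
  weighted-suc {k} {n} U eq φ IH = begin
    weighted U φ
      ≡⟨ Counting.weighted-rec P x∈U φ ⟩
    ∑ (subsets k) (λ S → 𝟙 (x ∈ S ⊆? U) *ᶻ (spanned x S *ᶻ weighted (U ─ S) (φ ∘ suc)))
      ≡⟨ ∑-cong (subsets k) (λ S → 𝟙-guard (x ∈ S ⊆? U) (λ (x∈S , _) →
           cong₂ _*ᶻ_ (spanned-size-≤ ∣ S ∣ S x∈S ℕ.≤-refl)
                      (IH (U ─ S) (s≤s⁻¹ (subst (∣ U ─ S ∣ <_) eq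
                        (Subset.p∩q≢∅⇒∣p─q∣<∣p∣ U S (x , Subset.x∈p∩q⁺ (x∈U , x∈S)))))))) ⟩
    ∑ (subsets k) (λ S → 𝟙 (x ∈ S ⊆? U) *ᶻ (connectedCount ∣ S ∣ *ᶻ weight (φ ∘ suc) ∣ U ─ S ∣))
      ≡⟨ ∑-∈⊆ U (λ i j → connectedCount i *ᶻ weight (φ ∘ suc) j) x∈U eq ⟩
    binomialSum n (λ i j → connectedCount (suc i) *ᶻ weight (φ ∘ suc) j) ∎
    where
    x = proj₁ (∣p∣≡1+n⇒nonempty U eq)
    x∈U = proj₂ (∣p∣≡1+n⇒nonempty U eq)

  weighted-size-≤ : ∀ N {k} (U : Subset k) φ → ∣ U ∣ ≤ N → weighted U φ ≡ weight φ ∣ U ∣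
  weighted-size-≤ N U φ le with ∣ U ∣ in eq
  weighted-size-≤ N       U φ le       | zero  = trans (Counting.weighted-empty P {U} eq φ) (sym (Counting.weighted-empty {0} P {⊤} refl φ))
  weighted-size-≤ (suc N) U φ (s≤s le) | suc n = trans
    (weighted-suc U eq φ (λ V ∣V∣≤ → weighted-size-≤ N V (φ ∘ suc) (ℕ.≤-trans ∣V∣≤ le)))
    (sym (weighted-suc {suc n} ⊤ (Subset.∣⊤∣≡n (suc n)) φ (λ V ∣V∣≤ → weighted-size-≤ N V (φ ∘ suc) (ℕ.≤-trans ∣V∣≤ le))))

  weighted-size : ∀ {k} (U : Subset k) φ → weighted U φ ≡ weight φ ∣ U ∣
  weighted-size U φ = weighted-size-≤ ∣ U ∣ U φ ℕ.≤-refl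

  weight-zero : ∀ φ → weight φ 0 ≡ φ 0
  weight-zero = Counting.weighted-empty {0} P {⊤} refl

  weight-suc : ∀ φ n → weight φ (suc n) ≡ binomialSum n (λ i j → connectedCount (suc i) *ᶻ weight (φ ∘ suc) j)
  weight-suc φ n = weighted-suc {suc n} ⊤ (Subset.∣⊤∣≡n (suc n)) φ (λ V _ → weighted-size V (φ ∘ suc))

  weight-one : ∀ n → weight (λ _ → 1ℤ) n ≡ w n
  weight-one n = trans (weighted-one {n} P ⊤) (cong w (Subset.∣⊤∣≡n n))

-- Signs and the counting sequences of surfaces

-- (-1)^n, in a form where the shift `sgn ∘ suc` made by the recursion reduces to a change of sign.
sgn : ℕ → ℤ
sgn zero    = 1ℤ
sgn (suc n) = -ᶻ sgn n

sgn-≡ : ∀ n → sgn n ≡ 𝟙 (2 ∣? n) -ᶻ 𝟙 (¬? (2 ∣? n))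
sgn-≡ zero          = refl
sgn-≡ (suc zero)    = refl
sgn-≡ (suc (suc n)) = begin
  -ᶻ -ᶻ sgn n                                          ≡⟨ ℤ.neg-involutive (sgn n) ⟩
  sgn n                                                ≡⟨ sgn-≡ n ⟩
  𝟙 (2 ∣? n) -ᶻ 𝟙 (¬? (2 ∣? n))
    ≡⟨ cong₂ _-ᶻ_ (𝟙-⇔ (2 ∣? n) (2 ∣? (2 + n)) up down) (𝟙-⇔ (¬? (2 ∣? n)) (¬? (2 ∣? (2 + n))) (_∘ down) (_∘ up)) ⟩
  𝟙 (2 ∣? (2 + n)) -ᶻ 𝟙 (¬? (2 ∣? (2 + n)))          ∎
  where
  up : 2 ∣ n → 2 ∣ 2 + n
  up = ∣m∣n⇒∣m+n ∣-refl
  down : 2 ∣ 2 + n → 2 ∣ n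
  down d = ∣m+n∣m⇒∣n d ∣-refl

∣sgn∣≤1 : ∀ n → ℤ.∣ sgn n ∣ ≤ 1
∣sgn∣≤1 zero    = ℕ.≤-refl
∣sgn∣≤1 (suc n) = subst (_≤ 1) (sym (ℤ.∣-i∣≡∣i∣ (sgn n))) (∣sgn∣≤1 n)

∣𝟙∣≤1 : ∀ {A : Set} (d : Dec A) → ℤ.∣ 𝟙 d ∣ ≤ 1
∣𝟙∣≤1 (yes _) = ℕ.≤-refl
∣𝟙∣≤1 (no _)  = z≤n

∑-applyUpTo : ∀ {A : Set} (h : ℕ → A) n f → ∑ (applyUpTo h n) f ≡ ∑< n (f ∘ h)
∑-applyUpTo h zero    f = refl
∑-applyUpTo h (suc n) f = cong (f (h 0) +ᶻ_) (∑-applyUpTo (h ∘ suc) n f)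

∑<-once : ∀ {n j} → j < n → ∑< n (λ i → 𝟙 (j ≟ i)) ≡ 1ℤ
∑<-once {suc n} {zero}  _         = cong (1ℤ +ᶻ_) (∑<-zero n (λ i _ → 𝟙-no (0 ≟ suc i) λ ()))
∑<-once {suc n} {suc j} (s≤s j<n) = trans (ℤ.+-identityˡ _)
  (trans (∑<-cong n (λ i _ → 𝟙-⇔ (suc j ≟ suc i) (j ≟ i) ℕ.suc-injective (cong suc))) (∑<-once j<n))

module Enumeration (P : ℕ) where

  open Sizes P

  -- α m counts the surfaces with m components; u counts surfaces with the sign
  -- of the parity of the number of components.
  α : ℕ → ℕ → ℤ
  α m = weight (λ j → 𝟙 (j ≟ m))

  u : ℕ → ℤ
  u = weight sgn

  weight-cong : ∀ {φ ψ} → (∀ j → φ j ≡ ψ j) → ∀ n → weight φ n ≡ weight ψ n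
  weight-cong eq n = ∑-cong (Counting.gluings {n} P) (λ s → cong (𝟙 (isSurface? {n} P ⊤ s) *ᶻ_) (eq _))

  weight-*ˡ : ∀ c φ n → weight (λ j → c *ᶻ φ j) n ≡ c *ᶻ weight φ n
  weight-*ˡ c φ n = trans (∑-cong (Counting.gluings {n} P) (λ s → swap (𝟙 (isSurface? {n} P ⊤ s)) c (φ (π₀ {n} P ⊤ s))))
                          (∑-*ˡ c (Counting.gluings {n} P) _)
    where
    swap : ∀ a b d → a *ᶻ (b *ᶻ d) ≡ b *ᶻ (a *ᶻ d)
    swap = solve-∀

  guard-≤ : ∀ {A : Set} (d : Dec A) {x} → ℤ.∣ x ∣ ≤ 1 → + ℤ.∣ 𝟙 d *ᶻ x ∣ ℤ.≤ 𝟙 d *ᶻ 1ℤ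
  guard-≤ (yes _) {x} le = ℤ.+≤+ (subst (λ y → ℤ.∣ y ∣ ≤ 1) (sym (ℤ.*-identityˡ x)) le)
  guard-≤ (no _)      _  = ℤ.≤-refl

  -- Used twice: for boundedness by `W`, and for vanishing at the sizes that carry no surface.
  ∣weight∣≤ : ∀ φ → (∀ j → ℤ.∣ φ j ∣ ≤ 1) → ∀ n → ℤ.∣ weight φ n ∣ ≤ surfaceCount n
  ∣weight∣≤ φ le n = ℤ.drop‿+≤+ (subst (+ ℤ.∣ weight φ n ∣ ℤ.≤_) (weight-one n)
    (∑-nonneg-≤ (Counting.gluings {n} P) (λ s → guard-≤ (isSurface? {n} P ⊤ s) (le (π₀ {n} P ⊤ s)))))

  ∣connectedCount∣≤ : ∀ n → ℤ.∣ connectedCount n ∣ ≤ surfaceCount n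
  ∣connectedCount∣≤ zero    = z≤n
  ∣connectedCount∣≤ (suc n) = ℤ.drop‿+≤+ (subst (+ ℤ.∣ connectedCount (suc n) ∣ ℤ.≤_) (weight-one (suc n))
    (∑-nonneg-≤ (Counting.gluings {suc n} P) (λ s →
      subst (λ v → + ℤ.∣ v ∣ ℤ.≤ 𝟙 (isSurface? {suc n} P ⊤ s) *ᶻ 1ℤ)
            (sym (𝟙-× (isSurface? {suc n} P ⊤ s) (Gluing.spanned? {suc n} P zero ⊤ s)))
            (guard-≤ (isSurface? {suc n} P ⊤ s) (∣𝟙∣≤1 (Gluing.spanned? {suc n} P zero ⊤ s))))))

  ∣α∣≤ : ∀ m n → ℤ.∣ α m n ∣ ≤ surfaceCount n
  ∣α∣≤ m = ∣weight∣≤ (λ j → 𝟙 (j ≟ m)) (λ j → ∣𝟙∣≤1 (j ≟ m))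

  ∣u∣≤ : ∀ n → ℤ.∣ u n ∣ ≤ surfaceCount n
  ∣u∣≤ = ∣weight∣≤ sgn ∣sgn∣≤1

  w-suc : ∀ n → w (suc n) ≡ binomialSum n (λ i j → connectedCount (suc i) *ᶻ w j)
  w-suc n = ℤ.i-j≡0⇒i≡j _ _ (defect≡0 n)

  binomialSum-cong : ∀ n {F G} → (∀ i j → F i j ≡ G i j) → binomialSum n F ≡ binomialSum n G
  binomialSum-cong zero    eq = eq 0 0
  binomialSum-cong (suc n) eq = cong₂ _+ᶻ_ (binomialSum-cong n (λ i j → eq (suc i) j)) (binomialSum-cong n (λ i j → eq i (suc j)))

  α-suc : ∀ m n → α (suc m) (suc n) ≡ binomialSum n (λ i j → connectedCount (suc i) *ᶻ α m j)
  α-suc m n = trans (weight-suc (λ j → 𝟙 (j ≟ suc m)) n) (binomialSum-cong n (λ i j → cong (connectedCount (suc i) *ᶻ_)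
    (weight-cong (λ l → 𝟙-⇔ (suc l ≟ suc m) (l ≟ m) ℕ.suc-injective (cong suc)) j)))

  -- A nonempty surface has a component: the shifted weight is identically 0, and linearity with the
  -- scalar 0 concludes.
  α₀-suc : ∀ n → α 0 (suc n) ≡ 0ℤ
  α₀-suc n = trans (weight-suc (λ j → 𝟙 (j ≟ 0)) n) (trans
    (binomialSum-cong n (λ i j → trans (cong (connectedCount (suc i) *ᶻ_) (weight-*ˡ 0ℤ (λ _ → 0ℤ) j)) (ℤ.*-zeroʳ (connectedCount (suc i)))))
    (null n))
    where
    null : ∀ n → binomialSum n (λ _ _ → 0ℤ) ≡ 0ℤ
    null zero    = refl
    null (suc n) = cong₂ _+ᶻ_ (null n) (null n)

  u-suc : ∀ n → u (suc n) ≡ binomialSum n (λ i j → connectedCount (suc i) *ᶻ (-1ℤ *ᶻ u j))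
  u-suc n = trans (weight-suc sgn n) (binomialSum-cong n (λ i j → cong (connectedCount (suc i) *ᶻ_)
    (trans (weight-cong (λ l → sym (ℤ.-1*i≡-i (sgn l))) j) (weight-*ˡ -1ℤ sgn j))))

  ∑-surfaces : ∀ {k} (U : Subset k) f → ∑ (surfaces P U) f ≡ ∑ (Counting.gluings {k} P) (λ s → 𝟙 (isSurface? P U s) *ᶻ f s)
  ∑-surfaces {k} U f = ∑-filter (isSurface? P U) (Counting.gluings {k} P) f

  length-surfaces : ∀ n → length (surfaces P (⊤ {n})) ≡ surfaceCount n
  length-surfaces n = ℤ.+-injective (begin
    + length (surfaces P (⊤ {n}))
      ≡⟨ length-filter≡∑ (isSurface? {n} P ⊤) (Counting.gluings {n} P) ⟩
    ∑ (Counting.gluings {n} P) (λ s → 𝟙 (isSurface? {n} P ⊤ s))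
      ≡⟨ ∑-cong (Counting.gluings {n} P) (λ s → sym (ℤ.*-identityʳ _)) ⟩
    weight (λ _ → 1ℤ) n
      ≡⟨ weight-one n ⟩
    w n ∎)

  length-surfaces-π₀ : ∀ m n → + length (filter (λ s → π₀ P (⊤ {n}) s ≟ m) (surfaces P (⊤ {n}))) ≡ α m n
  length-surfaces-π₀ m n = trans (length-filter≡∑ (λ s → π₀ P (⊤ {n}) s ≟ m) (surfaces P (⊤ {n}))) (∑-surfaces {n} ⊤ _)

  -- The difference of the two cardinalities is a sum signed by the parity of the second surface,
  -- and for each label set U it factors into a sum over each of the two surfaces.
  𝔡-≡ : ∀ k m → 𝔡 P k m ≡ binomialSum k (λ i j → α (m ∸ 1) i *ᶻ u j)
  𝔡-≡ k m = begin
    + length (filter (even? {P} {k} m) (allSurfacePairs P k)) -ᶻ + length (filter (odd? {P} {k} m) (allSurfacePairs P k))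
      ≡⟨ cong₂ _-ᶻ_ (length-filter≡∑ (even? {P} {k} m) (allSurfacePairs P k)) (length-filter≡∑ (odd? {P} {k} m) (allSurfacePairs P k)) ⟩
    ∑ (allSurfacePairs P k) (λ t → 𝟙 (even? {P} {k} m t)) -ᶻ ∑ (allSurfacePairs P k) (λ t → 𝟙 (odd? {P} {k} m t))
      ≡⟨ cong (∑ (allSurfacePairs P k) (λ t → 𝟙 (even? {P} {k} m t)) +ᶻ_)
           (trans (sym (ℤ.-1*i≡-i _)) (sym (∑-*ˡ -1ℤ (allSurfacePairs P k) (λ t → 𝟙 (odd? {P} {k} m t))))) ⟩
    ∑ (allSurfacePairs P k) (λ t → 𝟙 (even? {P} {k} m t)) +ᶻ ∑ (allSurfacePairs P k) (λ t → -1ℤ *ᶻ 𝟙 (odd? {P} {k} m t))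
      ≡⟨ ∑-+ (allSurfacePairs P k) _ _ ⟨
    ∑ (allSurfacePairs P k) (λ t → 𝟙 (even? {P} {k} m t) +ᶻ -1ℤ *ᶻ 𝟙 (odd? {P} {k} m t))
      ≡⟨ ∑-cong (allSurfacePairs P k) signed ⟩
    ∑ (allSurfacePairs P k) g
      ≡⟨ ∑-concatMap (surfacePairs P k) (upTo (suc k)) g ⟩
    ∑ (upTo (suc k)) (λ i → ∑ (surfacePairs P k i) g)
      ≡⟨ ∑-cong (upTo (suc k)) (λ i → trans
           (∑-concatMap pairsOn (filter (λ U → ∣ U ∣ ≟ i) (subsets k)) g)
           (trans (∑-filter (λ U → ∣ U ∣ ≟ i) (subsets k) (λ U → ∑ (pairsOn U) g))
                  (∑-cong (subsets k) (λ U → cong (𝟙 (∣ U ∣ ≟ i) *ᶻ_) (on U))))) ⟩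
    ∑ (upTo (suc k)) (λ i → ∑ (subsets k) (λ U → 𝟙 (∣ U ∣ ≟ i) *ᶻ h U))
      ≡⟨ ∑-swap (upTo (suc k)) (subsets k) (λ i U → 𝟙 (∣ U ∣ ≟ i) *ᶻ h U) ⟩
    ∑ (subsets k) (λ U → ∑ (upTo (suc k)) (λ i → 𝟙 (∣ U ∣ ≟ i) *ᶻ h U))
      -- Exactly one i ≤ k is the size of U, so letting i vary visits every U once.
      ≡⟨ ∑-cong (subsets k) (λ U → trans (∑-*ʳ (h U) (upTo (suc k)) (λ i → 𝟙 (∣ U ∣ ≟ i)))
           (trans (cong (_*ᶻ h U) (trans (∑-applyUpTo id (suc k) (λ i → 𝟙 (∣ U ∣ ≟ i))) (∑<-once (s≤s (Subset.∣p∣≤n U)))))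
                  (ℤ.*-identityˡ (h U)))) ⟩
    ∑ (subsets k) h
      ≡⟨ ∑-cong (subsets k) (λ U → cong₂ _*ᶻ_ (weighted-size U (λ j → 𝟙 (j ≟ m ∸ 1))) (weighted-size (∁ U) sgn)) ⟩
    ∑ (subsets k) (λ U → α (m ∸ 1) ∣ U ∣ *ᶻ u ∣ ∁ U ∣)
      ≡⟨ ∑-∁ k (λ i j → α (m ∸ 1) i *ᶻ u j) ⟩
    binomialSum k (λ i j → α (m ∸ 1) i *ᶻ u j) ∎
    where
    g : SurfacePair P k → ℤ
    g (U , s′ , s″) = 𝟙 (π₀ P U s′ ≟ m ∸ 1) *ᶻ sgn (π₀ P (∁ U) s″)
    h : Subset k → ℤ
    h U = weighted U (λ j → 𝟙 (j ≟ m ∸ 1)) *ᶻ weighted (∁ U) sgn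
    pairsOn : Subset k → List (SurfacePair P k)
    pairsOn U = map (U ,_) (cartesianProduct (surfaces P U) (surfaces P (∁ U)))
    signed : ∀ t → 𝟙 (even? {P} {k} m t) +ᶻ -1ℤ *ᶻ 𝟙 (odd? {P} {k} m t) ≡ g t
    signed (U , s′ , s″) = begin
      𝟙 (a ×-dec b) +ᶻ -1ℤ *ᶻ 𝟙 (a ×-dec ¬? b)  ≡⟨ cong₂ (λ x y → x +ᶻ -1ℤ *ᶻ y) (𝟙-× a b) (𝟙-× a (¬? b)) ⟩
      𝟙 a *ᶻ 𝟙 b +ᶻ -1ℤ *ᶻ (𝟙 a *ᶻ 𝟙 (¬? b))   ≡⟨ collect (𝟙 a) (𝟙 b) (𝟙 (¬? b)) ⟩
      𝟙 a *ᶻ (𝟙 b -ᶻ 𝟙 (¬? b))                 ≡⟨ cong (𝟙 a *ᶻ_) (sgn-≡ (π₀ P (∁ U) s″)) ⟨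
      𝟙 a *ᶻ sgn (π₀ P (∁ U) s″)               ∎
      where
      a = π₀ P U s′ ≟ m ∸ 1
      b = 2 ∣? π₀ P (∁ U) s″
      collect : ∀ x y z → x *ᶻ y +ᶻ -1ℤ *ᶻ (x *ᶻ z) ≡ x *ᶻ (y -ᶻ z)
      collect = solve-∀
    on : ∀ U → ∑ (pairsOn U) g ≡ h U
    on U = begin
      ∑ (pairsOn U) g
        ≡⟨ ∑-map (U ,_) (cartesianProduct (surfaces P U) (surfaces P (∁ U))) g ⟩
      ∑ (cartesianProduct (surfaces P U) (surfaces P (∁ U))) (λ r → g (U , r))
        ≡⟨ ∑-cartesianProduct (surfaces P U) (surfaces P (∁ U)) (λ r → g (U , r)) ⟩
      ∑ (surfaces P U) (λ s′ → ∑ (surfaces P (∁ U)) (λ s″ → a s′ *ᶻ b s″))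
        ≡⟨ ∑-cong (surfaces P U) (λ s′ → ∑-*ˡ (a s′) (surfaces P (∁ U)) b) ⟩
      ∑ (surfaces P U) (λ s′ → a s′ *ᶻ ∑ (surfaces P (∁ U)) b)
        ≡⟨ ∑-*ʳ (∑ (surfaces P (∁ U)) b) (surfaces P U) a ⟩
      ∑ (surfaces P U) a *ᶻ ∑ (surfaces P (∁ U)) b
        ≡⟨ cong₂ _*ᶻ_ (∑-surfaces U a) (∑-surfaces (∁ U) b) ⟩
      h U ∎
      where
      a b : (Side k P → Side k P) → ℤ
      a s′ = 𝟙 (π₀ P U s′ ≟ m ∸ 1)
      b s″ = sgn (π₀ P (∁ U) s″)

-- Restriction to the sizes that carry surfaces

-- In each block from e n + 1 to e (n + 1), with e = e′ + 1, only the last index is a multiple of e.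
∑<-multiples : ∀ e′ n f → (∀ i → ¬ suc e′ ∣ i → f i ≡ 0ℤ) →
               ∑< (suc (suc e′ * n)) f ≡ ∑< (suc n) (λ i → f (suc e′ * i))
∑<-multiples e′ zero    f vanish rewrite ℕ.*-zeroʳ e′ = refl
∑<-multiples e′ (suc n) f vanish = begin
  ∑< (suc (e * suc n)) f
    ≡⟨ cong (λ m → ∑< m f) (trans (cong suc (ℕ.*-suc e n)) (order e (e * n))) ⟩
  ∑< (suc (e * n) + e) f
    ≡⟨ ∑<-split (suc (e * n)) e f ⟩
  ∑< (suc (e * n)) f +ᶻ ∑< e (λ i → f (suc (e * n) + i))
    ≡⟨ cong₂ _+ᶻ_ (∑<-multiples e′ n f vanish) block ⟩
  ∑< (suc n) (λ i → f (e * i)) +ᶻ f (e * suc n)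
    ≡⟨ ∑<-last (suc n) (λ i → f (e * i)) ⟨
  ∑< (suc (suc n)) (λ i → f (e * i)) ∎
  where
  e : ℕ
  e = suc e′
  order : ∀ a b → suc (a + b) ≡ suc b + a
  order = ℕ-Solver.solve-∀
  between : ∀ i → i < e′ → ¬ e ∣ suc (e * n) + i
  between i i<e′ e∣ = ℕ.<⇒≱ (s≤s i<e′) (∣⇒≤ (∣m+n∣m⇒∣n (subst (e ∣_) (sym (ℕ.+-suc (e * n) i)) e∣) (m∣m*n n)))
  block : ∑< e (λ i → f (suc (e * n) + i)) ≡ f (e * suc n)
  block = begin
    ∑< e (λ i → f (suc (e * n) + i))
      ≡⟨ ∑<-last e′ (λ i → f (suc (e * n) + i)) ⟩
    ∑< e′ (λ i → f (suc (e * n) + i)) +ᶻ f (suc (e * n) + e′)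
      ≡⟨ cong₂ _+ᶻ_ (∑<-zero e′ (λ i i<e′ → vanish (suc (e * n) + i) (between i i<e′))) (cong f (trans (order′ (e * n) e′) (sym (ℕ.*-suc e n)))) ⟩
    0ℤ +ᶻ f (e * suc n)
      ≡⟨ ℤ.+-identityˡ (f (e * suc n)) ⟩
    f (e * suc n) ∎
    where
    order′ : ∀ a b → suc a + b ≡ suc b + a
    order′ = ℕ-Solver.solve-∀

absorption : ∀ i j → (suc (i + j) C suc i) * suc i ≡ suc (i + j) * ((i + j) C i)
absorption i j = ℕ.*-cancelʳ-≡ _ _ (i ! * j !) {{i ℕ.!* j !≢0}} (begin
  (suc (i + j) C suc i) * suc i * (i ! * j !)     ≡⟨ shuffle (suc (i + j) C suc i) (suc i) (i !) (j !) ⟩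
  (suc (i + j) C suc i) * (suc i * i ! * j !)     ≡⟨ choose-! (suc i) j ⟩
  suc (i + j) * (i + j) !                         ≡⟨ cong (suc (i + j) *_) (choose-! i j) ⟨
  suc (i + j) * (((i + j) C i) * (i ! * j !))     ≡⟨ ℕ.*-assoc (suc (i + j)) ((i + j) C i) (i ! * j !) ⟨
  suc (i + j) * ((i + j) C i) * (i ! * j !)       ∎)
  where
  shuffle : ∀ a b c d → a * b * (c * d) ≡ a * (b * c * d)
  shuffle = ℕ-Solver.solve-∀

-- The hypothesis is f′ = c′ g for exponential generating functions; it is
-- multiplied by z.
binomial-derivative : ∀ (f c g : ℕ → ℤ) → (∀ n → f (suc n) ≡ binomialSum n (λ i j → c (suc i) *ᶻ g j)) →
  ∀ n → + n *ᶻ f n ≡ ∑< (suc n) (λ i → + (n C i) *ᶻ ((+ i *ᶻ c i) *ᶻ g (n ∸ i)))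
binomial-derivative f c g rec zero = refl
binomial-derivative f c g rec (suc n) = begin
  + suc n *ᶻ f (suc n)
    ≡⟨ cong (+ suc n *ᶻ_) (trans (rec n) (binomialSum-≡ n (λ i j → c (suc i) *ᶻ g j))) ⟩
  + suc n *ᶻ ∑< (suc n) (λ i → + (n C i) *ᶻ (c (suc i) *ᶻ g (n ∸ i)))
    ≡⟨ ∑<-*ˡ (+ suc n) (suc n) (λ i → + (n C i) *ᶻ (c (suc i) *ᶻ g (n ∸ i))) ⟨
  ∑< (suc n) (λ i → + suc n *ᶻ (+ (n C i) *ᶻ (c (suc i) *ᶻ g (n ∸ i))))
    ≡⟨ ∑<-cong (suc n) (λ i i<n → entry i (s≤s⁻¹ i<n)) ⟩
  ∑< (suc n) (λ i → + (suc n C suc i) *ᶻ ((+ suc i *ᶻ c (suc i)) *ᶻ g (n ∸ i)))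
    ≡⟨ ℤ.+-identityˡ _ ⟨
  0ℤ +ᶻ ∑< (suc n) (λ i → + (suc n C suc i) *ᶻ ((+ suc i *ᶻ c (suc i)) *ᶻ g (n ∸ i)))
    ≡⟨ cong (_+ᶻ ∑< (suc n) (λ i → + (suc n C suc i) *ᶻ ((+ suc i *ᶻ c (suc i)) *ᶻ g (n ∸ i))))
         (null (+ (suc n C 0)) (c 0) (g (suc n))) ⟨
  ∑< (suc (suc n)) (λ i → + (suc n C i) *ᶻ ((+ i *ᶻ c i) *ᶻ g (suc n ∸ i))) ∎
  where
  null : ∀ a b x → a *ᶻ ((0ℤ *ᶻ b) *ᶻ x) ≡ 0ℤ
  null = solve-∀
  shuffle : ∀ a b x y → a *ᶻ (b *ᶻ (x *ᶻ y)) ≡ (a *ᶻ b) *ᶻ (x *ᶻ y)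
  shuffle = solve-∀
  shuffle′ : ∀ a b x y → (a *ᶻ b) *ᶻ (x *ᶻ y) ≡ a *ᶻ ((b *ᶻ x) *ᶻ y)
  shuffle′ = solve-∀
  entry : ∀ i → i ≤ n → + suc n *ᶻ (+ (n C i) *ᶻ (c (suc i) *ᶻ g (n ∸ i))) ≡
                        + (suc n C suc i) *ᶻ ((+ suc i *ᶻ c (suc i)) *ᶻ g (n ∸ i))
  entry i i≤n = begin
    + suc n *ᶻ (+ (n C i) *ᶻ (c (suc i) *ᶻ g (n ∸ i)))
      ≡⟨ shuffle (+ suc n) (+ (n C i)) (c (suc i)) (g (n ∸ i)) ⟩
    (+ suc n *ᶻ + (n C i)) *ᶻ (c (suc i) *ᶻ g (n ∸ i))
      ≡⟨ cong (_*ᶻ (c (suc i) *ᶻ g (n ∸ i))) (trans (sym (ℤ.pos-* (suc n) (n C i))) (trans (cong +_ (sym absorb)) (ℤ.pos-* (suc n C suc i) (suc i)))) ⟩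
    (+ (suc n C suc i) *ᶻ + suc i) *ᶻ (c (suc i) *ᶻ g (n ∸ i))
      ≡⟨ shuffle′ (+ (suc n C suc i)) (+ suc i) (c (suc i)) (g (n ∸ i)) ⟩
    + (suc n C suc i) *ᶻ ((+ suc i *ᶻ c (suc i)) *ᶻ g (n ∸ i)) ∎
    where
    absorb : (suc n C suc i) * suc i ≡ suc n * (n C i)
    absorb = subst (λ m → (suc m C suc i) * suc i ≡ suc m * (m C i)) (ℕ.m+[n∸m]≡n i≤n) (absorption i (n ∸ i))

-- Only sizes divisible by e = suc e′ carry surfaces, so everything is read off
-- along the multiples of e: e = 1 for even P and e = 2 for odd P.
module Lattice (P e′ q : ℕ) (e<q : suc e′ < q) (P*e≡2*q : P * suc e′ ≡ 2 * q)
               (vanish : ∀ i → ¬ suc e′ ∣ i → matchings (P * i) ≡ 0) where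

  e : ℕ
  e = suc e′

  open Sizes P using (connectedCount; surfaceCount; weight-zero)
  open Enumeration P
  open Growth e q e<q using (B; W)
  open Convolution e q e<q
  open Asymptotics e q e<q using (w; _∼_)
  open Singularity e q e<q using (Bounded; bounded; d; α∼d)
  open Transfer e q e<q

  scaled : (ℕ → ℤ) → ℕ → ℤ
  scaled f n = f (e * n)

  size-≡ : ∀ n → P * (e * n) ≡ 2 * (q * n)
  size-≡ n = trans (sym (ℕ.*-assoc P e n)) (trans (cong (_* n) P*e≡2*q) (ℕ.*-assoc 2 q n))

  surfaceCount-W : ∀ n → surfaceCount (e * n) ≡ W n
  surfaceCount-W n = cong matchings (size-≡ n)

  vanishing : ∀ (f : ℕ → ℤ) → (∀ n → ℤ.∣ f n ∣ ≤ surfaceCount n) → ∀ i → ¬ e ∣ i → f i ≡ 0ℤ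
  vanishing f le i ¬e∣i = ℤ.∣i∣≡0⇒i≡0 (ℕ.n≤0⇒n≡0 (subst (ℤ.∣ f i ∣ ≤_) (vanish i ¬e∣i) (le i)))

  -- Between multiples of e the binomial coefficients are the values of `B`, so the terms that
  -- survive are those of `⋆`.
  lattice-sum : ∀ (f g : ℕ → ℤ) → (∀ i → ¬ e ∣ i → f i ≡ 0ℤ) → ∀ n →
    ∑< (suc (e * n)) (λ i → + ((e * n) C i) *ᶻ (f i *ᶻ g (e * n ∸ i))) ≡ (scaled f ⋆ scaled g) n
  lattice-sum f g f-vanishes n = trans
    (∑<-multiples e′ n (λ i → + ((e * n) C i) *ᶻ (f i *ᶻ g (e * n ∸ i)))
      (λ i ¬e∣i → trans (cong (λ x → + ((e * n) C i) *ᶻ (x *ᶻ g (e * n ∸ i))) (f-vanishes i ¬e∣i))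
                        (trans (cong (+ ((e * n) C i) *ᶻ_) (ℤ.*-zeroˡ (g (e * n ∸ i)))) (ℤ.*-zeroʳ (+ ((e * n) C i))))))
    (∑<-cong (suc n) (λ i _ → cong (λ m → + B n i *ᶻ (f (e * i) *ᶻ g m)) (sym (ℕ.*-distribˡ-∸ e n i))))

  -- At size e n the operator z d/dz multiplies by e n, but `D` only by n; the factor e appears on
  -- both sides and is cancelled.
  derivative : ∀ (f g : ℕ → ℤ) → (∀ n → f (suc n) ≡ binomialSum n (λ i j → connectedCount (suc i) *ᶻ g j)) →
               D (scaled f) ≐ D (scaled connectedCount) ⋆ scaled g
  derivative f g rec .at n = ℤ.*-cancelˡ-≡ (+ e) (D (scaled f) n) ((D (scaled connectedCount) ⋆ scaled g) n) (begin
    + e *ᶻ (+ n *ᶻ f (e * n))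
      ≡⟨ ℤ.*-assoc (+ e) (+ n) (f (e * n)) ⟨
    + e *ᶻ + n *ᶻ f (e * n)
      ≡⟨ cong (_*ᶻ f (e * n)) (ℤ.pos-* e n) ⟨
    + (e * n) *ᶻ f (e * n)
      ≡⟨ binomial-derivative f connectedCount g rec (e * n) ⟩
    ∑< (suc (e * n)) (λ i → + ((e * n) C i) *ᶻ ((+ i *ᶻ connectedCount i) *ᶻ g (e * n ∸ i)))
      ≡⟨ lattice-sum (λ i → + i *ᶻ connectedCount i) g
           (λ i ¬e∣i → trans (cong (+ i *ᶻ_) (vanishing connectedCount ∣connectedCount∣≤ i ¬e∣i)) (ℤ.*-zeroʳ (+ i))) n ⟩
    (scaled (λ i → + i *ᶻ connectedCount i) ⋆ scaled g) n
      ≡⟨ ∑<-cong (suc n) (λ i _ → trans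
           (cong (λ x → + B n i *ᶻ (x *ᶻ connectedCount (e * i) *ᶻ scaled g (n ∸ i))) (ℤ.pos-* e i))
           (pull (+ B n i) (+ e) (+ i) (connectedCount (e * i)) (scaled g (n ∸ i)))) ⟩
    ∑< (suc n) (λ i → + e *ᶻ term (D (scaled connectedCount)) (scaled g) n i)
      ≡⟨ ∑<-*ˡ (+ e) (suc n) (term (D (scaled connectedCount)) (scaled g) n) ⟩
    + e *ᶻ (D (scaled connectedCount) ⋆ scaled g) n ∎)
    where
    pull : ∀ b e i c g → b *ᶻ (e *ᶻ i *ᶻ c *ᶻ g) ≡ e *ᶻ (b *ᶻ (i *ᶻ c *ᶻ g))
    pull = solve-∀

  scaled-w : scaled (λ n → + surfaceCount n) ≐ w
  scaled-w .at n = cong +_ (surfaceCount-W n)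

  D-cong : ∀ {x y} → x ≐ y → D x ≐ D y
  D-cong p .at n = cong (+ n *ᶻ_) (p .at n)

  scaled-bounded : ∀ (f : ℕ → ℤ) → (∀ n → ℤ.∣ f n ∣ ≤ surfaceCount n) → Bounded 1 (scaled f)
  scaled-bounded f le = bounded λ n → ℕ.≤-trans (le (e * n)) (ℕ.≤-reflexive (trans (surfaceCount-W n) (sym (ℕ.*-identityˡ (W n)))))

  α₀≐δ : scaled (α 0) ≐ δ
  α₀≐δ .at zero    = trans (cong (α 0) (ℕ.*-zeroʳ e)) (weight-zero (λ j → 𝟙 (j ≟ 0)))
  α₀≐δ .at (suc n) = trans (cong (α 0) (ℕ.*-suc e n)) (α₀-suc (e′ + e * n))

  coefficient : ℕ → ℕ → ℤ
  coefficient m k = (scaled (α m) ⋆ scaled u) k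

  α-expansion : ∀ m → scaled (α (suc m)) ∼ coefficient m
  α-expansion m = α∼d (scaled connectedCount) (scaled u) (scaled ∘ α)
    (trans (cong u (ℕ.*-zeroʳ e)) (weight-zero sgn)) α₀≐δ
    (D-cong (≐-sym scaled-w) ⟫ derivative (λ n → + surfaceCount n) (λ n → + surfaceCount n) w-suc ⟫ ⋆-congʳ (D (scaled connectedCount)) scaled-w)
    (derivative u (λ j → -1ℤ *ᶻ u j) u-suc ⟫ ⋆-congʳ (D (scaled connectedCount)) (pointwise λ n → ℤ.-1*i≡-i (u (e * n))))
    (λ m → derivative (α (suc m)) (α m) (α-suc m))
    (scaled-bounded u ∣u∣≤) (λ m → scaled-bounded (α m) (∣α∣≤ m)) (suc m)

  𝔡-coefficient : ∀ m k → 𝔡 P (e * k) (suc m) ≡ coefficient m k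
  𝔡-coefficient m k = trans (𝔡-≡ (e * k) (suc m)) (trans (binomialSum-≡ (e * k) (λ i j → α m i *ᶻ u j))
    (lattice-sum (α m) u (vanishing (α m) (∣α∣≤ m)) k))

  surface-expansion : ∀ m → AsymptoticExpansion (λ n → ℙ[π₀≡ suc m ] P (e * n)) (λ k → 𝔡 P (e * k) (suc m)) scaleℚ
  surface-expansion m = expansion-cong
    (λ n → cong (count n //_) (sym (trans (length-surfaces (e * n)) (surfaceCount-W n))))
    (λ k → sym (𝔡-coefficient m k)) (λ _ _ → refl)
    (expansion count (λ n → length-surfaces-π₀ (suc m) (e * n)) (α-expansion m))
    where
    count : ℕ → ℕ
    count n = length (filter (λ s → π₀ P (⊤ {e * n}) s ≟ suc m) (surfaces P (⊤ {e * n})))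

-- The two parities of P

matchings-even : ∀ n → matchings (2 * n) ≡ [ 2 * n -1]!!
matchings-even zero    = refl
matchings-even (suc n) = begin
  matchings (2 * suc n)             ≡⟨ cong matchings (ℕ.*-suc 2 n) ⟩
  suc (2 * n) * matchings (2 * n)   ≡⟨ cong (suc (2 * n) *_) (matchings-even n) ⟩
  suc (2 * n) * [ 2 * n -1]!!       ≡⟨ cong [_-1]!! (ℕ.*-suc 2 n) ⟨
  [ 2 * suc n -1]!!                 ∎

matchings-odd : ∀ n → ¬ 2 ∣ n → matchings n ≡ 0
matchings-odd zero          odd = ⊥-elim (odd (2 ∣0))
matchings-odd (suc zero)    odd = refl
matchings-odd (suc (suc n)) odd = trans (cong (suc n *_) (matchings-odd n (odd ∘ ∣m∣n⇒∣m+n ∣-refl))) (ℕ.*-zeroʳ (suc n))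

even-expansion : ∀ m q → 1 < q → AsymptoticExpansion
  (λ n → ℙ[π₀≡ suc m ] (q * 2) n)
  (λ k → 𝔡 (q * 2) k (suc m))
  (λ k n → ((n C k) // 1) *ℚ ([ q * 2 * (n ∸ k) -1]!! // [ q * 2 * n -1]!!))
even-expansion m q 1<q = expansion-cong
  (λ n → cong (ℙ[π₀≡ suc m ] (q * 2)) (ℕ.*-identityˡ n))
  (λ k → cong (λ j → 𝔡 (q * 2) j (suc m)) (ℕ.*-identityˡ k))
  (λ k n → cong₂ _*ℚ_ (cong₂ (λ i j → (i C j) // 1) (ℕ.*-identityˡ n) (ℕ.*-identityˡ k))
                      (cong₂ _//_ (W≡ (n ∸ k)) (W≡ n)))
  (surface-expansion m)
  where
  -- Here e = 1 and q = P / 2: no size is excluded.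
  open Lattice (q * 2) 0 q 1<q (trans (ℕ.*-identityʳ (q * 2)) (ℕ.*-comm q 2))
    (λ i ¬1∣i → ⊥-elim (¬1∣i (1∣ i)))
  W≡ : ∀ n → matchings (2 * (q * n)) ≡ [ q * 2 * n -1]!!
  W≡ n = trans (matchings-even (q * n)) (cong [_-1]!! (trans (sym (ℕ.*-assoc 2 q n)) (cong (_* n) (ℕ.*-comm 2 q))))

odd-expansion : ∀ m P → 2 < P → ¬ 2 ∣ P → AsymptoticExpansion
  (λ n → ℙ[π₀≡ suc m ] P (2 * n))
  (λ k → 𝔡 P (2 * k) (suc m))
  (λ k n → (((2 * n) C (2 * k)) // 1) *ℚ ([ 2 * P * (n ∸ k) -1]!! // [ 2 * P * n -1]!!))
odd-expansion m P 2<P ¬2∣P = expansion-cong (λ _ → refl) (λ _ → refl)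
  (λ k n → cong ((((2 * n) C (2 * k)) // 1) *ℚ_) (cong₂ _//_ (W≡ (n ∸ k)) (W≡ n)))
  (surface-expansion m)
  where
  odd-* : ∀ i → ¬ 2 ∣ i → ¬ 2 ∣ P * i
  odd-* i ¬2∣i 2∣P*i with euclidsLemma P i prime[2] 2∣P*i
  ... | inj₁ 2∣P = ¬2∣P 2∣P
  ... | inj₂ 2∣i = ¬2∣i 2∣i
  -- Here e = 2 and q = P: for odd i the number P i of sides is odd, so there is no surface of size
  -- i.
  open Lattice P 1 P 2<P (ℕ.*-comm P 2) (λ i ¬2∣i → matchings-odd (P * i) (odd-* i ¬2∣i))
  W≡ : ∀ n → matchings (2 * (P * n)) ≡ [ 2 * P * n -1]!!
  W≡ n = trans (matchings-even (P * n)) (cong [_-1]!! (sym (ℕ.*-assoc 2 P n)))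

proposition4p14 : (m P : ℕ) → 1 ≤ m → 3 ≤ P →
    (2 ∣ P → AsymptoticExpansion
    (λ n → ℙ[π₀≡ m ] P n)
    (λ k → 𝔡 P k m)
    (λ k n → ((n C k) // 1) *ℚ ([ P * (n ∸ k) -1]!! // [ P * n -1]!!)))
    ×
    (¬ 2 ∣ P → AsymptoticExpansion
    (λ n → ℙ[π₀≡ m ] P (2 * n))
    (λ k → 𝔡 P (2 * k) m)
    (λ k n → (((2 * n) C (2 * k)) // 1) *ℚ ([ 2 * P * (n ∸ k) -1]!! // [ 2 * P * n -1]!!)))
proposition4p14 (suc m) P _ 3≤P =
  -- With P = q * 2, the bound 3 ≤ P reads 1 * 2 < q * 2.
  (λ { (divides-refl q) → even-expansion m q (ℕ.*-cancelʳ-< 2 1 q 3≤P) }) ,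
  odd-expansion m P 3≤P
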